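{- Let $n\ge2$, $2\le d\le n$, and $1\le k \le n(n-d+1)$ be integers. Then $$\delta_q^{\mathrm{Her}}(n \times n, k, d) \in O\left(q^{n^2-k+1-(d-1)(2n-d+1)}\right) \quad \text{as } q \to +\infty.$$ Moreover, $\lim_{q \to+\infty}\delta^{\mathrm{Her}}_q(n \times n,k,d)=1$ if $k < n^2+1-(d-1)(2n-d+1)$, and $=0$ if $k > n^2+1-(d-1)(2n-d+1)$.
   Context: For a prime power $q$, $\mathrm{Her}_n(q^2)$ is the set of Hermitian matrices in $\mathbb{F}_{q^2}^{n\times n}$ ($M=M^*$, where $M^*$ is the transpose of $M$ with $x\mapsto x^q$ applied entrywise), an $\mathbb{F}_q$-space of dimension $n^2$. $\delta^{\mathrm{Her}}_q(n\times n,k,d)$ is the number of $k$-dimensional $\mathbb{F}_q$-subspaces of $\mathrm{Her}_n(q^2)$ in which every nonzero matrix has rank at least $d$, divided by the number of all $k$-dimensional $\mathbb{F}_q$-subspaces of $\mathrm{Her}_n(q^2)$. Limits are over prime powers $q$ with $n,k,d$ fixed. -}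

module Defs where

open import Level using (0ℓ)
open import Algebra.Bundles using (CommutativeRing)
open import Data.Nat using (ℕ; zero; suc; _≤_; _*_; _^_)
open import Data.Nat.Primality using (Prime)
open import Data.Bool using (Bool; true; false; _∧_; _∨_; not)
open import Data.Fin using (Fin)
open import Data.List using (List; []; _∷_; map; filter; length; concatMap; foldr; allFin; lookup)
open import Data.Bool.ListAction using (all; any)
open import Data.List.Relation.Unary.Any using (Any)
open import Data.List.Relation.Unary.AllPairs using (AllPairs)
open import Data.Product using (∃; _×_)
open import Data.Vec.Functional as VF using (Vector)
open import Relation.Binary using (Decidable)
open import Relation.Nullary using (¬_; does)
open import Relation.Binary.PropositionalEquality using (_≡_)
import Data.Fin
import Data.Nat
import Data.Bool

IsPrimePower : ℕ → Set
IsPrimePower q = ∃ λ p → ∃ λ e → Prime p × 1 ≤ e × q ≡ p ^ e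

record FiniteField (m : ℕ) : Set₁ where
  field
    cring : CommutativeRing 0ℓ 0ℓ
  open CommutativeRing cring public renaming (_*_ to _·_)
  field
    _≟_      : Decidable _≈_
    0≉1      : ¬ (0# ≈ 1#)
    inverse  : ∀ x → ¬ (x ≈ 0#) → ∃ λ y → x · y ≈ 1#
    elems    : List Carrier
    complete : ∀ x → Any (x ≈_) elems
    distinct : AllPairs (λ x y → ¬ (x ≈ y)) elems
    size     : length elems ≡ m

allFuns : {A : Set} → (k : ℕ) → List A → List (Vector A k)
allFuns zero    xs = (λ ()) ∷ []
allFuns (suc k) xs = concatMap (λ x → map (λ f → x VF.∷ f) (allFuns k xs)) xs

module HermitianCounting (q : ℕ) (F : FiniteField (q * q)) (n : ℕ) where
  open FiniteField F

  _^ᶠ_ : Carrier → ℕ → Carrier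
  x ^ᶠ zero  = 1#
  x ^ᶠ suc m = x · (x ^ᶠ m)

  _==_ : Carrier → Carrier → Bool
  x == y = does (x ≟ y)

  conj : Carrier → Carrier
  conj x = x ^ᶠ q

  Fq : List Carrier
  Fq = filter (λ x → x ≟ conj x) elems

  Mat : Set
  Mat = Fin n → Fin n → Carrier

  allᶠ : (m : ℕ) → (Fin m → Bool) → Bool
  allᶠ m p = all p (allFin m)

  anyᶠ : (m : ℕ) → (Fin m → Bool) → Bool
  anyᶠ m p = any p (allFin m)

  _⇒ᵇ_ : Bool → Bool → Bool
  a ⇒ᵇ b = not a ∨ b

  matEq : Mat → Mat → Bool
  matEq M N = allᶠ n λ i → allᶠ n λ j → M i j == N i j

  zeroM : Mat
  zeroM i j = 0#

  _⊕_ : Mat → Mat → Mat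
  (M ⊕ N) i j = M i j + N i j

  _⊙_ : Carrier → Mat → Mat
  (c ⊙ M) i j = c · M i j

  isHermitian : Mat → Bool
  isHermitian M = allᶠ n λ i → allᶠ n λ j → M j i == conj (M i j)

  -- Her_n(q²), as an explicit (duplicate-free) list
  herList : List Mat
  herList = filter (λ M → Data.Bool._≟_ (isHermitian M) true) (allFuns n (allFuns n elems))

  N : ℕ
  N = length herList

  H : Fin N → Mat
  H = lookup herList

  sumᶠ : (m : ℕ) → (Fin m → Carrier) → Carrier
  sumᶠ m f = foldr _+_ 0# (map f (allFin m))

  rowsIndependent : (d : ℕ) → Mat → (Fin d → Fin n) → Bool
  rowsIndependent d M r =
    all (λ c → (allᶠ n λ j → sumᶠ d (λ i → c i · M (r i) j) == 0#)
               ⇒ᵇ (allᶠ d λ i → c i == 0#))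
        (allFuns d elems)

  injectiveᵇ : (d : ℕ) → (Fin d → Fin n) → Bool
  injectiveᵇ d r = allᶠ d λ i → allᶠ d λ j →
    does (Data.Fin._≟_ (r i) (r j)) ⇒ᵇ does (Data.Fin._≟_ i j)

  rankAtLeast : (d : ℕ) → Mat → Bool
  rankAtLeast d M = any (λ r → injectiveᵇ d r ∧ rowsIndependent d M r) (allFuns d (allFin n))

  Subset : Set
  Subset = Fin N → Bool

  allSubsets : List Subset
  allSubsets = allFuns N (true ∷ false ∷ [])

  memᵇ : Subset → Mat → Bool
  memᵇ S M = anyᶠ N λ i → S i ∧ matEq (H i) M

  card : Subset → ℕ
  card S = length (filter (λ i → Data.Bool._≟_ (S i) true) (allFin N))

  isFqSubspace : Subset → Bool
  isFqSubspace S =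
    memᵇ S zeroM
    ∧ (allᶠ N λ i → allᶠ N λ j → (S i ∧ S j) ⇒ᵇ memᵇ S (H i ⊕ H j))
    ∧ all (λ c → allᶠ N λ i → S i ⇒ᵇ memᵇ S (c ⊙ H i)) Fq

  -- an F_q-subspace has F_q-dimension k iff it has q^k elements
  hasDim : ℕ → Subset → Bool
  hasDim k S = does (Data.Nat._≟_ (card S) (q ^ k))

  minRankAtLeast : ℕ → Subset → Bool
  minRankAtLeast d S = allᶠ N λ i → S i ⇒ᵇ (matEq (H i) zeroM ∨ rankAtLeast d (H i))

  numSubspaces : ℕ → ℕ
  numSubspaces k = length (filter (λ S → Data.Bool._≟_ (isFqSubspace S ∧ hasDim k S) true) allSubsets)

  numRankSubspaces : ℕ → ℕ → ℕ
  numRankSubspaces k d =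
    length (filter (λ S → Data.Bool._≟_ (isFqSubspace S ∧ hasDim k S ∧ minRankAtLeast d S) true) allSubsets)

{-# OPTIONS --safe #-}

-- Draw x ∈ V^k uniformly, V = Her_n(q²), |V| = q^(n²), and let B be the set of
-- nonzero Hermitian matrices of rank at most r = d − 1. A k-dimensional subspace
-- has q^(k²) spanning candidates, at least half of which are bases, and at least
-- half of all tuples are independent, so up to constant factors δ is the
-- probability that the span of x avoids B.
--
-- * The points x₀ + a·(x₁, …) for a ∈ F_q^(k-1) are pairwise independent and
--   uniform, so Chebyshev's inequality bounds the probability that all of them
--   avoid B by |V| / (q^(k-1) |B|).
-- * Conversely, a union bound over the points of the projective space P(F_q^k)
--   shows that the span meets B with probability O(q^(k-1) |B| / |V|).
-- * |B| has order q^(r(2n-r)): from below, iterate M′ ↦ [a u; u* M′ + a⁻¹u*u];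
--   from above, if r rows span M then M = C A C* with A the corresponding
--   principal r × r minor and C containing an identity block.

module Submission where

open import Defs
open import Algebra.Bundles using (CommutativeMonoid)
import Algebra.Properties.CommutativeMonoid.Sum as CMSum
import Algebra.Properties.CommutativeSemiring.Binomial as Binomial
import Algebra.Properties.CommutativeSemiring.Exp as CExp
import Algebra.Properties.Group as GroupProperties
import Algebra.Properties.Ring as RingProperties
import Algebra.Properties.Semiring.Exp as Exp
import Algebra.Properties.Semiring.Mult as Mult
import Algebra.Properties.Semiring.Sum as SSum
open import Data.Bool using (Bool; true; false; _∧_; _∨_; not)
import Data.Bool as Bool
open import Data.Bool.ListAction using (all; any)
open import Data.Empty using (⊥-elim)
open import Data.Fin using (Fin; zero; suc)
import Data.Fin as Fin
open import Data.Fin.Permutation using (permutation)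
import Data.Fin.Properties as Finₚ
open import Data.List using (List; []; _∷_; _++_; map; filter; length; concatMap; foldr; allFin; tabulate; lookup)
open import Data.List.Membership.Propositional.Properties using (∈-lookup)
import Data.List.Membership.Setoid.Properties as Membershipₚ
open import Data.List.Properties using (length-map; length-++; length-tabulate; length-filter; map-tabulate)
open import Data.List.Relation.Unary.All as All using (All; []; _∷_)
import Data.List.Relation.Unary.All.Properties as Allₚ
open import Data.List.Relation.Unary.AllPairs using (AllPairs; []; _∷_)
import Data.List.Relation.Unary.AllPairs as AllPairs
import Data.List.Relation.Unary.AllPairs.Properties as AllPairsₚ
open import Data.List.Relation.Unary.Any as Any using (Any; here; there)
import Data.List.Relation.Unary.Any.Properties as Anyₚ
open import Data.Nat using (ℕ; zero; suc; _+_; _*_; _∸_; _^_; _≤_; _<_; z≤n; s≤s; NonZero)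
import Data.Nat as ℕ
open import Data.Nat.Combinatorics using (nCk+nC[k+1]≡[n+1]C[k+1]; nCn≡1) renaming (_C_ to _choose_)
open import Data.Nat.Divisibility using (_∣_; divides; ∣⇒≤)
open import Data.Nat.Primality using (Prime; euclidsLemma)
import Data.Nat.Primality as Primality
import Data.Nat.Properties as ℕₚ
open import Data.Nat.Tactic.RingSolver using (solve-∀)
open import Data.Product using (∃; Σ; _×_; _,_; proj₁; proj₂)
open import Data.Sum using (_⊎_; inj₁; inj₂)
open import Data.Vec using (Vec; []; _∷_)
import Data.Vec.Functional as VF
open import Function using (_∘_; id)
open import Level using (0ℓ)
open import Relation.Binary using (Rel; Symmetric)
open import Relation.Binary.PropositionalEquality using (_≡_; _≢_; refl; sym; trans; cong; cong₂; subst; subst₂; module ≡-Reasoning)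
import Relation.Binary.Reasoning.Setoid as SetoidReasoning
open import Relation.Nullary using (¬_; Dec; yes; no; does; contradiction)
open import Relation.Nullary.Decidable using (dec-true)

-- Finite sums and counting

-- Densities appear only as inequalities between products of natural numbers, and constant factors
-- are given away freely. Both limits exclude the critical k, so the two exponents differ by at
-- least one and a whole factor q is left over to beat any constant. This justifies the crude
-- counts: half of all tuples instead of an exact product, and a cover with repetitions instead of
-- the exact number of low-rank matrices. The second moment uses affine points because the
-- coefficient vectors (1, a) and (1, a′) are linearly independent for a ≠ a′. Arbitrary
-- combinations would include proportional ones, whose events coincide. The q^(k-1) affine points
-- are still of the order of all (q^k - 1)/(q - 1) projective points. The claim about half of the
-- tuples rests on (q^k - 1)/(q - 1) ≤ q^k / 2, whence the threshold q ≥ 3. Only a field of order q²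
-- is given, while the linear algebra is over F_q. The scalar field is therefore constructed as the
-- fixed field of x ↦ x^q, and its order is found by bounding roots of polynomials.

∑ : {A : Set} → List A → (A → ℕ) → ℕ
∑ []       f = 0
∑ (x ∷ xs) f = f x + ∑ xs f

⟦_⟧ : Bool → ℕ
⟦ true ⟧  = 1
⟦ false ⟧ = 0

⟦⟧-mono : ∀ {a b} → (a ≡ true → b ≡ true) → ⟦ a ⟧ ≤ ⟦ b ⟧
⟦⟧-mono {false}        h = z≤n
⟦⟧-mono {true} {true}  h = ℕₚ.≤-refl
⟦⟧-mono {true} {false} h = contradiction (h refl) λ ()

count : {A : Set} → (A → Bool) → List A → ℕ
count p xs = ∑ xs (λ x → ⟦ p x ⟧)

module _ {A : Set} where

  ∑-mono-All : ∀ {xs : List A} {f g} → All (λ x → f x ≤ g x) xs → ∑ xs f ≤ ∑ xs g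
  ∑-mono-All []       = z≤n
  ∑-mono-All (p ∷ ps) = ℕₚ.+-mono-≤ p (∑-mono-All ps)

  ∑-mono : ∀ (xs : List A) {f g} → (∀ x → f x ≤ g x) → ∑ xs f ≤ ∑ xs g
  ∑-mono xs h = ∑-mono-All (All.universal h xs)

  ∑-cong : ∀ (xs : List A) {f g} → (∀ x → f x ≡ g x) → ∑ xs f ≡ ∑ xs g
  ∑-cong []       h = refl
  ∑-cong (x ∷ xs) h = cong₂ _+_ (h x) (∑-cong xs h)

  ∑-const : ∀ (xs : List A) c → ∑ xs (λ _ → c) ≡ length xs * c
  ∑-const []       c = refl
  ∑-const (x ∷ xs) c = cong (c +_) (∑-const xs c)

  ∑-≤-const : ∀ {xs : List A} {f c} → All (λ x → f x ≤ c) xs → ∑ xs f ≤ length xs * c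
  ∑-≤-const {xs} {c = c} h = subst (_ ≤_) (∑-const xs c) (∑-mono-All h)

  ∑-+ : ∀ (xs : List A) f g → ∑ xs (λ x → f x + g x) ≡ ∑ xs f + ∑ xs g
  ∑-+ []       f g = refl
  ∑-+ (x ∷ xs) f g = begin
    f x + g x + ∑ xs (λ y → f y + g y) ≡⟨ cong (f x + g x +_) (∑-+ xs f g) ⟩
    f x + g x + (∑ xs f + ∑ xs g)      ≡⟨ ℕₚ.+-assoc (f x) (g x) _ ⟩
    f x + (g x + (∑ xs f + ∑ xs g))    ≡⟨ cong (f x +_) (ℕₚ.+-assoc (g x) (∑ xs f) _) ⟨
    f x + (g x + ∑ xs f + ∑ xs g)      ≡⟨ cong (λ t → f x + (t + ∑ xs g)) (ℕₚ.+-comm (g x) _) ⟩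
    f x + (∑ xs f + g x + ∑ xs g)      ≡⟨ cong (f x +_) (ℕₚ.+-assoc (∑ xs f) (g x) _) ⟩
    f x + (∑ xs f + (g x + ∑ xs g))    ≡⟨ ℕₚ.+-assoc (f x) _ _ ⟨
    f x + ∑ xs f + (g x + ∑ xs g)      ∎
    where open ≡-Reasoning

  *-distribˡ-∑ : ∀ (xs : List A) c f → c * ∑ xs f ≡ ∑ xs (λ x → c * f x)
  *-distribˡ-∑ []       c f = ℕₚ.*-zeroʳ c
  *-distribˡ-∑ (x ∷ xs) c f =
    trans (ℕₚ.*-distribˡ-+ c (f x) _) (cong (c * f x +_) (*-distribˡ-∑ xs c f))

  *-distribʳ-∑ : ∀ (xs : List A) c f → ∑ xs f * c ≡ ∑ xs (λ x → f x * c)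
  *-distribʳ-∑ xs c f = trans (ℕₚ.*-comm _ c)
    (trans (*-distribˡ-∑ xs c f) (∑-cong xs (λ x → ℕₚ.*-comm c (f x))))

  ∑-++ : ∀ (xs ys : List A) f → ∑ (xs ++ ys) f ≡ ∑ xs f + ∑ ys f
  ∑-++ []       ys f = refl
  ∑-++ (x ∷ xs) ys f = trans (cong (f x +_) (∑-++ xs ys f)) (sym (ℕₚ.+-assoc (f x) _ _))

  ∑-map : ∀ {B : Set} (h : B → A) (ys : List B) f → ∑ (map h ys) f ≡ ∑ ys (f ∘ h)
  ∑-map h []       f = refl
  ∑-map h (y ∷ ys) f = cong (f (h y) +_) (∑-map h ys f)

  ∑-concatMap : ∀ {B : Set} (h : B → List A) (ys : List B) f →
                ∑ (concatMap h ys) f ≡ ∑ ys (λ y → ∑ (h y) f)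
  ∑-concatMap h []       f = refl
  ∑-concatMap h (y ∷ ys) f =
    trans (∑-++ (h y) _ f) (cong (∑ (h y) f +_) (∑-concatMap h ys f))

module _ {A B : Set} where

  ∑-swap : ∀ (xs : List A) (ys : List B) (f : A → B → ℕ) →
           ∑ xs (λ x → ∑ ys (f x)) ≡ ∑ ys (λ y → ∑ xs (λ x → f x y))
  ∑-swap []       ys f = sym (trans (∑-const ys 0) (ℕₚ.*-zeroʳ (length ys)))
  ∑-swap (x ∷ xs) ys f =
    trans (cong (∑ ys (f x) +_) (∑-swap xs ys f)) (sym (∑-+ ys (f x) _))

∑-allFuns-suc : {A : Set} (k : ℕ) (xs : List A) → ∀ f →
  ∑ (allFuns (suc k) xs) f ≡ ∑ xs (λ x → ∑ (allFuns k xs) (λ v → f (x VF.∷ v)))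
∑-allFuns-suc k xs f = trans (∑-concatMap _ xs f) (∑-cong xs (λ x → ∑-map (x VF.∷_) (allFuns k xs) f))

length≡∑ : {A : Set} (xs : List A) → length xs ≡ ∑ xs (λ _ → 1)
length≡∑ xs = sym (trans (∑-const xs 1) (ℕₚ.*-identityʳ _))

length-allFuns : {A : Set} (k : ℕ) (xs : List A) → length (allFuns k xs) ≡ length xs ^ k
length-allFuns zero    xs = refl
length-allFuns (suc k) xs = begin
  length (allFuns (suc k) xs)                          ≡⟨ length≡∑ (allFuns (suc k) xs) ⟩
  ∑ (allFuns (suc k) xs) (λ _ → 1)                     ≡⟨ ∑-allFuns-suc k xs _ ⟩
  ∑ xs (λ _ → ∑ (allFuns k xs) (λ _ → 1))              ≡⟨ ∑-const xs _ ⟩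
  length xs * ∑ (allFuns k xs) (λ _ → 1)               ≡⟨ cong (length xs *_) (length≡∑ (allFuns k xs)) ⟨
  length xs * length (allFuns k xs)                    ≡⟨ cong (length xs *_) (length-allFuns k xs) ⟩
  length xs * length xs ^ k                            ∎
  where open ≡-Reasoning

Distinct : {A : Set} → Rel A 0ℓ → List A → Set
Distinct _≈_ = AllPairs (λ x y → ¬ (x ≈ y))

module _ {A : Set} {_≈_ : Rel A 0ℓ} where

  lookup-injective : Symmetric _≈_ → ∀ {xs} → Distinct _≈_ xs →
                     ∀ i j → lookup xs i ≈ lookup xs j → i ≡ j
  lookup-injective s (p ∷ ps) zero    zero    e = refl
  lookup-injective s (p ∷ ps) zero    (suc j) e = contradiction e (All.lookup p (∈-lookup j))
  lookup-injective s (p ∷ ps) (suc i) zero    e = contradiction (s e) (All.lookup p (∈-lookup i))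
  lookup-injective s (p ∷ ps) (suc i) (suc j) e = cong suc (lookup-injective s ps i j e)

  -- Pigeonhole principle for a relation: the image of an element is the entry of `ys` at which its
  -- `Any` proof points. Thus no map respecting the equivalences has to be supplied.
  length-≤ : ∀ {B : Set} (R : A → B → Set) {xs : List A} {ys : List B} →
             Symmetric _≈_ → Distinct _≈_ xs → All (λ x → Any (R x) ys) xs →
             (∀ {x x′ y} → R x y → R x′ y → x ≈ x′) → length xs ≤ length ys
  length-≤ R {xs} {ys} s xs! total inj = Finₚ.injective⇒≤ {f = f} f-injective
    where
    related : ∀ i → Any (R (lookup xs i)) ys
    related i = All.lookup total (∈-lookup i)
    f : Fin (length xs) → Fin (length ys)
    f i = Any.index (related i)
    f-injective : ∀ {i j} → f i ≡ f j → i ≡ j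
    f-injective {i} {j} e = lookup-injective s xs! i j
      (inj (Anyₚ.lookup-index (related i))
           (subst (λ t → R (lookup xs j) (lookup ys t)) (sym e) (Anyₚ.lookup-index (related j))))

  -- The side condition `Q` serves the case where uniqueness holds for the listed elements but not
  -- for all of `A`: subspaces with a common basis, among arbitrary subsets.
  count-≤1-All : ∀ (Q : A → Set) (p : A → Bool) {xs} → Distinct _≈_ xs → All Q xs →
                 (∀ x y → Q x → Q y → p x ≡ true → p y ≡ true → x ≈ y) → count p xs ≤ 1
  count-≤1-All Q p {[]} [] _ u = z≤n
  count-≤1-All Q p {x ∷ xs} (h ∷ hs) (q ∷ qs) u with p x in eq
  ... | false = count-≤1-All Q p hs qs u
  ... | true  = s≤s (ℕₚ.≤-reflexive (none h qs))
    where
    none : ∀ {ys} → All (λ y → ¬ (x ≈ y)) ys → All Q ys → count p ys ≡ 0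
    none []       []                  = refl
    none {y ∷ ys} (n ∷ ns) (q′ ∷ qs′) with p y in eq′
    ... | false = none ns qs′
    ... | true  = contradiction (u x y q q′ eq eq′) n

  count-≤1 : ∀ (p : A → Bool) {xs} → Distinct _≈_ xs →
             (∀ x y → p x ≡ true → p y ≡ true → x ≈ y) → count p xs ≤ 1
  count-≤1 p {xs} d u = count-≤1-All (λ x → x ≡ x) p d (All.universal (λ _ → refl) xs) (λ x y _ _ → u x y)

  Distinct-filter : ∀ (p : A → Bool) {xs} → Distinct _≈_ xs →
                    Distinct _≈_ (filter (λ x → p x Bool.≟ true) xs)
  Distinct-filter p = AllPairsₚ.filter⁺ (λ x → p x Bool.≟ true)

module _ {A : Set} where

  length-filter≡count : ∀ (p : A → Bool) xs →
                        length (filter (λ x → p x Bool.≟ true) xs) ≡ count p xs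
  length-filter≡count p []       = refl
  length-filter≡count p (x ∷ xs) with p x
  ... | true  = cong suc (length-filter≡count p xs)
  ... | false = length-filter≡count p xs

  ∑-filter : ∀ (p : A → Bool) xs f →
             ∑ (filter (λ x → p x Bool.≟ true) xs) f ≡ ∑ xs (λ x → ⟦ p x ⟧ * f x)
  ∑-filter p []       f = refl
  ∑-filter p (x ∷ xs) f with p x
  ... | true  = cong₂ _+_ (sym (ℕₚ.+-identityʳ (f x))) (∑-filter p xs f)
  ... | false = ∑-filter p xs f

  count-≥1 : ∀ (p : A → Bool) {xs} → Any (λ x → p x ≡ true) xs → 1 ≤ count p xs
  count-≥1 p {x ∷ xs} (here px) rewrite px = s≤s z≤n
  count-≥1 p {x ∷ xs} (there a) = ℕₚ.≤-trans (count-≥1 p a) (ℕₚ.m≤n+m _ ⟦ p x ⟧)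

  count-mono : ∀ {p q : A → Bool} xs → (∀ x → p x ≡ true → q x ≡ true) → count p xs ≤ count q xs
  count-mono xs h = ∑-mono xs (λ x → ⟦⟧-mono (h x))

  count-not : ∀ (p : A → Bool) xs → count p xs + count (not ∘ p) xs ≡ length xs
  count-not p []       = refl
  count-not p (x ∷ xs) with p x
  ... | true  = cong suc (count-not p xs)
  ... | false = trans (ℕₚ.+-suc _ _) (cong suc (count-not p xs))

  -- A subset with at least as many elements as the whole is the whole. This replaces comparison of
  -- dimensions when a span is identified with the subspace that contains it.
  count-exhaust : ∀ {p q : A → Bool} xs → (∀ x → p x ≡ true → q x ≡ true) →
                  count q xs ≤ count p xs → All (λ x → q x ≡ true → p x ≡ true) xs
  count-exhaust []       h le = []
  count-exhaust {p} {q} (x ∷ xs) h le with p x in px | q x in qx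
  ... | true  | true  = (λ _ → px) ∷ count-exhaust xs h (ℕₚ.≤-pred le)
  ... | true  | false = contradiction (trans (sym qx) (h x px)) λ ()
  ... | false | false = (λ e → trans px (trans (sym qx) e)) ∷ count-exhaust xs h le
  ... | false | true  = contradiction (ℕₚ.≤-trans le (count-mono xs h)) (ℕₚ.1+n≰n)

  filter-All : ∀ (p : A → Bool) xs → All (λ x → p x ≡ true) (filter (λ x → p x Bool.≟ true) xs)
  filter-All p xs = Allₚ.all-filter (λ x → p x Bool.≟ true) xs

  filter-Any : ∀ (p : A → Bool) {P : A → Set} {xs} → (∀ {x} → P x → p x ≡ true) →
               Any P xs → Any P (filter (λ x → p x Bool.≟ true) xs)
  filter-Any p {P} {x ∷ xs} h (here px) with p x in eq
  ... | true  = here px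
  ... | false = contradiction (trans (sym eq) (h px)) λ ()
  filter-Any p {P} {x ∷ xs} h (there a) with p x
  ... | true  = there (filter-Any p h a)
  ... | false = filter-Any p h a

  all-elim : ∀ (p : A → Bool) {xs} → all p xs ≡ true → All (λ x → p x ≡ true) xs
  all-elim p {[]}     e = []
  all-elim p {x ∷ xs} e with p x in eq
  ... | true = eq ∷ all-elim p e

  all-intro : ∀ (p : A → Bool) {xs} → All (λ x → p x ≡ true) xs → all p xs ≡ true
  all-intro p []                   = refl
  all-intro p (px ∷ ps) rewrite px = all-intro p ps

  all-false : ∀ (p : A → Bool) {xs} → all p xs ≡ false → Any (λ x → p x ≡ false) xs
  all-false p {x ∷ xs} e with p x in eq
  ... | true  = there (all-false p e)
  ... | false = here eq

  any-elim : ∀ (p : A → Bool) {xs} → any p xs ≡ true → Any (λ x → p x ≡ true) xs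
  any-elim p {x ∷ xs} e with p x in eq
  ... | true  = here eq
  ... | false = there (any-elim p e)

  any-intro : ∀ (p : A → Bool) {xs} → Any (λ x → p x ≡ true) xs → any p xs ≡ true
  any-intro p {x ∷ xs} (here px) rewrite px = refl
  any-intro p {x ∷ xs} (there a) with p x
  ... | true  = refl
  ... | false = any-intro p a

  ⟦any⟧≤count : ∀ (p : A → Bool) xs → ⟦ any p xs ⟧ ≤ count p xs
  ⟦any⟧≤count p []       = z≤n
  ⟦any⟧≤count p (x ∷ xs) with p x
  ... | true  = s≤s z≤n
  ... | false = ⟦any⟧≤count p xs

∧-elim : ∀ {a b} → a ∧ b ≡ true → a ≡ true × b ≡ true
∧-elim {true} e = refl , e

∧-intro : ∀ {a b} → a ≡ true → b ≡ true → a ∧ b ≡ true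
∧-intro refl e = e

⇒-elim : ∀ {a b} → not a ∨ b ≡ true → a ≡ true → b ≡ true
⇒-elim e refl = e

⇒-intro : ∀ {a b} → (a ≡ true → b ≡ true) → not a ∨ b ≡ true
⇒-intro {true}  h = h refl
⇒-intro {false} h = refl

does-elim : {P : Set} (d : Dec P) → does d ≡ true → P
does-elim (yes p) e = p

All-allFin : ∀ {m} {P : Fin m → Set} → (∀ i → P i) → All P (allFin m)
All-allFin h = All.universal h _

allFin-lookup : ∀ {m} {P : Fin m → Set} → All P (allFin m) → ∀ i → P i
allFin-lookup = Allₚ.tabulate⁻

Any-allFin : ∀ {m} {P : Fin m → Set} i → P i → Any P (allFin m)
Any-allFin i p = Anyₚ.tabulate⁺ i p

allFin-distinct : ∀ m → Distinct _≡_ (allFin m)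
allFin-distinct m = AllPairsₚ.tabulate⁺ (λ i≢j → i≢j)

module _ {A : Set} (_≈_ : Rel A 0ℓ) where

  Pointwise : ∀ {k} → Rel (Fin k → A) 0ℓ
  Pointwise f g = ∀ i → f i ≈ g i

  allFuns-complete : ∀ k {xs} → (∀ x → Any (x ≈_) xs) → ∀ f → Any (Pointwise f) (allFuns k xs)
  allFuns-complete zero    c f = here (λ ())
  allFuns-complete (suc k) {xs} c f =
    Anyₚ.concatMap⁺ _ (Any.map (λ {x} e → Anyₚ.map⁺ (Any.map (λ {g} h → λ { zero → e ; (suc i) → h i })
      (allFuns-complete k c (f ∘ suc)))) (c (f zero)))

  allFuns-distinct : ∀ k {xs} → Distinct _≈_ xs → Distinct Pointwise (allFuns k xs)
  allFuns-distinct zero    d = [] ∷ []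
  allFuns-distinct (suc k) {xs} d = AllPairsₚ.concat⁺
    (Allₚ.map⁺ (All.universal (λ x → AllPairsₚ.map⁺ (AllPairs.map (λ n e → n (e ∘ suc)) (allFuns-distinct k d))) xs))
    (AllPairsₚ.map⁺ (AllPairs.map (λ n → Allₚ.map⁺ (All.universal (λ _ → Allₚ.map⁺ (All.universal (λ _ e → n (e zero)) _)) _)) d))

-- Finite fields

private
  -- Absorption identity, by induction with Pascal's rule applied on both sides.
  [1+k]*[1+n]C[1+k] : ∀ n k → suc k * (suc n choose suc k) ≡ suc n * (n choose k)
  [1+k]*[1+n]C[1+k] zero    zero    = refl
  [1+k]*[1+n]C[1+k] zero    (suc k) = ℕₚ.*-zeroʳ (suc (suc k))
  [1+k]*[1+n]C[1+k] (suc n) zero    = trans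
    (cong (1 *_) (sym (nCk+nC[k+1]≡[n+1]C[k+1] (suc n) 0)))
    (trans (cong (λ t → 1 * (1 + t)) (trans (sym (ℕₚ.*-identityˡ _)) ([1+k]*[1+n]C[1+k] n 0))) (lem n))
    where
    lem : ∀ n → 1 * (1 + suc n * 1) ≡ suc (suc n) * 1
    lem = solve-∀
  [1+k]*[1+n]C[1+k] (suc n) (suc k) = begin
    suc (suc k) * (suc (suc n) choose suc (suc k))
      ≡⟨ cong (suc (suc k) *_) (nCk+nC[k+1]≡[n+1]C[k+1] (suc n) (suc k)) ⟨
    suc (suc k) * (suc n choose suc k + suc n choose suc (suc k))
      ≡⟨ split k (suc n choose suc k) (suc n choose suc (suc k)) ⟩
    suc n choose suc k + (suc k * (suc n choose suc k) + suc (suc k) * (suc n choose suc (suc k)))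
      ≡⟨ cong (suc n choose suc k +_) (cong₂ _+_ ([1+k]*[1+n]C[1+k] n k) ([1+k]*[1+n]C[1+k] n (suc k))) ⟩
    suc n choose suc k + (suc n * (n choose k) + suc n * (n choose suc k))
      ≡⟨ cong (suc n choose suc k +_) (ℕₚ.*-distribˡ-+ (suc n) (n choose k) (n choose suc k)) ⟨
    suc n choose suc k + suc n * (n choose k + n choose suc k)
      ≡⟨ cong (λ t → suc n choose suc k + suc n * t) (nCk+nC[k+1]≡[n+1]C[k+1] n k) ⟩
    suc n choose suc k + suc n * (suc n choose suc k) ∎
    where
    open ≡-Reasoning
    split : ∀ k a b → suc (suc k) * (a + b) ≡ a + (suc k * a + suc (suc k) * b)
    split = solve-∀

-- By absorption p divides `suc k` times the coefficient, and it is too large to divide `suc k`.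
p∣pC[1+k] : ∀ {p k} → Prime p → suc k < p → p ∣ p choose suc k
p∣pC[1+k] {suc n} {k} pp k<p
  with euclidsLemma (suc k) (suc n choose suc k) pp
         (divides (n choose k) (trans ([1+k]*[1+n]C[1+k] n k) (ℕₚ.*-comm (suc n) (n choose k))))
... | inj₁ p∣1+k = contradiction (∣⇒≤ p∣1+k) (ℕₚ.<⇒≱ k<p)
... | inj₂ p∣C   = p∣C

module _ (M : CommutativeMonoid 0ℓ 0ℓ) where
  private module M = CommutativeMonoid M
  open CMSum M using (sum; sum-remove; sum-cong-≋; sum-replicate-zero)

  sum-single : ∀ {n} (t : Fin n → M.Carrier) i → (∀ j → j ≢ i → t j M.≈ M.ε) → sum t M.≈ t i
  sum-single {suc n} t i h = M.trans (sum-remove {i = i} t)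
    (M.trans (M.∙-cong M.refl (M.trans (sum-cong-≋ (λ j → h _ (Finₚ.punchInᵢ≢i i j))) (sum-replicate-zero n)))
             (M.identityʳ (t i)))

module FieldTheory {m : ℕ} (F : FiniteField m) where
  open FiniteField F hiding (zero) renaming
    (_+_ to _+ᶠ_; -_ to -ᶠ_; _-_ to _-ᶠ_; refl to ≈-refl; sym to ≈-sym; trans to ≈-trans; _≟_ to _≟ᶠ_)
  open RingProperties ring using (+-identityʳ-unique; -‿distribˡ-*)
  open GroupProperties +-group using () renaming (x∙y⁻¹≈ε⇒x≈y to x-y≈0⇒x≈y)
  open Exp semiring using () renaming (_^_ to _^ᶠ_)
  open Mult semiring using (×-congˡ) renaming (_×_ to _×ᶠ_)
  open SetoidReasoning setoid

  private
    ix : Fin (length elems) → Carrier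
    ix = lookup elems

  index : Carrier → Fin (length elems)
  index x = Any.index (complete x)

  index-≈ : ∀ x → x ≈ lookup elems (index x)
  index-≈ x = Anyₚ.lookup-index (complete x)

  lookup-inj : ∀ i j → lookup elems i ≈ lookup elems j → i ≡ j
  lookup-inj = lookup-injective ≈-sym distinct

  no-zero-divisors : ∀ {x y} → ¬ (x ≈ 0#) → x · y ≈ 0# → y ≈ 0#
  no-zero-divisors {x} {y} x≉0 xy≈0 with z , xz≈1 ← inverse x x≉0 = begin
    y              ≈⟨ *-identityˡ y ⟨
    1# · y         ≈⟨ *-congʳ (≈-trans (≈-sym xz≈1) (*-comm x z)) ⟩
    (z · x) · y    ≈⟨ *-assoc z x y ⟩
    z · (x · y)    ≈⟨ *-congˡ xy≈0 ⟩
    z · 0#         ≈⟨ zeroʳ z ⟩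
    0#             ∎

  *-nonzero : ∀ {x y} → ¬ (x ≈ 0#) → ¬ (y ≈ 0#) → ¬ (x · y ≈ 0#)
  *-nonzero x≉0 y≉0 e = y≉0 (no-zero-divisors x≉0 e)

  *-cancelˡ-nonzero : ∀ {x y z} → ¬ (x ≈ 0#) → x · y ≈ x · z → y ≈ z
  *-cancelˡ-nonzero {x} {y} {z} x≉0 e with w , xw≈1 ← inverse x x≉0 = begin
    y            ≈⟨ recover y ⟩
    w · (x · y)  ≈⟨ *-congˡ e ⟩
    w · (x · z)  ≈⟨ recover z ⟨
    z            ∎
    where
    recover : ∀ y → y ≈ w · (x · y)
    recover y = ≈-trans (≈-sym (*-identityˡ y))
      (≈-trans (*-congʳ (≈-trans (≈-sym xw≈1) (*-comm x w))) (*-assoc w x y))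

  module _ (M : CommutativeMonoid 0ℓ 0ℓ) where
    private module M = CommutativeMonoid M
    open CMSum M using (sum; sum-permute; sum-cong-≋)

    -- Conjugation by the enumeration `elems` turns a bijection of the field into a permutation of
    -- positions. The monoid is arbitrary because the lemma serves translations in the additive
    -- group and scalings in the multiplicative monoid.
    sum-elems-bijection : ∀ (h : Carrier → M.Carrier) → (∀ {x y} → x ≈ y → h x M.≈ h y) →
      ∀ (f g : Carrier → Carrier) → (∀ {x y} → x ≈ y → f x ≈ f y) → (∀ {x y} → x ≈ y → g x ≈ g y) →
      (∀ x → f (g x) ≈ x) → (∀ x → g (f x) ≈ x) →
      sum (h ∘ lookup elems) M.≈ sum (h ∘ f ∘ lookup elems)
    sum-elems-bijection h h-cong f g f-cong g-cong fg gf = M.trans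
      (sum-permute (h ∘ ix) (permutation (conjugate f) (conjugate g) (inverts g f g-cong f-cong fg) (inverts f g f-cong g-cong gf)))
      (sum-cong-≋ (λ i → h-cong (≈-sym (index-≈ (f (ix i))))))
      where
      conjugate : (Carrier → Carrier) → Fin (length elems) → Fin (length elems)
      conjugate f i = index (f (ix i))
      inverts : ∀ f g → (∀ {x y} → x ≈ y → f x ≈ f y) → (∀ {x y} → x ≈ y → g x ≈ g y) →
                (∀ x → g (f x) ≈ x) → ∀ i → conjugate g (conjugate f i) ≡ i
      inverts f g fc gc gf i = lookup-inj _ i (begin
        ix (index (g (ix (index (f (ix i))))))  ≈⟨ index-≈ _ ⟨
        g (ix (index (f (ix i))))               ≈⟨ gc (≈-sym (index-≈ _)) ⟩
        g (f (ix i))                            ≈⟨ gf (ix i) ⟩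
        ix i                                    ∎)

  -- Translation by 1 permutes the field, so the sum of all elements equals itself plus |F| · 1.
  size×1≈0 : m ×ᶠ 1# ≈ 0#
  size×1≈0 = begin
    m ×ᶠ 1#                       ≈⟨ ×-congˡ size ⟨
    length elems ×ᶠ 1#            ≈⟨ sum-replicate (length elems) ⟨
    sum {length elems} (λ _ → 1#) ≈⟨ +-identityʳ-unique (sum ix) _ (≈-sym total) ⟩
    0#                            ∎
    where
    open CMSum +-commutativeMonoid using (sum; sum-replicate; ∑-distrib-+)
    total : sum ix ≈ sum ix +ᶠ sum {length elems} (λ _ → 1#)
    total = ≈-trans
      (sum-elems-bijection +-commutativeMonoid id id (_+ᶠ 1#) (_+ᶠ (-ᶠ 1#)) +-congʳ +-congʳ
        (λ x → ≈-trans (+-assoc x _ _) (≈-trans (+-congˡ (-‿inverseˡ 1#)) (+-identityʳ x)))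
        (λ x → ≈-trans (+-assoc x _ _) (≈-trans (+-congˡ (-‿inverseʳ 1#)) (+-identityʳ x))))
      (∑-distrib-+ ix (λ _ → 1#))

  private
    module Π = CMSum *-commutativeMonoid

    Π-nonzero : ∀ {n} (t : Fin n → Carrier) → (∀ i → ¬ (t i ≈ 0#)) → ¬ (Π.sum t ≈ 0#)
    Π-nonzero {zero}  t h e = 0≉1 (≈-sym e)
    Π-nonzero {suc n} t h e = *-nonzero (h zero) (Π-nonzero (t ∘ suc) (h ∘ suc)) e

  -- For x ≉ 0, multiplication by x permutes the nonzero elements, whose product is invertible.
  x^size≈x : ∀ x → x ^ᶠ m ≈ x
  x^size≈x x with x ≟ᶠ 0#
  ... | yes x≈0 = vanish m size
    where
    vanish : ∀ m → length elems ≡ m → x ^ᶠ m ≈ x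
    vanish zero    e = ⊥-elim (empty elems e (complete 0#))
      where
      empty : ∀ xs → length xs ≡ 0 → ¬ Any (0# ≈_) xs
      empty [] _ ()
    vanish (suc m) e = ≈-trans (*-congʳ x≈0) (≈-trans (zeroˡ _) (≈-sym x≈0))
  ... | no x≉0 with z , xz≈1 ← inverse x x≉0 = begin
    x ^ᶠ m                            ≈⟨ Exp.^-congʳ semiring x size ⟨
    x ^ᶠ length elems                 ≈⟨ Π.sum-replicate (length elems) ⟨
    Π.sum {length elems} (λ _ → x)    ≈⟨ Π.sum-cong-≋ (λ i → ≈-sym (φψ (ix i))) ⟩
    Π.sum (λ i → φ (ix i) · ψ (ix i)) ≈⟨ Π.∑-distrib-+ (φ ∘ ix) (ψ ∘ ix) ⟩
    Π.sum (φ ∘ ix) · Π.sum (ψ ∘ ix)   ≈⟨ *-cong Φ≈1 Ψ≈x ⟩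
    1# · x                            ≈⟨ *-identityˡ x ⟩
    x                                 ∎
    where
    -- The product runs over all elements, zero included, so zero is neutralised: `g` replaces it by
    -- 1, `φ` is x away from zero, and `ψ` supplies the missing x at zero. Scaling by x shows that
    -- the product of `φ` is 1, and the product of `ψ` is x.
    g φ ψ : Carrier → Carrier
    g y with y ≟ᶠ 0#
    ... | yes _ = 1#
    ... | no  _ = y
    φ y with y ≟ᶠ 0#
    ... | yes _ = 1#
    ... | no  _ = x
    ψ y with y ≟ᶠ 0#
    ... | yes _ = x
    ... | no  _ = 1#
    φψ : ∀ y → φ y · ψ y ≈ x
    φψ y with y ≟ᶠ 0#
    ... | yes _ = *-identityˡ x
    ... | no  _ = *-identityʳ x
    g≉0 : ∀ y → ¬ (g y ≈ 0#)
    g≉0 y e with y ≟ᶠ 0#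
    ... | yes _ = 0≉1 (≈-sym e)
    ... | no  n = n e
    g-cong : ∀ {y z} → y ≈ z → g y ≈ g z
    g-cong {y} {z} e with y ≟ᶠ 0# | z ≟ᶠ 0#
    ... | yes _ | yes _ = ≈-refl
    ... | yes a | no  b = contradiction (≈-trans (≈-sym e) a) b
    ... | no  a | yes b = contradiction (≈-trans e b) a
    ... | no  _ | no  _ = e
    gx : ∀ y → g (x · y) ≈ φ y · g y
    gx y with y ≟ᶠ 0# | (x · y) ≟ᶠ 0#
    ... | yes _ | yes _ = ≈-sym (*-identityˡ 1#)
    ... | yes a | no  b = contradiction (≈-trans (*-congˡ a) (zeroʳ x)) b
    ... | no  a | yes b = contradiction b (*-nonzero x≉0 a)
    ... | no  _ | no  _ = ≈-refl
    G : Carrier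
    G = Π.sum (g ∘ ix)
    Φ≈1 : Π.sum (φ ∘ ix) ≈ 1#
    Φ≈1 = *-cancelˡ-nonzero (Π-nonzero (g ∘ ix) (g≉0 ∘ ix)) (begin
      G · Π.sum (φ ∘ ix)               ≈⟨ *-comm G _ ⟩
      Π.sum (φ ∘ ix) · G               ≈⟨ Π.∑-distrib-+ (φ ∘ ix) (g ∘ ix) ⟨
      Π.sum (λ i → φ (ix i) · g (ix i)) ≈⟨ Π.sum-cong-≋ (λ i → ≈-sym (gx (ix i))) ⟩
      Π.sum (λ i → g (x · ix i))       ≈⟨ sum-elems-bijection *-commutativeMonoid g g-cong (x ·_) (z ·_) *-congˡ *-congˡ
                                            (cancels x z xz≈1) (cancels z x (≈-trans (*-comm z x) xz≈1)) ⟨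
      G                                ≈⟨ *-identityʳ G ⟨
      G · 1#                           ∎)
      where
      cancels : ∀ x z → x · z ≈ 1# → ∀ y → x · (z · y) ≈ y
      cancels x z e y = ≈-trans (≈-sym (*-assoc x z y)) (≈-trans (*-congʳ e) (*-identityˡ y))
    Ψ≈x : Π.sum (ψ ∘ ix) ≈ x
    Ψ≈x = ≈-trans (sum-single *-commutativeMonoid (ψ ∘ ix) (index 0#) off) at
      where
      off : ∀ j → j ≢ index 0# → ψ (ix j) ≈ 1#
      off j j≢ with ix j ≟ᶠ 0#
      ... | yes e = contradiction (lookup-inj j _ (≈-trans e (index-≈ 0#))) j≢
      ... | no  _ = ≈-refl
      at : ψ (ix (index 0#)) ≈ x
      at with ix (index 0#) ≟ᶠ 0#
      ... | yes _ = ≈-refl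
      ... | no  n = contradiction (≈-sym (index-≈ 0#)) n

  x·[y·z]≈y·[x·z] : ∀ x y z → x · (y · z) ≈ y · (x · z)
  x·[y·z]≈y·[x·z] x y z = ≈-trans (≈-sym (*-assoc x y z)) (≈-trans (*-congʳ (*-comm x y)) (*-assoc y x z))

  -- Coefficients start at the constant term and the leading 1 is implicit, so the index `d` is
  -- exactly the degree and the zero polynomial cannot occur.
  evalMonic : ∀ {d} → Vec Carrier d → Carrier → Carrier
  evalMonic []       x = 1#
  evalMonic (c ∷ cs) x = c +ᶠ x · evalMonic cs x

  private
    _⊹_ : ∀ {d} → Vec Carrier (suc d) → Carrier × Vec Carrier d → Vec Carrier (suc d)
    (c ∷ [])      ⊹ (a , [])     = (c +ᶠ a) ∷ []
    (c ∷ d ∷ cs)  ⊹ (a , e ∷ es) = (c +ᶠ a · e) ∷ ((d ∷ cs) ⊹ (a , es))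

    interchange : ∀ a b c d → (a +ᶠ b) +ᶠ (c +ᶠ d) ≈ (a +ᶠ c) +ᶠ (b +ᶠ d)
    interchange a b c d = begin
      (a +ᶠ b) +ᶠ (c +ᶠ d) ≈⟨ +-assoc a b _ ⟩
      a +ᶠ (b +ᶠ (c +ᶠ d)) ≈⟨ +-congˡ (≈-trans (≈-sym (+-assoc b c d)) (≈-trans (+-congʳ (+-comm b c)) (+-assoc c b d))) ⟩
      a +ᶠ (c +ᶠ (b +ᶠ d)) ≈⟨ +-assoc a c _ ⟨
      (a +ᶠ c) +ᶠ (b +ᶠ d) ∎

    eval-⊹ : ∀ {d} (cs : Vec Carrier (suc d)) a es x →
             evalMonic (cs ⊹ (a , es)) x ≈ evalMonic cs x +ᶠ a · evalMonic es x
    eval-⊹ (c ∷ []) a [] x = begin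
      (c +ᶠ a) +ᶠ x · 1#        ≈⟨ +-assoc c a _ ⟩
      c +ᶠ (a +ᶠ x · 1#)        ≈⟨ +-congˡ (+-comm a _) ⟩
      c +ᶠ (x · 1# +ᶠ a)        ≈⟨ +-assoc c _ a ⟨
      (c +ᶠ x · 1#) +ᶠ a        ≈⟨ +-congˡ (*-identityʳ a) ⟨
      (c +ᶠ x · 1#) +ᶠ a · 1#   ∎
    eval-⊹ (c ∷ d ∷ cs) a (e ∷ es) x = begin
      (c +ᶠ a · e) +ᶠ x · evalMonic ((d ∷ cs) ⊹ (a , es)) x ≈⟨ +-congˡ (*-congˡ (eval-⊹ (d ∷ cs) a es x)) ⟩
      (c +ᶠ a · e) +ᶠ x · (D +ᶠ a · E)                  ≈⟨ +-congˡ (distribˡ x D _) ⟩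
      (c +ᶠ a · e) +ᶠ (x · D +ᶠ x · (a · E))            ≈⟨ interchange c _ _ _ ⟩
      (c +ᶠ x · D) +ᶠ (a · e +ᶠ x · (a · E))            ≈⟨ +-congˡ (+-congˡ (x·[y·z]≈y·[x·z] x a E)) ⟩
      (c +ᶠ x · D) +ᶠ (a · e +ᶠ a · (x · E))            ≈⟨ +-congˡ (distribˡ a e _) ⟨
      (c +ᶠ x · D) +ᶠ a · (e +ᶠ x · E)                  ∎
      where
      D E : Carrier
      D = evalMonic (d ∷ cs) x
      E = evalMonic es x

    cancel-middle : ∀ x y z → (x +ᶠ y) +ᶠ (z +ᶠ (-ᶠ y)) ≈ x +ᶠ z
    cancel-middle x y z = begin
      (x +ᶠ y) +ᶠ (z +ᶠ (-ᶠ y)) ≈⟨ interchange x y z (-ᶠ y) ⟩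
      (x +ᶠ z) +ᶠ (y +ᶠ (-ᶠ y)) ≈⟨ +-congˡ (-‿inverseʳ y) ⟩
      (x +ᶠ z) +ᶠ 0#            ≈⟨ +-identityʳ _ ⟩
      x +ᶠ z                    ∎

  -- Synthetic division: if D(x) = D(a) + (x - a) E(x), then c + x D(x) leaves the quotient D + a E.
  -- It is again monic because E has smaller degree than D.
  divideMonic : ∀ {d} (cs : Vec Carrier (suc d)) a →
    ∃ λ ds → ∀ x → evalMonic cs x ≈ evalMonic cs a +ᶠ (x +ᶠ (-ᶠ a)) · evalMonic {d} ds x
  divideMonic (c ∷ []) a = [] , λ x → begin
    c +ᶠ x · 1#                           ≈⟨ +-congˡ (*-identityʳ x) ⟩
    c +ᶠ x                                ≈⟨ cancel-middle c a x ⟨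
    (c +ᶠ a) +ᶠ (x +ᶠ (-ᶠ a))             ≈⟨ +-cong (+-congˡ (*-identityʳ a)) (*-identityʳ _) ⟨
    (c +ᶠ a · 1#) +ᶠ (x +ᶠ (-ᶠ a)) · 1#   ∎
  divideMonic (c ∷ d ∷ cs) a with es , h ← divideMonic (d ∷ cs) a = (d ∷ cs) ⊹ (a , es) , λ x →
    let D  = evalMonic (d ∷ cs) x
        D′ = evalMonic (d ∷ cs) a
        y  = x +ᶠ (-ᶠ a)
        E  = evalMonic es x in
    begin
    c +ᶠ x · D                              ≈⟨ cancel-middle c (a · D) (x · D) ⟨
    (c +ᶠ a · D) +ᶠ (x · D +ᶠ (-ᶠ (a · D)))   ≈⟨ +-cong (+-congˡ (*-congˡ (h x))) (+-congˡ (-‿distribˡ-* a D)) ⟩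
    (c +ᶠ a · (D′ +ᶠ y · E)) +ᶠ (x · D +ᶠ (-ᶠ a) · D) ≈⟨ +-cong (+-congˡ (distribˡ a D′ _)) (≈-sym (distribʳ D x (-ᶠ a))) ⟩
    (c +ᶠ (a · D′ +ᶠ a · (y · E))) +ᶠ y · D ≈⟨ +-congʳ (+-assoc c _ _) ⟨
    ((c +ᶠ a · D′) +ᶠ a · (y · E)) +ᶠ y · D ≈⟨ +-assoc _ _ _ ⟩
    (c +ᶠ a · D′) +ᶠ (a · (y · E) +ᶠ y · D) ≈⟨ +-congˡ (≈-trans (+-comm _ _) (+-congˡ (x·[y·z]≈y·[x·z] a y E))) ⟩
    (c +ᶠ a · D′) +ᶠ (y · D +ᶠ y · (a · E)) ≈⟨ +-congˡ (distribˡ y D _) ⟨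
    (c +ᶠ a · D′) +ᶠ y · (D +ᶠ a · E)       ≈⟨ +-congˡ (*-congˡ (eval-⊹ (d ∷ cs) a es x)) ⟨
    (c +ᶠ a · D′) +ᶠ y · evalMonic ((d ∷ cs) ⊹ (a , es)) x ∎

  roots-≤-degree : ∀ {d} (cs : Vec Carrier d) {xs} → Distinct _≈_ xs →
                   All (λ x → evalMonic cs x ≈ 0#) xs → length xs ≤ d
  roots-≤-degree cs       {[]}     _        _        = z≤n
  roots-≤-degree []       {x ∷ xs} _        (r ∷ _)  = contradiction (≈-sym r) 0≉1
  roots-≤-degree (c ∷ cs) {a ∷ xs} (d ∷ ds) (r ∷ rs) with es , h ← divideMonic (c ∷ cs) a =
    s≤s (roots-≤-degree es ds (All.zipWith (λ {x} (a≉x , rx) →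
      no-zero-divisors (λ e → a≉x (≈-sym (x-y≈0⇒x≈y x a e)))
        (≈-trans (≈-sym (≈-trans (h x) (≈-trans (+-congʳ r) (+-identityˡ _)))) rx)) (d , rs)))

  -- Abstract so that unification sees the summand instead of an unfolded fold.
  abstract
    ∑ᶠ : ∀ {n} → (Fin n → Carrier) → Carrier
    ∑ᶠ = SSum.sum semiring

    ∑ᶠ-zero : ∀ (f : Fin 0 → Carrier) → ∑ᶠ f ≈ 0#
    ∑ᶠ-zero f = ≈-refl

    ∑ᶠ-suc : ∀ {n} (f : Fin (suc n) → Carrier) → ∑ᶠ f ≈ f zero +ᶠ ∑ᶠ (f ∘ suc)
    ∑ᶠ-suc f = ≈-refl

    ∑ᶠ-cong : ∀ {n} {f g : Fin n → Carrier} → (∀ i → f i ≈ g i) → ∑ᶠ f ≈ ∑ᶠ g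
    ∑ᶠ-cong = SSum.sum-cong-≋ semiring

    ∑ᶠ-0 : ∀ {n} {f : Fin n → Carrier} → (∀ i → f i ≈ 0#) → ∑ᶠ f ≈ 0#
    ∑ᶠ-0 {n} h = ≈-trans (∑ᶠ-cong h) (SSum.sum-replicate-zero semiring n)

    ∑ᶠ-+ : ∀ {n} (f g : Fin n → Carrier) → ∑ᶠ (λ i → f i +ᶠ g i) ≈ ∑ᶠ f +ᶠ ∑ᶠ g
    ∑ᶠ-+ = SSum.∑-distrib-+ semiring

    ∑ᶠ-comm : ∀ {m n} (f : Fin m → Fin n → Carrier) →
              ∑ᶠ (λ i → ∑ᶠ (λ j → f i j)) ≈ ∑ᶠ (λ j → ∑ᶠ (λ i → f i j))
    ∑ᶠ-comm = SSum.∑-comm semiring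

    ·-∑ᶠ : ∀ {n} c (f : Fin n → Carrier) → c · ∑ᶠ f ≈ ∑ᶠ (λ i → c · f i)
    ·-∑ᶠ = SSum.*-distribˡ-sum semiring

    ∑ᶠ-· : ∀ {n} (f : Fin n → Carrier) c → ∑ᶠ f · c ≈ ∑ᶠ (λ i → f i · c)
    ∑ᶠ-· f c = SSum.*-distribʳ-sum semiring c f

    ∑ᶠ-single : ∀ {n} (f : Fin n → Carrier) i → (∀ j → j ≢ i → f j ≈ 0#) → ∑ᶠ f ≈ f i
    ∑ᶠ-single = sum-single +-commutativeMonoid

    foldr≡∑ᶠ : ∀ {m n} (f : Fin n → Carrier) (g : Fin m → Fin n) → foldr _+ᶠ_ 0# (map f (tabulate g)) ≡ ∑ᶠ (f ∘ g)
    foldr≡∑ᶠ {zero}  f g = refl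
    foldr≡∑ᶠ {suc m} f g = cong (f (g zero) +ᶠ_) (foldr≡∑ᶠ f (g ∘ suc))

module _ {A : Set} {P : A → Set} where

  attach : ∀ {xs} → All P xs → List (Σ A P)
  attach []                = []
  attach {x ∷ xs} (p ∷ ps) = (x , p) ∷ attach ps

  map-attach : ∀ {xs} (ps : All P xs) → map proj₁ (attach ps) ≡ xs
  map-attach []                = refl
  map-attach {x ∷ xs} (p ∷ ps) = cong (x ∷_) (map-attach ps)

2≤primePower : ∀ {q} → IsPrimePower q → 2 ≤ q
2≤primePower (p , suc e , pp , _ , refl) =
  ℕₚ.≤-trans (ℕₚ.≤-trans (ℕ.nonTrivial⇒n>1 p {{Primality.prime⇒nonTrivial pp}}) (ℕₚ.≤-reflexive (sym (ℕₚ.*-identityʳ p))))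
             (ℕₚ.*-monoʳ-≤ p (ℕₚ.m^n>0 p {{Primality.prime⇒nonZero pp}} e))

-- The involution x ↦ x^q and its fixed field

module Conjugation (q : ℕ) (q-pp : IsPrimePower q) (F : FiniteField (q * q)) where
  open FiniteField F hiding (zero) renaming
    (_+_ to _+ᶠ_; -_ to -ᶠ_; _-_ to _-ᶠ_; refl to ≈-refl; sym to ≈-sym; trans to ≈-trans; _≟_ to _≟ᶠ_)
  open FieldTheory F
  open RingProperties ring using (+-identityʳ-unique; +-inverseʳ-unique; -‿distribˡ-*)
  open Exp semiring using (^-congˡ; ^-congʳ; ^-assocʳ) renaming (_^_ to _^ᶠ_)
  open Mult semiring using (×-congʳ; ×-assoc-*; ×1-homo-*; ×-congˡ; ×-homo-1) renaming (_×_ to _×ᶠ_)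
  open SSum semiring using (sum; sum-cong-≋; sum-init-last; sum-replicate-zero)
  open SetoidReasoning setoid

  2≤q : 2 ≤ q
  2≤q = 2≤primePower q-pp

  private
    p e : ℕ
    p = proj₁ q-pp
    e = proj₁ (proj₂ q-pp)
    p-prime : Prime p
    p-prime = proj₁ (proj₂ (proj₂ q-pp))
    q≡p^e : q ≡ p ^ e
    q≡p^e = proj₂ (proj₂ (proj₂ (proj₂ q-pp)))

    *≈0⇒≈0 : ∀ m n → (m * n) ×ᶠ 1# ≈ 0# → m ×ᶠ 1# ≈ 0# ⊎ n ×ᶠ 1# ≈ 0#
    *≈0⇒≈0 m n h with (m ×ᶠ 1#) ≟ᶠ 0#
    ... | yes z = inj₁ z
    ... | no nz = inj₂ (no-zero-divisors nz (≈-trans (≈-sym (×1-homo-* m n)) h))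

    ^≈0⇒≈0 : ∀ p e → (p ^ e) ×ᶠ 1# ≈ 0# → p ×ᶠ 1# ≈ 0#
    ^≈0⇒≈0 p zero    h = contradiction (≈-trans (≈-sym h) (×-homo-1 1#)) 0≉1
    ^≈0⇒≈0 p (suc e) h with *≈0⇒≈0 p (p ^ e) h
    ... | inj₁ z = z
    ... | inj₂ z = ^≈0⇒≈0 p e z

    q×1≈0 : q ×ᶠ 1# ≈ 0#
    q×1≈0 with *≈0⇒≈0 q q size×1≈0
    ... | inj₁ z = z
    ... | inj₂ z = z

    -- The multiple of 1 by the order q² of the field vanishes. Without zero divisors, one of the
    -- prime factors of q², all equal to p, already annihilates 1.
    p×1≈0 : p ×ᶠ 1# ≈ 0#
    p×1≈0 = ^≈0⇒≈0 p e (≈-trans (×-congˡ (sym q≡p^e)) q×1≈0)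

    multiple≈0 : ∀ {c} → p ∣ c → ∀ z → c ×ᶠ z ≈ 0#
    multiple≈0 (divides k refl) z = begin
      (k * p) ×ᶠ z         ≈⟨ ×-congʳ (k * p) (*-identityˡ z) ⟨
      (k * p) ×ᶠ (1# · z)  ≈⟨ ×-assoc-* (k * p) 1# z ⟨
      ((k * p) ×ᶠ 1#) · z  ≈⟨ *-congʳ (×1-homo-* k p) ⟩
      ((k ×ᶠ 1#) · (p ×ᶠ 1#)) · z ≈⟨ *-congʳ (≈-trans (*-congˡ p×1≈0) (zeroʳ _)) ⟩
      0# · z               ≈⟨ zeroˡ z ⟩
      0#                   ∎

    -- The inner binomial coefficients are multiples of the prime. The prime is a variable here, as
    -- the fixed `p` is a projection and cannot be matched against a successor.
    freshman : ∀ n → Prime n → (∀ {c} → n ∣ c → ∀ z → c ×ᶠ z ≈ 0#) →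
               ∀ x y → (x +ᶠ y) ^ᶠ n ≈ x ^ᶠ n +ᶠ y ^ᶠ n
    freshman (suc n) n-prime vanish x y = begin
      (x +ᶠ y) ^ᶠ suc n                         ≈⟨ Binomial.theorem commutativeSemiring (suc n) x y ⟩
      term zero +ᶠ sum (term ∘ suc)             ≈⟨ +-cong first (≈-trans (sum-init-last (term ∘ suc)) (+-cong middle final)) ⟩
      y ^ᶠ suc n +ᶠ (0# +ᶠ x ^ᶠ suc n)          ≈⟨ +-congˡ (+-identityˡ _) ⟩
      y ^ᶠ suc n +ᶠ x ^ᶠ suc n                  ≈⟨ +-comm _ _ ⟩
      x ^ᶠ suc n +ᶠ y ^ᶠ suc n                  ∎
      where
      term : Fin (suc (suc n)) → Carrier
      term = Binomial.binomialTerm commutativeSemiring x y (suc n)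
      first : term zero ≈ y ^ᶠ suc n
      first = ≈-trans (×-homo-1 _) (*-identityˡ _)
      middle : sum (VF.init (term ∘ suc)) ≈ 0#
      middle = ≈-trans (sum-cong-≋ (λ i → vanish (p∣pC[1+k] n-prime
        (s≤s (subst (_< n) (sym (Finₚ.toℕ-inject₁ i)) (Finₚ.toℕ<n i)))) _)) (sum-replicate-zero n)
      final : VF.last (term ∘ suc) ≈ x ^ᶠ suc n
      final rewrite Finₚ.toℕ-fromℕ n | nCn≡1 (suc n) | ℕₚ.n∸n≡0 n = ≈-trans (×-homo-1 _) (*-identityʳ _)

    frobenius : ∀ e x y → (x +ᶠ y) ^ᶠ (p ^ e) ≈ x ^ᶠ (p ^ e) +ᶠ y ^ᶠ (p ^ e)
    frobenius zero    x y = ≈-trans (*-identityʳ _) (+-cong (≈-sym (*-identityʳ x)) (≈-sym (*-identityʳ y)))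
    frobenius (suc e) x y = begin
      (x +ᶠ y) ^ᶠ (p * p ^ e)                   ≈⟨ ^-assocʳ (x +ᶠ y) p (p ^ e) ⟨
      ((x +ᶠ y) ^ᶠ p) ^ᶠ (p ^ e)                ≈⟨ ^-congˡ (p ^ e) (freshman p p-prime multiple≈0 x y) ⟩
      (x ^ᶠ p +ᶠ y ^ᶠ p) ^ᶠ (p ^ e)             ≈⟨ frobenius e _ _ ⟩
      (x ^ᶠ p) ^ᶠ (p ^ e) +ᶠ (y ^ᶠ p) ^ᶠ (p ^ e) ≈⟨ +-cong (^-assocʳ x p (p ^ e)) (^-assocʳ y p (p ^ e)) ⟩
      x ^ᶠ (p * p ^ e) +ᶠ y ^ᶠ (p * p ^ e)      ∎

  σ : Carrier → Carrier
  σ x = x ^ᶠ q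

  σ-cong : ∀ {x y} → x ≈ y → σ x ≈ σ y
  σ-cong = ^-congˡ q

  σ-+ : ∀ x y → σ (x +ᶠ y) ≈ σ x +ᶠ σ y
  σ-+ x y = begin
    (x +ᶠ y) ^ᶠ q              ≈⟨ ^-congʳ (x +ᶠ y) q≡p^e ⟩
    (x +ᶠ y) ^ᶠ (p ^ e)        ≈⟨ frobenius e x y ⟩
    x ^ᶠ (p ^ e) +ᶠ y ^ᶠ (p ^ e) ≈⟨ +-cong (^-congʳ x q≡p^e) (^-congʳ y q≡p^e) ⟨
    x ^ᶠ q +ᶠ y ^ᶠ q           ∎

  σ-* : ∀ x y → σ (x · y) ≈ σ x · σ y
  σ-* x y = CExp.^-distrib-* commutativeSemiring x y q

  σ-involutive : ∀ x → σ (σ x) ≈ x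
  σ-involutive x = ≈-trans (^-assocʳ x q q) (x^size≈x x)

  σ-0 : σ 0# ≈ 0#
  σ-0 = +-identityʳ-unique (σ 0#) (σ 0#) (≈-trans (≈-sym (σ-+ 0# 0#)) (σ-cong (+-identityˡ 0#)))

  σ-neg : ∀ x → σ (-ᶠ x) ≈ -ᶠ σ x
  σ-neg x = +-inverseʳ-unique (σ x) (σ (-ᶠ x))
    (≈-trans (≈-sym (σ-+ x (-ᶠ x))) (≈-trans (σ-cong (-‿inverseʳ x)) σ-0))

  σ-1 : σ 1# ≈ 1#
  σ-1 = one q
    where
    one : ∀ n → 1# ^ᶠ n ≈ 1#
    one zero    = ≈-refl
    one (suc n) = ≈-trans (*-identityˡ _) (one n)

  σ-∑ᶠ : ∀ {n} (f : Fin n → Carrier) → σ (∑ᶠ f) ≈ ∑ᶠ (σ ∘ f)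
  σ-∑ᶠ {zero}  f = ≈-trans (σ-cong (∑ᶠ-zero f)) (≈-trans σ-0 (≈-sym (∑ᶠ-zero (σ ∘ f))))
  σ-∑ᶠ {suc n} f = begin
    σ (∑ᶠ f)                       ≈⟨ σ-cong (∑ᶠ-suc f) ⟩
    σ (f zero +ᶠ ∑ᶠ (f ∘ suc))     ≈⟨ σ-+ _ _ ⟩
    σ (f zero) +ᶠ σ (∑ᶠ (f ∘ suc)) ≈⟨ +-congˡ (σ-∑ᶠ (f ∘ suc)) ⟩
    σ (f zero) +ᶠ ∑ᶠ (σ ∘ f ∘ suc) ≈⟨ ∑ᶠ-suc (σ ∘ f) ⟨
    ∑ᶠ (σ ∘ f)                     ∎

  private
    zeros : ∀ d → Vec Carrier d
    zeros zero    = []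
    zeros (suc d) = 0# ∷ zeros d

    evalMonic-zeros : ∀ d x → evalMonic (zeros d) x ≈ x ^ᶠ d
    evalMonic-zeros zero    x = ≈-refl
    evalMonic-zeros (suc d) x = ≈-trans (+-identityˡ _) (*-congˡ (evalMonic-zeros d x))

    trinomial : ∀ n → 2 ≤ n → ∀ c b →
                ∃ λ (cs : Vec Carrier n) → ∀ x → evalMonic cs x ≈ c +ᶠ (x · b +ᶠ x ^ᶠ n)
    trinomial (suc zero) (s≤s ()) c b
    trinomial (suc (suc n)) _ c b = c ∷ b ∷ zeros n , λ x →
      +-congˡ (≈-trans (distribˡ x b _) (+-congˡ (*-congˡ (*-congˡ (evalMonic-zeros n x)))))

  -- The equation is a monic polynomial of degree q in x; `2 ≤ q` keeps the linear term below the
  -- leading one. With b = 1 it bounds the fibres of the trace, with b = -1 the number of fixed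
  -- elements.
  roots-bound : ∀ b c {xs} → Distinct _≈_ xs → All (λ x → x · b +ᶠ σ x ≈ c) xs → length xs ≤ q
  roots-bound b c d rs with cs , h ← trinomial q 2≤q (-ᶠ c) b =
    roots-≤-degree cs d (All.map (λ {x} r → ≈-trans (h x) (≈-trans (+-congˡ r) (-‿inverseˡ c))) rs)

  isFixed : Carrier → Bool
  isFixed x = does (x ≟ᶠ σ x)

  fixed : List Carrier
  fixed = filter (λ x → isFixed x Bool.≟ true) elems

  fixed-distinct : Distinct _≈_ fixed
  fixed-distinct = Distinct-filter isFixed distinct

  fixed-All : All (λ x → x ≈ σ x) fixed
  fixed-All = All.map (λ {x} → does-elim (x ≟ᶠ σ x)) (filter-All isFixed elems)

  fixed-complete : ∀ x → x ≈ σ x → Any (x ≈_) fixed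
  fixed-complete x h = filter-Any isFixed
    (λ {y} e → dec-true (y ≟ᶠ σ y) (≈-trans (≈-sym e) (≈-trans h (σ-cong e)))) (complete x)

  private
    trace : Carrier → Carrier
    trace x = x +ᶠ σ x

    inFibre : Carrier → Carrier → Bool
    inFibre y x = does (trace x ≟ᶠ y)

    fibre-≤ : ∀ y → count (inFibre y) elems ≤ q
    fibre-≤ y = subst (_≤ q) (length-filter≡count (inFibre y) elems)
      (roots-bound 1# y (Distinct-filter (inFibre y) distinct)
        (All.map (λ {x} h → ≈-trans (+-congʳ (*-identityʳ x)) (does-elim (trace x ≟ᶠ y) h)) (filter-All (inFibre y) elems)))

  -- The trace x + σ x takes its values in the fixed field, and its fibres have at most q elements.
  length-fixed : length fixed ≡ q
  length-fixed = ℕₚ.≤-antisym upper (ℕₚ.*-cancelʳ-≤ q (length fixed) q {{ℕ.>-nonZero (ℕₚ.<⇒≤ 2≤q)}} lower)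
    where
    upper : length fixed ≤ q
    upper = roots-bound (-ᶠ 1#) 0# fixed-distinct (All.map (λ {x} h → begin
      x · (-ᶠ 1#) +ᶠ σ x  ≈⟨ +-cong (*-comm x _) (≈-sym h) ⟩
      (-ᶠ 1#) · x +ᶠ x    ≈⟨ +-congʳ (≈-trans (≈-sym (-‿distribˡ-* 1# x)) (-‿cong (*-identityˡ x))) ⟩
      (-ᶠ x) +ᶠ x         ≈⟨ -‿inverseˡ x ⟩
      0#                  ∎) fixed-All)
    trace-fixed : ∀ x → trace x ≈ σ (trace x)
    trace-fixed x = ≈-sym (≈-trans (σ-+ x (σ x)) (≈-trans (+-congˡ (σ-involutive x)) (+-comm _ x)))
    lower : q * q ≤ length fixed * q
    lower = ℕR.begin
      q * q                                              ℕR.≡⟨ size ⟨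
      length elems                                       ℕR.≡⟨ length≡∑ elems ⟩
      ∑ elems (λ _ → 1)                                  ℕR.≤⟨ ∑-mono elems (λ x → count-≥1 (λ y → inFibre y x)
                                                              (Any.map (λ {y} e → dec-true (trace x ≟ᶠ y) e) (fixed-complete (trace x) (trace-fixed x)))) ⟩
      ∑ elems (λ x → ∑ fixed (λ y → ⟦ inFibre y x ⟧))    ℕR.≡⟨ ∑-swap elems fixed _ ⟩
      ∑ fixed (λ y → count (inFibre y) elems)            ℕR.≤⟨ ∑-≤-const (All.universal fibre-≤ fixed) ⟩
      length fixed * q                                   ℕR.∎
      where module ℕR = ℕₚ.≤-Reasoning

  -- The scalar field F_q. Equality compares first components, so the fixedness proofs never matter
  -- and every ring law is inherited.
  fixedField : FiniteField q
  fixedField = record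
    { cring = record
      { Carrier = Σ Carrier (λ x → x ≈ σ x)
      ; _≈_ = λ x y → proj₁ x ≈ proj₁ y
      ; _+_ = λ (x , h) (y , k) → x +ᶠ y , ≈-trans (+-cong h k) (≈-sym (σ-+ x y))
      ; _*_ = λ (x , h) (y , k) → x · y , ≈-trans (*-cong h k) (≈-sym (σ-* x y))
      ; -_ = λ (x , h) → -ᶠ x , ≈-trans (-‿cong h) (≈-sym (σ-neg x))
      ; 0# = 0# , ≈-sym σ-0
      ; 1# = 1# , ≈-sym σ-1
      ; isCommutativeRing = record
        { isRing = record
          { +-isAbelianGroup = record
            { isGroup = record
              { isMonoid = record
                { isSemigroup = record
                  { isMagma = record
                    { isEquivalence = record { refl = ≈-refl ; sym = ≈-sym ; trans = ≈-trans }
                    ; ∙-cong = +-cong }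
                  ; assoc = λ _ _ _ → +-assoc _ _ _ }
                ; identity = (λ _ → +-identityˡ _) , (λ _ → +-identityʳ _) }
              ; inverse = (λ _ → -‿inverseˡ _) , (λ _ → -‿inverseʳ _)
              ; ⁻¹-cong = -‿cong }
            ; comm = λ _ _ → +-comm _ _ }
          ; *-cong = *-cong
          ; *-assoc = λ _ _ _ → *-assoc _ _ _
          ; *-identity = (λ _ → *-identityˡ _) , (λ _ → *-identityʳ _)
          ; distrib = (λ _ _ _ → distribˡ _ _ _) , (λ _ _ _ → distribʳ _ _ _) }
        ; *-comm = λ _ _ → *-comm _ _ } }
    ; _≟_ = λ x y → proj₁ x ≟ᶠ proj₁ y
    ; 0≉1 = 0≉1
    -- Applying `σ` to x z = 1 with x fixed shows that σ z is an inverse of x as well. Cancelling x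
    -- gives z = σ z.
    ; inverse = λ (x , h) x≉0 → let (z , xz≈1) = inverse x x≉0 in
        (z , *-cancelˡ-nonzero x≉0 (≈-trans xz≈1 (≈-trans (≈-sym σ-1)
          (≈-trans (σ-cong (≈-sym xz≈1)) (≈-trans (σ-* x z) (*-congʳ (≈-sym h))))))) , xz≈1
    ; elems = attach fixed-All
    ; complete = λ (x , h) → Anyₚ.map⁻ (subst (Any (x ≈_)) (sym (map-attach fixed-All)) (fixed-complete x h))
    ; distinct = AllPairsₚ.map⁻ (subst (Distinct _≈_) (sym (map-attach fixed-All)) fixed-distinct)
    ; size = trans (sym (length-map proj₁ (attach fixed-All))) (trans (cong length (map-attach fixed-All)) length-fixed)
    }

-- Lists of pairs and of coordinatewise choices

module _ {A B : Set} where

  pairs : List A → List B → List (A × B)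
  pairs xs ys = concatMap (λ x → map (x ,_) ys) xs

  length-pairs : ∀ xs ys → length (pairs xs ys) ≡ length xs * length ys
  length-pairs xs ys = begin
    length (pairs xs ys)             ≡⟨ length≡∑ (pairs xs ys) ⟩
    ∑ (pairs xs ys) (λ _ → 1)        ≡⟨ ∑-concatMap _ xs _ ⟩
    ∑ xs (λ x → ∑ (map (x ,_) ys) (λ _ → 1)) ≡⟨ ∑-cong xs (λ x → ∑-map (x ,_) ys _) ⟩
    ∑ xs (λ x → ∑ ys (λ _ → 1))      ≡⟨ ∑-const xs _ ⟩
    length xs * ∑ ys (λ _ → 1)       ≡⟨ cong (length xs *_) (length≡∑ ys) ⟨
    length xs * length ys            ∎
    where open ≡-Reasoning

  pairs-Any : ∀ {P : A → Set} {Q : B → Set} {xs ys} → Any P xs → Any Q ys →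
              Any (λ t → P (proj₁ t) × Q (proj₂ t)) (pairs xs ys)
  pairs-Any ps qs = Anyₚ.concatMap⁺ _ (Any.map (λ p → Anyₚ.map⁺ (Any.map (p ,_) qs)) ps)

  pairs-All : ∀ {P : A → Set} {Q : B → Set} {xs ys} → All P xs → All Q ys →
              All (λ t → P (proj₁ t) × Q (proj₂ t)) (pairs xs ys)
  pairs-All ps qs = Allₚ.concat⁺ (Allₚ.map⁺ (All.map (λ p → Allₚ.map⁺ (All.map (p ,_) qs)) ps))

  Pairwise : Rel A 0ℓ → Rel B 0ℓ → Rel (A × B) 0ℓ
  Pairwise _≈₁_ _≈₂_ (a , b) (a′ , b′) = a ≈₁ a′ × b ≈₂ b′

  pairs-distinct : ∀ {_≈₁_ : Rel A 0ℓ} {_≈₂_ : Rel B 0ℓ} {xs ys} →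
                   Distinct _≈₁_ xs → Distinct _≈₂_ ys → Distinct (Pairwise _≈₁_ _≈₂_) (pairs xs ys)
  pairs-distinct {xs = xs} {ys} d₁ d₂ = AllPairsₚ.concat⁺
    (Allₚ.map⁺ (All.universal (λ x → AllPairsₚ.map⁺ (AllPairs.map (λ n e → n (proj₂ e)) d₂)) xs))
    (AllPairsₚ.map⁺ (AllPairs.map (λ n → Allₚ.map⁺ (All.universal (λ _ → Allₚ.map⁺ (All.universal (λ _ e → n (proj₁ e)) _)) _)) d₁))

∑-allFin-suc : ∀ {k} (h : Fin (suc k) → ℕ) → ∑ (allFin (suc k)) h ≡ h zero + ∑ (allFin k) (h ∘ suc)
∑-allFin-suc {k} h = cong (h zero +_) (trans (cong (λ l → ∑ l h) (sym (map-tabulate id suc))) (∑-map suc (allFin k) h))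

-- Each coordinate has its own list of values: in the factor C of a low-rank matrix the pivot rows
-- are forced and the other rows are free.
allDepFuns : {A : Set} (k : ℕ) → (Fin k → List A) → List (Fin k → A)
allDepFuns zero    f = (λ ()) ∷ []
allDepFuns (suc k) f = concatMap (λ x → map (x VF.∷_) (allDepFuns k (f ∘ suc))) (f zero)

allDepFuns-complete : {A : Set} (_≈_ : Rel A 0ℓ) (k : ℕ) (f : Fin k → List A) (g : Fin k → A) →
                      (∀ i → Any (g i ≈_) (f i)) → Any (Pointwise _≈_ g) (allDepFuns k f)
allDepFuns-complete _≈_ zero    f g c = here (λ ())
allDepFuns-complete _≈_ (suc k) f g c =
  Anyₚ.concatMap⁺ _ (Any.map (λ e → Anyₚ.map⁺ (Any.map (λ h → λ { zero → e ; (suc i) → h i })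
    (allDepFuns-complete _≈_ k (f ∘ suc) (g ∘ suc) (c ∘ suc)))) (c zero))

length-allDepFuns : {A : Set} (X k : ℕ) (f : Fin k → List A) (b : Fin k → Bool) →
                    (∀ i → length (f i) ≡ X ^ ⟦ b i ⟧) → length (allDepFuns k f) ≡ X ^ count b (allFin k)
length-allDepFuns X zero    f b h = refl
length-allDepFuns X (suc k) f b h = begin
  length (allDepFuns (suc k) f)                      ≡⟨ length≡∑ (allDepFuns (suc k) f) ⟩
  ∑ (allDepFuns (suc k) f) (λ _ → 1)                 ≡⟨ ∑-concatMap _ (f zero) _ ⟩
  ∑ (f zero) (λ x → ∑ (map (x VF.∷_) tails) (λ _ → 1)) ≡⟨ ∑-cong (f zero) (λ x → ∑-map (x VF.∷_) tails _) ⟩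
  ∑ (f zero) (λ _ → ∑ tails (λ _ → 1))               ≡⟨ ∑-const (f zero) _ ⟩
  length (f zero) * ∑ tails (λ _ → 1)                ≡⟨ cong₂ _*_ (h zero) (sym (length≡∑ tails)) ⟩
  X ^ ⟦ b zero ⟧ * length tails                      ≡⟨ cong (X ^ ⟦ b zero ⟧ *_) (length-allDepFuns X k (f ∘ suc) (b ∘ suc) (h ∘ suc)) ⟩
  X ^ ⟦ b zero ⟧ * X ^ count (b ∘ suc) (allFin k)    ≡⟨ ℕₚ.^-distribˡ-+-* X ⟦ b zero ⟧ _ ⟨
  X ^ (⟦ b zero ⟧ + count (b ∘ suc) (allFin k))      ≡⟨ cong (X ^_) (∑-allFin-suc (⟦_⟧ ∘ b)) ⟨
  X ^ count b (allFin (suc k))                       ∎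
  where
  open ≡-Reasoning
  tails = allDepFuns k (f ∘ suc)

-- Hermitian matrices

module Hermitian (q : ℕ) (q-pp : IsPrimePower q) (F : FiniteField (q * q)) where
  open FiniteField F hiding (zero) renaming
    (_+_ to _+ᶠ_; -_ to -ᶠ_; _-_ to _-ᶠ_; refl to ≈-refl; sym to ≈-sym; trans to ≈-trans; _≟_ to _≟ᶠ_)
  open FieldTheory F
  open Conjugation q q-pp F
  open Exp semiring using () renaming (_^_ to _^ᶠ_)
  private module HC (n : ℕ) = HermitianCounting q F n

  infix 4 _≐_

  Mat : ℕ → Set
  Mat n = Fin n → Fin n → Carrier

  _≐_ : ∀ {n} → Rel (Mat n) 0ℓ
  M ≐ M′ = ∀ i j → M i j ≈ M′ i j

  ≐-sym : ∀ {n} {M M′ : Mat n} → M ≐ M′ → M′ ≐ M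
  ≐-sym h i j = ≈-sym (h i j)

  ≐-trans : ∀ {n} {M M′ M″ : Mat n} → M ≐ M′ → M′ ≐ M″ → M ≐ M″
  ≐-trans h k i j = ≈-trans (h i j) (k i j)

  Herm : ∀ {n} → Mat n → Set
  Herm M = ∀ i j → M j i ≈ σ (M i j)

  Herm-resp : ∀ {n} {M M′ : Mat n} → M ≐ M′ → Herm M → Herm M′
  Herm-resp e h i j = ≈-trans (≈-sym (e j i)) (≈-trans (h i j) (σ-cong (e i j)))

  conj≡σ : ∀ n x → HC.conj n x ≡ σ x
  conj≡σ n x = pow q
    where
    pow : ∀ m → HC._^ᶠ_ n x m ≡ x ^ᶠ m
    pow zero    = refl
    pow (suc m) = cong (x ·_) (pow m)

  isHermitian-elim : ∀ {n} (M : Mat n) → HC.isHermitian n M ≡ true → Herm M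
  isHermitian-elim {n} M e i j = subst (M j i ≈_) (conj≡σ n (M i j)) (does-elim (M j i ≟ᶠ HC.conj n (M i j))
    (allFin-lookup (all-elim _ (allFin-lookup (all-elim _ e) i)) j))

  isHermitian-intro : ∀ {n} (M : Mat n) → Herm M → HC.isHermitian n M ≡ true
  isHermitian-intro {n} M h = all-intro _ (All-allFin λ i → all-intro _ (All-allFin λ j →
    dec-true (M j i ≟ᶠ HC.conj n (M i j)) (subst (M j i ≈_) (sym (conj≡σ n (M i j))) (h i j))))

  herList : ∀ n → List (Mat n)
  herList n = HC.herList n

  herList-All : ∀ n → All Herm (herList n)
  herList-All n = All.map (λ {M} → isHermitian-elim M) (filter-All (HC.isHermitian n) (allFuns n (allFuns n elems)))

  herList-complete : ∀ {n} (M : Mat n) → Herm M → Any (M ≐_) (herList n)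
  herList-complete {n} M h = filter-Any (HC.isHermitian n) (λ {M′} e → isHermitian-intro M′ (Herm-resp e h))
    (allFuns-complete (Pointwise _≈_) n (allFuns-complete _≈_ n complete) M)

  herList-distinct : ∀ n → Distinct _≐_ (herList n)
  herList-distinct n = Distinct-filter (HC.isHermitian n)
    (allFuns-distinct (Pointwise _≈_) n (allFuns-distinct _≈_ n distinct))

  block : ∀ {n} → Carrier → (Fin n → Carrier) → Mat n → Mat (suc n)
  block a u M zero    zero    = a
  block a u M zero    (suc j) = u j
  block a u M (suc i) zero    = σ (u i)
  block a u M (suc i) (suc j) = M i j

  block-Herm : ∀ {n a u} {M : Mat n} → a ≈ σ a → Herm M → Herm (block a u M)
  block-Herm a-fixed h zero    zero    = a-fixed
  block-Herm a-fixed h zero    (suc j) = ≈-refl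
  block-Herm a-fixed h (suc i) zero    = ≈-sym (σ-involutive _)
  block-Herm a-fixed h (suc i) (suc j) = h i j

  length-elems^ : ∀ n → length (allFuns n elems) ≡ q ^ (2 * n)
  length-elems^ n = trans (length-allFuns n elems) (trans (cong (_^ n) (trans size (cong (q *_) (sym (ℕₚ.*-identityʳ q)))))
    (ℕₚ.^-*-assoc q 2 n))

  -- A Hermitian matrix of size n + 1 amounts to a corner in F_q, a free row of length n over the
  -- large field and a Hermitian block of size n. The exponent therefore grows by 1 + 2n.
  length-herList : ∀ n → length (herList n) ≡ q ^ (n * n)
  length-herList zero    = refl
  length-herList (suc n) = trans (ℕₚ.≤-antisym upper lower) length-params
    where
    params : List (Carrier × ((Fin n → Carrier) × Mat n))
    params = pairs fixed (pairs (allFuns n elems) (herList n))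
    toMat : Carrier × ((Fin n → Carrier) × Mat n) → Mat (suc n)
    toMat (a , u , M) = block a u M
    exponent : ∀ n → 1 + (2 * n + n * n) ≡ suc n * suc n
    exponent = solve-∀
    length-params : length params ≡ q ^ (suc n * suc n)
    length-params = ≡R.begin
      length params
        ≡R.≡⟨ trans (length-pairs fixed _) (cong₂ _*_ length-fixed (length-pairs (allFuns n elems) (herList n))) ⟩
      q * (length (allFuns n elems) * length (herList n))
        ≡R.≡⟨ cong (q *_) (cong₂ _*_ (length-elems^ n) (length-herList n)) ⟩
      q * (q ^ (2 * n) * q ^ (n * n)) ≡R.≡⟨ cong (q *_) (ℕₚ.^-distribˡ-+-* q (2 * n) (n * n)) ⟨
      q ^ (1 + (2 * n + n * n))       ≡R.≡⟨ cong (q ^_) (exponent n) ⟩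
      q ^ (suc n * suc n)             ≡R.∎
      where module ≡R = ≡-Reasoning
    upper : length (herList (suc n)) ≤ length params
    upper = length-≤ (λ M t → M ≐ toMat t) ≐-sym (herList-distinct (suc n))
      (All.map (λ {M} h → Any.map (λ {t} (ea , eu , eM) → λ
          { zero zero → ea ; zero (suc j) → eu j
          ; (suc i) zero → ≈-trans (h zero (suc i)) (σ-cong (eu i)) ; (suc i) (suc j) → eM i j })
        (pairs-Any (fixed-complete (M zero zero) (h zero zero))
          (pairs-Any (allFuns-complete _≈_ n complete (λ j → M zero (suc j)))
            (herList-complete (λ i j → M (suc i) (suc j)) (λ i j → h (suc i) (suc j))))))
        (herList-All (suc n)))
      (λ e e′ → ≐-trans e (≐-sym e′))
    lower : length params ≤ length (herList (suc n))
    lower = length-≤ (λ t M → toMat t ≐ M)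
      (λ (a , b , c) → ≈-sym a , (λ j → ≈-sym (b j)) , ≐-sym c)
      (pairs-distinct fixed-distinct (pairs-distinct (allFuns-distinct _≈_ n distinct) (herList-distinct n)))
      (All.map (λ {t} (h , _ , k) → herList-complete (toMat t) (block-Herm h k))
        -- The free row carries no condition, so a trivially true predicate takes its place.
        (pairs-All fixed-All (pairs-All (All.universal (λ _ → ≈-refl {0#}) (allFuns n elems)) (herList-All n))))
      (λ {t} {t′} e e′ → let d = ≐-trans e (≐-sym e′) in
        d zero zero , (λ j → d zero (suc j)) , (λ i j → d (suc i) (suc j)))

-- Many Hermitian matrices of low rank

module LowRank (q : ℕ) (q-pp : IsPrimePower q) (F : FiniteField (q * q)) where
  open FiniteField F hiding (zero) renaming
    (_+_ to _+ᶠ_; -_ to -ᶠ_; _-_ to _-ᶠ_; refl to ≈-refl; sym to ≈-sym; trans to ≈-trans; _≟_ to _≟ᶠ_)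
  open FieldTheory F
  open Conjugation q q-pp F
  open Hermitian q q-pp F
  open GroupProperties +-group using () renaming (x∙y⁻¹≈ε⇒x≈y to x-y≈0⇒x≈y)
  open SetoidReasoning setoid
  private
    module HC (n : ℕ) = HermitianCounting q F n
    module ℕR = ℕₚ.≤-Reasoning

  Indep : ∀ {n d} → Mat n → (Fin d → Fin n) → Set
  Indep {n} {d} M ρ = ∀ (c : Fin d → Carrier) → (∀ j → ∑ᶠ (λ i → c i · M (ρ i) j) ≈ 0#) → ∀ i → c i ≈ 0#

  Inj : ∀ {n d} → (Fin d → Fin n) → Set
  Inj ρ = ∀ i j → ρ i ≡ ρ j → i ≡ j

  RankAtLeast : ∀ {n} → ℕ → Mat n → Set
  RankAtLeast {n} d M = ∃ λ (ρ : Fin d → Fin n) → Inj ρ × Indep M ρ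

  sumᶠ≡∑ᶠ : ∀ n {d} (f : Fin d → Carrier) → HC.sumᶠ n d f ≡ ∑ᶠ f
  sumᶠ≡∑ᶠ n f = foldr≡∑ᶠ f id

  rowsIndependent-elim : ∀ {n d} (M : Mat n) (ρ : Fin d → Fin n) → HC.rowsIndependent n d M ρ ≡ true → Indep M ρ
  rowsIndependent-elim {n} {d} M ρ e c h i
    with implies , c≈ ← All.lookupAny (all-elim _ e) (allFuns-complete _≈_ d complete c) =
    ≈-trans (c≈ i) (does-elim (_ ≟ᶠ 0#) (allFin-lookup (all-elim _ (⇒-elim implies
      (all-intro _ (All-allFin λ j → dec-true (_ ≟ᶠ 0#)
        (subst (_≈ 0#) (sym (sumᶠ≡∑ᶠ n (λ i → _ · M (ρ i) j))) (≈-trans (∑ᶠ-cong (λ i → *-congʳ (≈-sym (c≈ i)))) (h j))))))) i))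

  rowsIndependent-intro : ∀ {n d} (M : Mat n) (ρ : Fin d → Fin n) → Indep M ρ → HC.rowsIndependent n d M ρ ≡ true
  rowsIndependent-intro {n} {d} M ρ h = all-intro _ (All.universal (λ c → ⇒-intro λ e →
    all-intro _ (All-allFin λ i → dec-true (_ ≟ᶠ 0#) (h c (λ j →
      subst (_≈ 0#) (sumᶠ≡∑ᶠ n (λ i → _ · M (ρ i) j)) (does-elim (_ ≟ᶠ 0#) (allFin-lookup (all-elim _ e) j))) i))) (allFuns d elems))

  injectiveᵇ-elim : ∀ {n d} (ρ : Fin d → Fin n) → HC.injectiveᵇ n d ρ ≡ true → Inj ρ
  injectiveᵇ-elim ρ e i j h = does-elim (i Fin.≟ j)
    (⇒-elim (allFin-lookup (all-elim _ (allFin-lookup (all-elim _ e) i)) j) (dec-true (ρ i Fin.≟ ρ j) h))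

  injectiveᵇ-intro : ∀ {n d} (ρ : Fin d → Fin n) → Inj ρ → HC.injectiveᵇ n d ρ ≡ true
  injectiveᵇ-intro ρ h = all-intro _ (All-allFin λ i → all-intro _ (All-allFin λ j →
    ⇒-intro λ e → dec-true (i Fin.≟ j) (h i j (does-elim (ρ i Fin.≟ ρ j) e))))

  rankAtLeast-elim : ∀ {n} d (M : Mat n) → HC.rankAtLeast n d M ≡ true → RankAtLeast d M
  rankAtLeast-elim {n} d M e with ρ , h ← Any.satisfied (any-elim _ {allFuns d (allFin n)} e) with i , r ← ∧-elim h =
    ρ , injectiveᵇ-elim ρ i , rowsIndependent-elim M ρ r

  rankAtLeast-intro : ∀ {n} d (M : Mat n) → RankAtLeast d M → HC.rankAtLeast n d M ≡ true
  rankAtLeast-intro {n} d M (ρ , inj , indep) = any-intro _ (Any.map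
    (λ {ρ′} e → ∧-intro
      (injectiveᵇ-intro ρ′ λ i j h → inj i j (trans (e i) (trans h (sym (e j)))))
      (rowsIndependent-intro M ρ′ λ c h → indep c λ j →
        ≈-trans (∑ᶠ-cong (λ i → *-congˡ (reflexive (cong (λ t → M t j) (e i))))) (h j)))
    (allFuns-complete _≡_ d (λ x → Any-allFin x refl) ρ))

  RankAtLeast-resp : ∀ {n d} {M M′ : Mat n} → M ≐ M′ → RankAtLeast d M → RankAtLeast d M′
  RankAtLeast-resp e (ρ , inj , indep) = ρ , inj , λ c h → indep c λ j →
    ≈-trans (∑ᶠ-cong (λ i → *-congˡ (e (ρ i) j))) (h j)

  -- Rank at most `r`, stated positively as a factorisation through a space of dimension `r`. In
  -- this form it is carried along directly when a matrix is bordered.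
  Factors : ∀ {n} → ℕ → Mat n → Set
  Factors {n} r M = ∃ λ (W : Fin n → Fin r → Carrier) → ∃ λ (U : Fin r → Fin n → Carrier) →
    ∀ i j → M i j ≈ ∑ᶠ (λ l → W i l · U l j)

  -- If r + 1 rows were independent, c ↦ c W would embed F^(r+1) into F^r.
  Factors⇒¬RankAtLeast : ∀ {n r} {M : Mat n} → Factors r M → ¬ RankAtLeast (suc r) M
  Factors⇒¬RankAtLeast {n} {r} {M} (W , U , M≈WU) (ρ , _ , indep) =
    ℕₚ.<⇒≱ (ℕₚ.^-monoʳ-< s 1<s (ℕₚ.n<1+n r)) too-many
    where
    s : ℕ
    s = length elems
    1<s : 1 < s
    1<s = subst (2 ≤_) (sym size) (ℕₚ.≤-trans 2≤q (ℕₚ.m≤m*n q q {{ℕ.>-nonZero (ℕₚ.<⇒≤ 2≤q)}}))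
    Φ : (Fin (suc r) → Carrier) → Fin r → Carrier
    Φ c l = ∑ᶠ (λ i → c i · W (ρ i) l)
    Φ-kernel : ∀ c → (∀ l → Φ c l ≈ 0#) → ∀ i → c i ≈ 0#
    Φ-kernel c h = indep c λ j → begin
      ∑ᶠ (λ i → c i · M (ρ i) j)                       ≈⟨ ∑ᶠ-cong (λ i → *-congˡ (M≈WU (ρ i) j)) ⟩
      ∑ᶠ (λ i → c i · ∑ᶠ (λ l → W (ρ i) l · U l j))   ≈⟨ ∑ᶠ-cong (λ i → ·-∑ᶠ (c i) _) ⟩
      ∑ᶠ (λ i → ∑ᶠ (λ l → c i · (W (ρ i) l · U l j))) ≈⟨ ∑ᶠ-comm _ ⟩
      ∑ᶠ (λ l → ∑ᶠ (λ i → c i · (W (ρ i) l · U l j))) ≈⟨ ∑ᶠ-cong (λ l → ∑ᶠ-cong λ i → ≈-sym (*-assoc _ _ _)) ⟩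
      ∑ᶠ (λ l → ∑ᶠ (λ i → (c i · W (ρ i) l) · U l j)) ≈⟨ ∑ᶠ-cong (λ l → ≈-sym (∑ᶠ-· _ (U l j))) ⟩
      ∑ᶠ (λ l → Φ c l · U l j)                         ≈⟨ ∑ᶠ-0 (λ l → ≈-trans (*-congʳ (h l)) (zeroˡ _)) ⟩
      0#                                                ∎
    Φ-injective : ∀ c c′ → (∀ l → Φ c l ≈ Φ c′ l) → ∀ i → c i ≈ c′ i
    Φ-injective c c′ h i = x-y≈0⇒x≈y _ _ (Φ-kernel (λ i → c i +ᶠ (-ᶠ c′ i)) (λ l → begin
      ∑ᶠ (λ i → (c i +ᶠ (-ᶠ c′ i)) · W (ρ i) l)        ≈⟨ ∑ᶠ-cong (λ i → distribʳ _ _ _) ⟩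
      ∑ᶠ (λ i → c i · W (ρ i) l +ᶠ (-ᶠ c′ i) · W (ρ i) l) ≈⟨ ∑ᶠ-+ _ _ ⟩
      Φ c l +ᶠ ∑ᶠ (λ i → (-ᶠ c′ i) · W (ρ i) l)        ≈⟨ +-congʳ (h l) ⟩
      Φ c′ l +ᶠ ∑ᶠ (λ i → (-ᶠ c′ i) · W (ρ i) l)       ≈⟨ ∑ᶠ-+ _ _ ⟨
      ∑ᶠ (λ i → c′ i · W (ρ i) l +ᶠ (-ᶠ c′ i) · W (ρ i) l) ≈⟨ ∑ᶠ-0 (λ i → ≈-trans (≈-sym (distribʳ _ _ _)) (≈-trans (*-congʳ (-‿inverseʳ _)) (zeroˡ _))) ⟩
      0#                                                ∎) i)
    too-many : s ^ suc r ≤ s ^ r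
    too-many = ℕR.begin
      s ^ suc r                      ℕR.≡⟨ length-allFuns (suc r) elems ⟨
      length (allFuns (suc r) elems) ℕR.≤⟨ length-≤ (λ c v → ∀ l → Φ c l ≈ v l) (λ e i → ≈-sym (e i))
                                             (allFuns-distinct _≈_ (suc r) distinct)
                                             (All.universal (λ c → allFuns-complete _≈_ r complete (Φ c)) _)
                                             (λ {c} {c′} e e′ → Φ-injective c c′ λ l → ≈-trans (e l) (≈-sym (e′ l))) ⟩
      length (allFuns r elems)       ℕR.≡⟨ length-allFuns r elems ⟩
      s ^ r                          ℕR.∎

  Pivot : Carrier → Set
  Pivot a = a ≈ σ a × ∃ λ b → a · b ≈ 1# × b ≈ σ b

  isNonzero : Carrier → Bool
  isNonzero x = not (does (x ≟ᶠ 0#))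

  nonzeros : List Carrier
  nonzeros = filter (λ x → isNonzero x Bool.≟ true) fixed

  -- This is q - 1 ≥ q/2 without subtraction. It is the source of the factor `2 ^ r` in the lower
  -- bound for low-rank matrices.
  q≤2*nonzeros : q ≤ 2 * length nonzeros
  q≤2*nonzeros = double (ℕR.begin
    q                                         ℕR.≡⟨ length-fixed ⟨
    length fixed                              ℕR.≡⟨ count-not (λ x → does (x ≟ᶠ 0#)) fixed ⟨
    count (λ x → does (x ≟ᶠ 0#)) fixed + count isNonzero fixed
      ℕR.≤⟨ ℕₚ.+-mono-≤ (count-≤1 (λ x → does (x ≟ᶠ 0#)) fixed-distinct
              (λ x y ex ey → ≈-trans (does-elim (x ≟ᶠ 0#) ex) (≈-sym (does-elim (y ≟ᶠ 0#) ey))))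
              (ℕₚ.≤-reflexive (sym (length-filter≡count isNonzero fixed))) ⟩
    1 + length nonzeros                       ℕR.∎)
    where
    double : q ≤ 1 + length nonzeros → q ≤ 2 * length nonzeros
    double h = ℕₚ.≤-trans h (ℕₚ.≤-trans
      (ℕₚ.+-monoˡ-≤ (length nonzeros) (ℕₚ.≤-pred (ℕₚ.≤-trans 2≤q h)))
      (ℕₚ.+-monoʳ-≤ (length nonzeros) (ℕₚ.m≤m+n _ 0)))

  nonzeros-Pivot : All Pivot nonzeros
  nonzeros-Pivot = All.zipWith (λ {a} (a-fixed , a≉0) → a-fixed , pivot a a-fixed λ e →
      contradiction (trans (sym a≉0) (cong not (dec-true (a ≟ᶠ 0#) e))) λ ())
    (Allₚ.filter⁺ (λ x → isNonzero x Bool.≟ true) fixed-All , filter-All isNonzero fixed)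
    where
    pivot : ∀ a → a ≈ σ a → ¬ (a ≈ 0#) → ∃ λ b → a · b ≈ 1# × b ≈ σ b
    pivot a a-fixed a≉0 with (b , b-fixed) , ab≈1 ← FiniteField.inverse fixedField (a , a-fixed) a≉0 = b , ab≈1 , b-fixed

  schur : ∀ {n} → Σ Carrier Pivot → (Fin n → Carrier) → Mat n → Mat (suc n)
  schur (a , _ , b , _) u M = block a u (λ i j → b · (σ (u i) · u j) +ᶠ M i j)

  schur-Herm : ∀ {n} p u (M : Mat n) → Herm M → Herm (schur p u M)
  schur-Herm (a , a-fixed , b , _ , b-fixed) u M h = block-Herm a-fixed λ i j → begin
    b · (σ (u j) · u i) +ᶠ M j i                ≈⟨ +-cong (*-cong b-fixed (*-comm _ _)) (h i j) ⟩
    σ b · (u i · σ (u j)) +ᶠ σ (M i j)          ≈⟨ +-congʳ (*-congˡ (*-congʳ (σ-involutive (u i)))) ⟨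
    σ b · (σ (σ (u i)) · σ (u j)) +ᶠ σ (M i j)  ≈⟨ +-congʳ (≈-trans (σ-* _ _) (*-congˡ (σ-* _ _))) ⟨
    σ (b · (σ (u i) · u j)) +ᶠ σ (M i j)        ≈⟨ σ-+ _ _ ⟨
    σ (b · (σ (u i) · u j) +ᶠ M i j)            ∎

  -- The new first column (a, u*) times the new first row (1, a⁻¹u) produces the border and the
  -- rank-one correction. The old factors, padded with zeros, produce M.
  schur-Factors : ∀ {n r} p u (M : Mat n) → Factors r M → Factors (suc r) (schur p u M)
  schur-Factors {n} {r} (a , a-fixed , b , ab≈1 , b-fixed) u M (W , U , M≈WU) =
    W′ , U′ , λ i j → ≈-trans (entry i j) (≈-sym (∑ᶠ-suc (λ l → W′ i l · U′ l j)))
    where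
    W′ : Fin (suc n) → Fin (suc r) → Carrier
    W′ zero    zero    = a
    W′ zero    (suc l) = 0#
    W′ (suc i) zero    = σ (u i)
    W′ (suc i) (suc l) = W i l
    U′ : Fin (suc r) → Fin (suc n) → Carrier
    U′ zero    zero    = 1#
    U′ zero    (suc j) = b · u j
    U′ (suc l) zero    = 0#
    U′ (suc l) (suc j) = U l j
    tail-0 : ∀ {f : Fin r → Carrier} {x y} → (∀ l → f l ≈ 0#) → x ≈ y → x ≈ y +ᶠ ∑ᶠ f
    tail-0 h e = ≈-trans e (≈-trans (≈-sym (+-identityʳ _)) (+-congˡ (≈-sym (∑ᶠ-0 h))))
    entry : ∀ i j → schur (a , a-fixed , b , ab≈1 , b-fixed) u M i j ≈
                    W′ i zero · U′ zero j +ᶠ ∑ᶠ (λ l → W′ i (suc l) · U′ (suc l) j)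
    entry zero    zero    = tail-0 (λ l → zeroˡ _) (≈-sym (*-identityʳ a))
    entry zero    (suc j) = tail-0 (λ l → zeroˡ _) (≈-sym (≈-trans (≈-sym (*-assoc a b (u j))) (≈-trans (*-congʳ ab≈1) (*-identityˡ _))))
    entry (suc i) zero    = tail-0 (λ l → zeroʳ _) (≈-sym (*-identityʳ _))
    entry (suc i) (suc j) = +-cong (≈-trans (≈-sym (*-assoc b _ _)) (≈-trans (*-congʳ (*-comm b _)) (*-assoc _ b _))) (M≈WU i j)

  -- The corner is a, the rest of the first row is u, and M is recovered as the Schur complement of
  -- the corner.
  schur-injective : ∀ {n} p p′ u u′ {M M′ : Mat n} → schur p u M ≐ schur p′ u′ M′ →
                    proj₁ p ≈ proj₁ p′ × (∀ j → u j ≈ u′ j) × M ≐ M′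
  schur-injective (a , _ , b , ab≈1 , _) (a′ , _ , b′ , a′b′≈1 , _) u u′ {M} {M′} e =
    a≈a′ , u≈u′ , λ i j → +-cancelˡ (b · (σ (u i) · u j)) _ _
      (≈-trans (e (suc i) (suc j)) (+-congʳ (*-cong (≈-sym b≈b′) (*-cong (σ-cong (≈-sym (u≈u′ i))) (≈-sym (u≈u′ j))))))
    where
    open RingProperties ring using (+-cancelˡ)
    a≈a′ = e zero zero
    u≈u′ = λ j → e zero (suc j)
    a≉0 : ¬ (a ≈ 0#)
    a≉0 h = 0≉1 (≈-trans (≈-sym (zeroˡ b)) (≈-trans (*-congʳ (≈-sym h)) ab≈1))
    b≈b′ : b ≈ b′
    b≈b′ = *-cancelˡ-nonzero a≉0 (≈-trans ab≈1 (≈-trans (≈-sym a′b′≈1) (*-congʳ (≈-sym a≈a′))))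

  lowRank : ∀ r s → List (Mat (r + s))
  lowRank zero    s = (λ _ _ → 0#) ∷ []
  lowRank (suc r) s = map (λ (p , u , M) → schur p u M)
    (pairs (attach nonzeros-Pivot) (pairs (allFuns (r + s) elems) (lowRank r s)))

  lowRank-All : ∀ r s → All (λ M → Herm M × Factors r M) (lowRank r s)
  lowRank-All zero    s = ((λ _ _ → ≈-sym σ-0) , (λ _ ()) , (λ ()) , λ _ _ → ≈-sym (∑ᶠ-zero _)) ∷ []
  lowRank-All (suc r) s = Allₚ.map⁺ (All.map
    (λ {(p , u , M)} (_ , _ , h , f) → schur-Herm p u M h , schur-Factors p u M f)
    (pairs-All (All.universal (λ _ → ≈-refl {0#}) (attach nonzeros-Pivot))
      (pairs-All (All.universal (λ _ → ≈-refl {0#}) (allFuns (r + s) elems)) (lowRank-All r s))))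

  -- The corner adjoined last is invertible. Since the zero matrix does not belong to the set to be
  -- avoided, at least one bordering is required.
  lowRank-nonzero : ∀ r s → All (λ M → ¬ (∀ i j → M i j ≈ 0#)) (lowRank (suc r) s)
  lowRank-nonzero r s = Allₚ.map⁺ (All.universal (λ ((a , _ , b , ab≈1 , _) , _) e →
    0≉1 (≈-trans (≈-sym (zeroˡ b)) (≈-trans (*-congʳ (≈-sym (e zero zero))) ab≈1)))
    (pairs (attach nonzeros-Pivot) (pairs (allFuns (r + s) elems) (lowRank r s))))

  lowRank-distinct : ∀ r s → Distinct _≐_ (lowRank r s)
  lowRank-distinct zero    s = [] ∷ []
  lowRank-distinct (suc r) s = AllPairsₚ.map⁺ (AllPairs.map
    (λ {(p , u , _)} {(p′ , u′ , _)} n e → n (schur-injective p p′ u u′ e))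
    (pairs-distinct {_≈₁_ = λ p p′ → proj₁ p ≈ proj₁ p′}
      (AllPairsₚ.map⁻ (subst (Distinct _≈_) (sym (map-attach nonzeros-Pivot)) (Distinct-filter isNonzero fixed-distinct)))
      (pairs-distinct (allFuns-distinct _≈_ (r + s) distinct) (lowRank-distinct r s))))

  -- With n = r + s the exponent is r(2n - r). Bordering a matrix of size m offers at least q/2
  -- corners and q^(2m) rows, for m from s up to r + s - 1.
  lowRank-size : ∀ r s → q ^ (r * (r + 2 * s)) ≤ 2 ^ r * length (lowRank r s)
  lowRank-size zero    s = ℕₚ.≤-refl
  lowRank-size (suc r) s = ℕR.begin
    q ^ (suc r * (suc r + 2 * s))                   ℕR.≡⟨ cong (q ^_) (exponent r s) ⟩
    q ^ (1 + (2 * (r + s) + r * (r + 2 * s)))       ℕR.≡⟨ cong (q *_) (ℕₚ.^-distribˡ-+-* q (2 * (r + s)) _) ⟩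
    q * (q ^ (2 * (r + s)) * q ^ (r * (r + 2 * s)))
      ℕR.≤⟨ ℕₚ.*-mono-≤ q≤2*nonzeros (ℕₚ.*-monoʳ-≤ (q ^ (2 * (r + s))) (lowRank-size r s)) ⟩
    2 * z * (y * (2 ^ r * x))                       ℕR.≡⟨ rearrange z y (2 ^ r) x ⟩
    2 * 2 ^ r * (z * (y * x))                       ℕR.≡⟨ cong (2 * 2 ^ r *_) (sym count-params) ⟩
    2 ^ suc r * length (lowRank (suc r) s)          ℕR.∎
    where
    x y z : ℕ
    x = length (lowRank r s)
    y = q ^ (2 * (r + s))
    z = length nonzeros
    exponent : ∀ r s → suc r * (suc r + 2 * s) ≡ 1 + (2 * (r + s) + r * (r + 2 * s))
    exponent = solve-∀
    rearrange : ∀ z y w x → 2 * z * (y * (w * x)) ≡ 2 * w * (z * (y * x))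
    rearrange = solve-∀
    count-params : length (lowRank (suc r) s) ≡ z * (y * x)
    count-params = trans (length-map _ (pairs (attach nonzeros-Pivot) _)) (trans (length-pairs (attach nonzeros-Pivot) _)
      (cong₂ _*_ (trans (sym (length-map proj₁ (attach nonzeros-Pivot))) (cong length (map-attach nonzeros-Pivot)))
        (trans (length-pairs (allFuns (r + s) elems) _) (cong (_* x) (length-elems^ (r + s))))))

-- Few Hermitian matrices of low rank

module RowSpace (q : ℕ) (q-pp : IsPrimePower q) (F : FiniteField (q * q)) where
  open FiniteField F hiding (zero) renaming
    (_+_ to _+ᶠ_; -_ to -ᶠ_; _-_ to _-ᶠ_; refl to ≈-refl; sym to ≈-sym; trans to ≈-trans; _≟_ to _≟ᶠ_)
  open FieldTheory F
  open Conjugation q q-pp F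
  open Hermitian q q-pp F
  open LowRank q q-pp F
  open RingProperties ring using (-‿distribˡ-*)
  open SetoidReasoning setoid
  private
    module ℕR = ℕₚ.≤-Reasoning

  InSpan : ∀ {n s} → Mat n → (Fin s → Fin n) → Fin n → Set
  InSpan {n} {s} M ρ i = ∃ λ (c : Fin s → Carrier) → ∀ j → M i j ≈ ∑ᶠ (λ l → c l · M (ρ l) j)

  InSpan? : ∀ {n s} (M : Mat n) (ρ : Fin s → Fin n) i → Dec (InSpan M ρ i)
  InSpan? {n} {s} M ρ i with Any.any? (λ c → Finₚ.all? (λ j → M i j ≟ᶠ ∑ᶠ (λ l → c l · M (ρ l) j))) (allFuns s elems)
  ... | yes a = yes (Any.satisfied a)
  ... | no ¬a = no λ (c , h) → ¬a (Any.map (λ e j → ≈-trans (h j) (∑ᶠ-cong λ l → *-congʳ (e l))) (allFuns-complete _≈_ s complete c))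

  δ : ∀ {s} → Fin s → Fin s → Carrier
  δ l m with m Fin.≟ l
  ... | yes _ = 1#
  ... | no  _ = 0#

  ∑ᶠ-δ : ∀ {s} l (f : Fin s → Carrier) → ∑ᶠ (λ m → δ l m · f m) ≈ f l
  ∑ᶠ-δ l f = ≈-trans (∑ᶠ-single (λ m → δ l m · f m) l off) at
    where
    off : ∀ m → m ≢ l → δ l m · f m ≈ 0#
    off m m≢l with m Fin.≟ l
    ... | yes e = contradiction e m≢l
    ... | no  _ = zeroˡ _
    at : δ l l · f l ≈ f l
    at with l Fin.≟ l
    ... | yes _ = *-identityˡ _
    ... | no  n = contradiction refl n

  private
    -- In a relation with nonzero coefficient at the new row, division by that coefficient would
    -- place the row in the span of the others.
    extend-Indep : ∀ {n s} (M : Mat n) (ρ : Fin s → Fin n) i → ¬ InSpan M ρ i → Indep M ρ → Indep M (i VF.∷ ρ)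
    extend-Indep M ρ i ¬span indep c h with c zero ≟ᶠ 0#
    ... | yes c₀≈0 = λ { zero → c₀≈0 ; (suc l) → indep (c ∘ suc) (λ j → begin
            ∑ᶠ (λ l → c (suc l) · M (ρ l) j)                        ≈⟨ +-identityˡ _ ⟨
            0# +ᶠ ∑ᶠ (λ l → c (suc l) · M (ρ l) j)                  ≈⟨ +-congʳ (≈-trans (*-congʳ c₀≈0) (zeroˡ _)) ⟨
            c zero · M i j +ᶠ ∑ᶠ (λ l → c (suc l) · M (ρ l) j)      ≈⟨ ∑ᶠ-suc _ ⟨
            ∑ᶠ (λ l → c l · M ((i VF.∷ ρ) l) j)                     ≈⟨ h j ⟩
            0#                                                      ∎) l }
    ... | no c₀≉0 with z , c₀z≈1 ← inverse (c zero) c₀≉0 = contradiction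
      ((λ l → (-ᶠ z) · c (suc l)) , λ j → begin
            M i j                                                   ≈⟨ *-identityˡ _ ⟨
            1# · M i j                                              ≈⟨ *-congʳ (≈-trans (*-comm z (c zero)) c₀z≈1) ⟨
            (z · c zero) · M i j                                    ≈⟨ *-assoc z _ _ ⟩
            z · (c zero · M i j)                                    ≈⟨ *-congˡ (solve-head j) ⟩
            z · (-ᶠ T j)                                            ≈⟨ -‿distribʳ-* z (T j) ⟨
            -ᶠ (z · T j)                                            ≈⟨ -‿distribˡ-* z (T j) ⟩
            (-ᶠ z) · T j                                            ≈⟨ ·-∑ᶠ (-ᶠ z) _ ⟩
            ∑ᶠ (λ l → (-ᶠ z) · (c (suc l) · M (ρ l) j))             ≈⟨ ∑ᶠ-cong (λ l → ≈-sym (*-assoc (-ᶠ z) _ _)) ⟩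
            ∑ᶠ (λ l → ((-ᶠ z) · c (suc l)) · M (ρ l) j)             ∎) ¬span
      where
      open RingProperties ring using (-‿distribʳ-*; +-inverseˡ-unique)
      T : ∀ j → Carrier
      T j = ∑ᶠ (λ l → c (suc l) · M (ρ l) j)
      solve-head : ∀ j → c zero · M i j ≈ -ᶠ T j
      solve-head j = +-inverseˡ-unique _ _ (≈-trans (≈-sym (∑ᶠ-suc _)) (h j))

    extend-Inj : ∀ {n s} (M : Mat n) (ρ : Fin s → Fin n) i → ¬ InSpan M ρ i → Inj ρ → Inj (i VF.∷ ρ)
    extend-Inj M ρ i ¬span inj zero    zero    e = refl
    extend-Inj M ρ i ¬span inj zero    (suc l) refl = contradiction (δ l , λ j → ≈-sym (∑ᶠ-δ l _)) ¬span
    extend-Inj M ρ i ¬span inj (suc l) zero    refl = contradiction (δ l , λ j → ≈-sym (∑ᶠ-δ l _)) ¬span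
    extend-Inj M ρ i ¬span inj (suc l) (suc m) e = cong suc (inj l m e)

  SpanningRows : ∀ {n} → Mat n → ℕ → Set
  SpanningRows {n} M s = ∃ λ (ρ : Fin s → Fin n) → Inj ρ × (∀ i → InSpan M ρ i)

  -- Greedy choice: while some row lies outside the span of the chosen ones, it is added. The fuel
  -- and the number of chosen rows always sum to `suc r`, so running out of fuel would mean `suc r`
  -- independent rows.
  spanningRows : ∀ {n} r (M : Mat n) → ¬ RankAtLeast (suc r) M → ∃ λ s → s ≤ r × SpanningRows M s
  spanningRows r M ¬rank = grow (suc r) {0} (ℕₚ.+-identityʳ (suc r)) (λ ()) (λ ()) (λ _ _ ())
    where
    grow : ∀ fuel {s} → fuel + s ≡ suc r → (ρ : Fin s → Fin _) → Inj ρ → Indep M ρ → ∃ λ s → s ≤ r × SpanningRows M s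
    grow zero    refl ρ inj indep = contradiction (ρ , inj , indep) ¬rank
    grow (suc fuel) {s} e ρ inj indep with Finₚ.all? (InSpan? M ρ)
    ... | yes spans = s , subst (s ≤_) (ℕₚ.suc-injective e) (ℕₚ.m≤n+m s fuel) , ρ , inj , spans
    ... | no ¬spans with i , ¬span ← Finₚ.¬∀⟶∃¬ _ _ (InSpan? M ρ) ¬spans =
      grow fuel (trans (ℕₚ.+-suc fuel s) e) (i VF.∷ ρ) (extend-Inj M ρ i ¬span inj) (extend-Indep M ρ i ¬span indep)

  -- C A C*
  congruent : ∀ {n s} → (Fin n → Fin s → Carrier) → Mat s → Mat n
  congruent C A i j = ∑ᶠ (λ l → C i l · ∑ᶠ (λ m → σ (C j m) · A l m))

  congruent-cong : ∀ {n s} {C C′ : Fin n → Fin s → Carrier} {A A′ : Mat s} →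
                   (∀ i l → C i l ≈ C′ i l) → A ≐ A′ → congruent C A ≐ congruent C′ A′
  congruent-cong c a i j = ∑ᶠ-cong λ l → *-cong (c i l) (∑ᶠ-cong λ m → *-cong (σ-cong (c j m)) (a l m))

  minor : ∀ {n s} → Mat n → (Fin s → Fin n) → Mat s
  minor M ρ l m = M (ρ l) (ρ m)

  -- Hermitian symmetry turns the expansion along rows into one along columns with conjugated
  -- coefficients. Expanding in both directions leaves only entries of the minor.
  Herm⇒congruent : ∀ {n s} (M : Mat n) (ρ : Fin s → Fin n) (C : Fin n → Fin s → Carrier) → Herm M →
    (∀ i j → M i j ≈ ∑ᶠ (λ l → C i l · M (ρ l) j)) → M ≐ congruent C (minor M ρ)
  Herm⇒congruent M ρ C herm spans i j = ≈-trans (spans i j) (∑ᶠ-cong λ l → *-congˡ (begin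
    M (ρ l) j                                 ≈⟨ herm j (ρ l) ⟩
    σ (M j (ρ l))                             ≈⟨ σ-cong (spans j (ρ l)) ⟩
    σ (∑ᶠ (λ m → C j m · M (ρ m) (ρ l)))      ≈⟨ σ-∑ᶠ _ ⟩
    ∑ᶠ (λ m → σ (C j m · M (ρ m) (ρ l)))      ≈⟨ ∑ᶠ-cong (λ m → ≈-trans (σ-* _ _) (*-congˡ (≈-sym (herm (ρ m) (ρ l))))) ⟩
    ∑ᶠ (λ m → σ (C j m) · M (ρ l) (ρ m))      ∎))

  private
    InRange? : ∀ {n s} (ρ : Fin s → Fin n) i → Dec (∃ λ l → ρ l ≡ i)
    InRange? ρ i = Finₚ.any? (λ l → ρ l Fin.≟ i)

    -- A row indexed by `ρ` is expressed by itself, hence the single unit vector. Leaving these s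
    -- rows free would inflate the count by q^(2s²) and spoil the exponent.
    rowChoices : ∀ {n s} → (Fin s → Fin n) → Fin n → List (Fin s → Carrier)
    rowChoices {s = s} ρ i with InRange? ρ i
    ... | yes (l , _) = δ l ∷ []
    ... | no  _       = allFuns s elems

    outside : ∀ {n s} → (Fin s → Fin n) → Fin n → Bool
    outside ρ i = not (does (InRange? ρ i))

    length-rowChoices : ∀ {n s} (ρ : Fin s → Fin n) i → length (rowChoices ρ i) ≡ (q ^ (2 * s)) ^ ⟦ outside ρ i ⟧
    length-rowChoices {s = s} ρ i with InRange? ρ i
    ... | yes _ = refl
    ... | no  _ = trans (length-elems^ s) (sym (ℕₚ.*-identityʳ _))

    chooseRows : ∀ {n s} (M : Mat n) (ρ : Fin s → Fin n) → (∀ i → InSpan M ρ i) →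
      ∃ λ (C : Fin n → Fin s → Carrier) → (∀ i j → M i j ≈ ∑ᶠ (λ l → C i l · M (ρ l) j))
        × (∀ i → Any (Pointwise _≈_ (C i)) (rowChoices ρ i))
    chooseRows {n} {s} M ρ spans = (λ i → proj₁ (row i)) , (λ i → proj₁ (proj₂ (row i))) , (λ i → proj₂ (proj₂ (row i)))
      where
      row : ∀ i → ∃ λ (c : Fin s → Carrier) → (∀ j → M i j ≈ ∑ᶠ (λ l → c l · M (ρ l) j)) × Any (Pointwise _≈_ c) (rowChoices ρ i)
      row i with InRange? ρ i
      ... | yes (l , refl) = δ l , (λ j → ≈-sym (∑ᶠ-δ l _)) , here (λ _ → ≈-refl)
      ... | no  _          = proj₁ (spans i) , proj₂ (spans i) , allFuns-complete _≈_ s complete _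

    outside-count : ∀ s t (ρ : Fin s → Fin (s + t)) → Inj ρ → count (outside ρ) (allFin (s + t)) ≤ t
    outside-count s t ρ inj = ℕₚ.+-cancelˡ-≤ s _ t (ℕR.begin
      s + count (outside ρ) (allFin (s + t))
        ℕR.≤⟨ ℕₚ.+-monoˡ-≤ _ range ⟩
      count inside (allFin (s + t)) + count (outside ρ) (allFin (s + t))
        ℕR.≡⟨ count-not inside (allFin (s + t)) ⟩
      length (allFin (s + t)) ℕR.≡⟨ length-tabulate id ⟩
      s + t                   ℕR.∎)
      where
      inside : Fin (s + t) → Bool
      inside i = does (InRange? ρ i)
      range : s ≤ count inside (allFin (s + t))
      range = ℕR.begin
        s                                                        ℕR.≡⟨ length-tabulate id ⟨
        length (allFin s)                                        ℕR.≤⟨ length-≤ (λ l i → ρ l ≡ i) sym (allFin-distinct s)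
          (All-allFin λ l → filter-Any inside (λ {i} e → dec-true (InRange? ρ i) (l , e)) (Any-allFin (ρ l) refl))
          (λ {l} {m} e e′ → inj l m (trans e (sym e′))) ⟩
        length (filter (λ i → inside i Bool.≟ true) (allFin (s + t))) ℕR.≡⟨ length-filter≡count inside (allFin (s + t)) ⟩
        count inside (allFin (s + t))                            ℕR.∎

    congruents : ∀ {n s} → (Fin s → Fin n) → List (Mat n)
    congruents {n} {s} ρ = map (λ (C , A) → congruent C A) (pairs (allDepFuns n (rowChoices ρ)) (herList s))

    -- The minor accounts for s² in the exponent, and each of the at most t rows outside the range
    -- of `ρ` for 2s.
    length-congruents : ∀ s t (ρ : Fin s → Fin (s + t)) → Inj ρ → length (congruents ρ) ≤ q ^ (s * (s + 2 * t))
    length-congruents s t ρ inj = ℕR.begin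
      length (congruents ρ)
        ℕR.≡⟨ trans (length-map _ (pairs (allDepFuns (s + t) (rowChoices ρ)) (herList s))) (length-pairs (allDepFuns (s + t) (rowChoices ρ)) (herList s)) ⟩
      length (allDepFuns (s + t) (rowChoices ρ)) * length (herList s)
        ℕR.≡⟨ cong₂ _*_ (length-allDepFuns (q ^ (2 * s)) (s + t) (rowChoices ρ) (outside ρ) (length-rowChoices ρ)) (length-herList s) ⟩
      (q ^ (2 * s)) ^ count (outside ρ) (allFin (s + t)) * q ^ (s * s)
        ℕR.≤⟨ ℕₚ.*-monoˡ-≤ (q ^ (s * s)) (ℕₚ.^-monoʳ-≤ (q ^ (2 * s)) {{ℕₚ.m^n≢0 q (2 * s) {{q≢0}}}} (outside-count s t ρ inj)) ⟩
      (q ^ (2 * s)) ^ t * q ^ (s * s)  ℕR.≡⟨ cong (_* q ^ (s * s)) (ℕₚ.^-*-assoc q (2 * s) t) ⟩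
      q ^ (2 * s * t) * q ^ (s * s)    ℕR.≡⟨ ℕₚ.^-distribˡ-+-* q (2 * s * t) (s * s) ⟨
      q ^ (2 * s * t + s * s)          ℕR.≡⟨ cong (q ^_) (exponent s t) ⟩
      q ^ (s * (s + 2 * t))            ℕR.∎
      where
      q≢0 : NonZero q
      q≢0 = ℕ.>-nonZero (ℕₚ.<⇒≤ 2≤q)
      exponent : ∀ s t → 2 * s * t + s * s ≡ s * (s + 2 * t)
      exponent = solve-∀

    injections : ∀ n s → List (Fin s → Fin n)
    injections n s = filter (λ ρ → HermitianCounting.injectiveᵇ q F n s ρ Bool.≟ true) (allFuns s (allFin n))

    candidates : ∀ n s → List (Mat n)
    candidates n s = concatMap congruents (injections n s)

    -- With s + t = r + u, s (s + 2 t) = (s + t)² − t².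
    exponent-mono : ∀ s t r u → s + t ≡ r + u → s ≤ r → s * (s + 2 * t) ≤ r * (r + 2 * u)
    exponent-mono s t r u e s≤r = ℕₚ.+-cancelʳ-≤ (t * t) _ _ (ℕR.begin
      s * (s + 2 * t) + t * t   ℕR.≡⟨ square s t ⟩
      (s + t) * (s + t)         ℕR.≡⟨ cong (λ x → x * x) e ⟩
      (r + u) * (r + u)         ℕR.≡⟨ square r u ⟨
      r * (r + 2 * u) + u * u   ℕR.≤⟨ ℕₚ.+-monoʳ-≤ _ (ℕₚ.*-mono-≤ u≤t u≤t) ⟩
      r * (r + 2 * u) + t * t   ℕR.∎)
      where
      square : ∀ s t → s * (s + 2 * t) + t * t ≡ (s + t) * (s + t)
      square = solve-∀
      u≤t : u ≤ t
      u≤t = ℕₚ.+-cancelˡ-≤ r u t (subst (_≤ r + t) e (ℕₚ.+-monoˡ-≤ t s≤r))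

    length-candidates : ∀ r u s → s ≤ r → length (candidates (r + u) s) ≤ suc (r + u) ^ r * q ^ (r * (r + 2 * u))
    length-candidates r u s s≤r = ℕR.begin
      length (candidates n s)                                  ℕR.≡⟨ length≡∑ (candidates n s) ⟩
      ∑ (candidates n s) (λ _ → 1)                             ℕR.≡⟨ ∑-concatMap congruents (injections n s) _ ⟩
      ∑ (injections n s) (λ ρ → ∑ (congruents ρ) (λ _ → 1))    ℕR.≡⟨ ∑-cong (injections n s) (λ ρ → sym (length≡∑ (congruents ρ))) ⟩
      ∑ (injections n s) (λ ρ → length (congruents ρ))         ℕR.≤⟨ ∑-≤-const (All.map (λ {ρ} e → bound ρ (injectiveᵇ-elim ρ e)) (filter-All _ (allFuns s (allFin n)))) ⟩
      length (injections n s) * q ^ E                          ℕR.≤⟨ ℕₚ.*-monoˡ-≤ (q ^ E) few ⟩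
      suc n ^ r * q ^ E                                        ℕR.∎
      where
      n E : ℕ
      n = r + u
      E = r * (r + 2 * u)
      few : length (injections n s) ≤ suc n ^ r
      few = ℕR.begin
        length (injections n s)          ℕR.≤⟨ length-filter _ (allFuns s (allFin n)) ⟩
        length (allFuns s (allFin n))    ℕR.≡⟨ length-allFuns s (allFin n) ⟩
        length (allFin n) ^ s            ℕR.≡⟨ cong (_^ s) (length-tabulate id) ⟩
        -- The base is enlarged to `suc n` because monotonicity in the exponent requires a nonzero
        -- base.
        n ^ s                            ℕR.≤⟨ ℕₚ.^-monoˡ-≤ s (ℕₚ.n≤1+n n) ⟩
        suc n ^ s                        ℕR.≤⟨ ℕₚ.^-monoʳ-≤ (suc n) s≤r ⟩
        suc n ^ r                        ℕR.∎
      bound : ∀ (ρ : Fin s → Fin n) → Inj ρ → length (congruents ρ) ≤ q ^ E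
      bound ρ inj with ℕₚ.m≤n⇒∃[o]m+o≡n (ℕₚ.≤-trans s≤r (ℕₚ.m≤m+n r u))
      ... | t , e = ℕₚ.≤-trans (subst (λ n → (ρ : Fin s → Fin n) → Inj ρ → length (congruents ρ) ≤ q ^ (s * (s + 2 * t))) e (length-congruents s t) ρ inj)
                      (ℕₚ.^-monoʳ-≤ q {{ℕ.>-nonZero (ℕₚ.<⇒≤ 2≤q)}} (exponent-mono s t r u e s≤r))

  -- A cover suffices, so the candidates may repeat. The number of spanning rows may be any s ≤ r,
  -- which gives the factor `suc r`; the choice of the rows gives the power of `suc (r + u)`.
  lowRank-upper : ∀ r u {xs : List (Mat (r + u))} → Distinct _≐_ xs →
    All (λ M → Herm M × ¬ RankAtLeast (suc r) M) xs →
    length xs ≤ suc r * suc (r + u) ^ r * q ^ (r * (r + 2 * u))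
  lowRank-upper r u {xs} xs! lows = ℕR.begin
    length xs                                             ℕR.≤⟨ length-≤ _≐_ ≐-sym xs! (All.map (λ {M} (h , ¬rank) → covered M h ¬rank) lows)
                                                                  (λ e e′ → ≐-trans e (≐-sym e′)) ⟩
    length all-candidates                                 ℕR.≡⟨ length≡∑ all-candidates ⟩
    ∑ all-candidates (λ _ → 1)                            ℕR.≡⟨ ∑-concatMap (λ s → candidates n (Fin.toℕ s)) (allFin (suc r)) (λ _ → 1) ⟩
    ∑ (allFin (suc r)) (λ s → ∑ (candidates n (Fin.toℕ s)) (λ _ → 1))
      ℕR.≤⟨ ∑-≤-const (All-allFin λ s → subst (_≤ X) (length≡∑ (candidates n (Fin.toℕ s))) (length-candidates r u (Fin.toℕ s) (Finₚ.toℕ≤pred[n] s))) ⟩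
    length (allFin (suc r)) * X                           ℕR.≡⟨ cong (_* X) (length-tabulate {n = suc r} id) ⟩
    suc r * X                                             ℕR.≡⟨ ℕₚ.*-assoc (suc r) (suc n ^ r) _ ⟨
    suc r * suc n ^ r * q ^ (r * (r + 2 * u))             ℕR.∎
    where
    n X : ℕ
    n = r + u
    X = suc n ^ r * q ^ (r * (r + 2 * u))
    all-candidates : List (Mat n)
    all-candidates = concatMap (λ s → candidates n (Fin.toℕ s)) (allFin (suc r))
    covered-by : ∀ (M : Mat n) s → Herm M → SpanningRows M s → Any (M ≐_) (candidates n s)
    covered-by M s herm (ρ , inj , spans) = Anyₚ.concatMap⁺ congruents (Any.map (λ {ρ′} e → covered-at ρ′
        (λ i → proj₁ (spans i) , λ j → ≈-trans (proj₂ (spans i) j) (∑ᶠ-cong λ l → *-congˡ (reflexive (cong (λ t → M t j) (e l))))))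
      (filter-Any _ (λ {ρ′} e → injectiveᵇ-intro ρ′ λ i j h → inj i j (trans (e i) (trans h (sym (e j)))))
        (allFuns-complete _≡_ s (λ x → Any-allFin x refl) ρ)))
      where
      covered-at : ∀ (ρ : Fin s → Fin n) → (∀ i → InSpan M ρ i) → Any (M ≐_) (congruents ρ)
      covered-at ρ spans with C , C-spans , C-choice ← chooseRows M ρ spans =
        Anyₚ.map⁺ (Any.map
          (λ (c , a) → ≐-trans (Herm⇒congruent M ρ C herm C-spans) (congruent-cong c a))
          (pairs-Any (allDepFuns-complete (Pointwise _≈_) n (rowChoices ρ) C C-choice)
            (herList-complete (minor M ρ) (λ l m → herm (ρ l) (ρ m)))))
    covered : ∀ M → Herm M → ¬ RankAtLeast (suc r) M → Any (M ≐_) all-candidates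
    covered M herm ¬rank with s , s≤r , rows ← spanningRows r M ¬rank =
      Anyₚ.concatMap⁺ _ (Any.map (λ { refl → subst (λ t → Any (M ≐_) (candidates n t)) (sym (Finₚ.toℕ-fromℕ< (s≤s s≤r))) (covered-by M s herm rows) })
        (Any-allFin {P = Fin.fromℕ< (s≤s s≤r) ≡_} (Fin.fromℕ< (s≤s s≤r)) refl))

-- Vector spaces over finite fields

-- Vectors are indices in `Fin N`. Equality is then propositional and a subset is a Boolean function
-- on indices, the encoding in which the subspaces of the theorem are counted.
record VectorSpace {q : ℕ} (K : FiniteField q) (N : ℕ) : Set where
  open FiniteField K using (Carrier; _≈_; _·_; 1#) renaming (_+_ to _+ᶠ_)
  infixl 6 _+ᵛ_
  infixr 7 _∙_
  field
    _+ᵛ_        : Fin N → Fin N → Fin N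
    0ᵛ          : Fin N
    -ᵛ_         : Fin N → Fin N
    _∙_         : Carrier → Fin N → Fin N
    +ᵛ-assoc    : ∀ u v w → (u +ᵛ v) +ᵛ w ≡ u +ᵛ (v +ᵛ w)
    +ᵛ-comm     : ∀ u v → u +ᵛ v ≡ v +ᵛ u
    +ᵛ-identityˡ : ∀ v → 0ᵛ +ᵛ v ≡ v
    -ᵛ-inverseˡ : ∀ v → (-ᵛ v) +ᵛ v ≡ 0ᵛ
    ∙-cong      : ∀ {a b} v → a ≈ b → a ∙ v ≡ b ∙ v
    1∙          : ∀ v → 1# ∙ v ≡ v
    ∙-assoc     : ∀ a b v → (a · b) ∙ v ≡ a ∙ b ∙ v
    ∙-distribʳ  : ∀ a b v → (a +ᶠ b) ∙ v ≡ a ∙ v +ᵛ b ∙ v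
    ∙-distribˡ  : ∀ a u v → a ∙ (u +ᵛ v) ≡ a ∙ u +ᵛ a ∙ v

module Subspaces {q : ℕ} (K : FiniteField q) {N : ℕ} (𝕍 : VectorSpace K N) where
  open FiniteField K hiding (zero) renaming
    (_+_ to _+ᶠ_; -_ to -ᶠ_; _-_ to _-ᶠ_; refl to ≈-refl; sym to ≈-sym; trans to ≈-trans; _≟_ to _≟ᶠ_)
  open VectorSpace 𝕍
  open GroupProperties +-group using () renaming (x∙y⁻¹≈ε⇒x≈y to x-y≈0⇒x≈y)
  private
    module ℕR = ℕₚ.≤-Reasoning

  V : List (Fin N)
  V = allFin N

  length-V : length V ≡ N
  length-V = length-tabulate id

  +ᵛ-identityʳ : ∀ v → v +ᵛ 0ᵛ ≡ v
  +ᵛ-identityʳ v = trans (+ᵛ-comm v 0ᵛ) (+ᵛ-identityˡ v)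

  -ᵛ-cancel : ∀ u v → (-ᵛ u) +ᵛ (u +ᵛ v) ≡ v
  -ᵛ-cancel u v = trans (sym (+ᵛ-assoc _ u v)) (trans (cong (_+ᵛ v) (-ᵛ-inverseˡ u)) (+ᵛ-identityˡ v))

  +ᵛ-cancelˡ : ∀ u {v w} → u +ᵛ v ≡ u +ᵛ w → v ≡ w
  +ᵛ-cancelˡ u {v} {w} e = trans (sym (-ᵛ-cancel u v)) (trans (cong ((-ᵛ u) +ᵛ_) e) (-ᵛ-cancel u w))

  +ᵛ-cancelʳ : ∀ w {u v} → u +ᵛ w ≡ v +ᵛ w → u ≡ v
  +ᵛ-cancelʳ w {u} {v} e = +ᵛ-cancelˡ w (trans (+ᵛ-comm w u) (trans e (+ᵛ-comm v w)))

  idempotent⇒0ᵛ : ∀ {v} → v ≡ v +ᵛ v → v ≡ 0ᵛ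
  idempotent⇒0ᵛ {v} e = sym (+ᵛ-cancelˡ v (trans (+ᵛ-identityʳ v) e))

  0∙ : ∀ v → 0# ∙ v ≡ 0ᵛ
  0∙ v = idempotent⇒0ᵛ (trans (∙-cong v (≈-sym (+-identityˡ 0#))) (∙-distribʳ 0# 0# v))

  ∙0ᵛ : ∀ a → a ∙ 0ᵛ ≡ 0ᵛ
  ∙0ᵛ a = idempotent⇒0ᵛ (trans (cong (a ∙_) (sym (+ᵛ-identityˡ 0ᵛ))) (∙-distribˡ a 0ᵛ 0ᵛ))

  ∙-cancel : ∀ {a} → ¬ (a ≈ 0#) → ∀ {u v} → a ∙ u ≡ a ∙ v → u ≡ v
  ∙-cancel {a} a≉0 {u} {v} e with b , ab≈1 ← inverse a a≉0 =
    trans (recover u) (trans (cong (b ∙_) e) (sym (recover v)))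
    where
    recover : ∀ v → v ≡ b ∙ a ∙ v
    recover v = trans (sym (1∙ v)) (trans (∙-cong v (≈-trans (≈-sym ab≈1) (*-comm a b))) (∙-assoc b a v))

  +ᵛ-interchange : ∀ a b c d → (a +ᵛ b) +ᵛ (c +ᵛ d) ≡ (a +ᵛ c) +ᵛ (b +ᵛ d)
  +ᵛ-interchange a b c d = begin
    (a +ᵛ b) +ᵛ (c +ᵛ d) ≡⟨ +ᵛ-assoc a b _ ⟩
    a +ᵛ (b +ᵛ (c +ᵛ d)) ≡⟨ cong (a +ᵛ_) (trans (sym (+ᵛ-assoc b c d)) (trans (cong (_+ᵛ d) (+ᵛ-comm b c)) (+ᵛ-assoc c b d))) ⟩
    a +ᵛ (c +ᵛ (b +ᵛ d)) ≡⟨ +ᵛ-assoc a c _ ⟨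
    (a +ᵛ c) +ᵛ (b +ᵛ d) ∎
    where open ≡-Reasoning

  lc : ∀ {k} → (Fin k → Carrier) → (Fin k → Fin N) → Fin N
  lc {zero}  c x = 0ᵛ
  lc {suc k} c x = c zero ∙ x zero +ᵛ lc (c ∘ suc) (x ∘ suc)

  lc-cong : ∀ {k} {c c′ : Fin k → Carrier} x → (∀ i → c i ≈ c′ i) → lc c x ≡ lc c′ x
  lc-cong {zero}  x e = refl
  lc-cong {suc k} x e = cong₂ _+ᵛ_ (∙-cong (x zero) (e zero)) (lc-cong (x ∘ suc) (e ∘ suc))

  lc-+ : ∀ {k} (c c′ : Fin k → Carrier) x → lc (λ i → c i +ᶠ c′ i) x ≡ lc c x +ᵛ lc c′ x
  lc-+ {zero}  c c′ x = sym (+ᵛ-identityˡ 0ᵛ)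
  lc-+ {suc k} c c′ x = trans (cong₂ _+ᵛ_ (∙-distribʳ _ _ _) (lc-+ (c ∘ suc) (c′ ∘ suc) (x ∘ suc))) (+ᵛ-interchange _ _ _ _)

  lc-scale : ∀ {k} s (c : Fin k → Carrier) x → lc (λ i → s · c i) x ≡ s ∙ lc c x
  lc-scale {zero}  s c x = sym (∙0ᵛ s)
  lc-scale {suc k} s c x = trans (cong₂ _+ᵛ_ (∙-assoc s _ _) (lc-scale s (c ∘ suc) (x ∘ suc))) (sym (∙-distribˡ s _ _))

  lc-0 : ∀ {k} (x : Fin k → Fin N) → lc (λ _ → 0#) x ≡ 0ᵛ
  lc-0 {zero}  x = refl
  lc-0 {suc k} x = trans (cong₂ _+ᵛ_ (0∙ _) (lc-0 (x ∘ suc))) (+ᵛ-identityˡ 0ᵛ)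

  _⊖_ : ∀ {k} → (Fin k → Carrier) → (Fin k → Carrier) → Fin k → Carrier
  (c ⊖ c′) i = c i +ᶠ (-ᶠ c′ i)

  lc-⊖ : ∀ {k} (c c′ : Fin k → Carrier) x → lc c′ x +ᵛ lc (c ⊖ c′) x ≡ lc c x
  lc-⊖ c c′ x = trans (sym (lc-+ c′ (c ⊖ c′) x)) (lc-cong x λ i →
    ≈-trans (+-congˡ (+-comm _ _)) (≈-trans (≈-sym (+-assoc _ _ _)) (≈-trans (+-congʳ (-‿inverseʳ _)) (+-identityˡ _))))

  unit : ∀ {k} → Fin k → Fin k → Carrier
  unit zero    = 1# VF.∷ (λ _ → 0#)
  unit (suc i) = 0# VF.∷ unit i

  lc-unit : ∀ {k} i (x : Fin k → Fin N) → lc (unit i) x ≡ x i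
  lc-unit zero    x = trans (cong₂ _+ᵛ_ (1∙ _) (lc-0 (x ∘ suc))) (+ᵛ-identityʳ _)
  lc-unit (suc i) x = trans (cong₂ _+ᵛ_ (0∙ _) (lc-unit i (x ∘ suc))) (+ᵛ-identityˡ _)

  count-injective : ∀ (P : Fin N → Bool) (f : Fin N → Fin N) → (∀ {u v} → f u ≡ f v → u ≡ v) →
                    ∀ {xs} → Distinct _≡_ xs → count (P ∘ f) xs ≤ count P V
  count-injective P f inj {xs} xs! = ℕR.begin
    count (P ∘ f) xs                                   ℕR.≡⟨ length-filter≡count (P ∘ f) xs ⟨
    length (filter (λ v → P (f v) Bool.≟ true) xs)     ℕR.≤⟨ length-≤ (λ u v → f u ≡ v) sym (Distinct-filter (P ∘ f) xs!)
      (All.map (λ {u} h → filter-Any P (λ { refl → h }) (Any-allFin {P = f u ≡_} (f u) refl)) (filter-All (P ∘ f) xs))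
      (λ e e′ → inj (trans e (sym e′))) ⟩
    length (filter (λ v → P v Bool.≟ true) V)          ℕR.≡⟨ length-filter≡count P V ⟩
    count P V                                          ℕR.∎

  V-distinct : Distinct _≡_ V
  V-distinct = allFin-distinct N

  count-translate : ∀ (P : Fin N → Bool) w → count (λ v → P (v +ᵛ w)) V ≡ count P V
  count-translate P w = ℕₚ.≤-antisym (count-injective P (_+ᵛ w) (+ᵛ-cancelʳ w) V-distinct) (ℕR.begin
    count P V                             ℕR.≡⟨ ∑-cong V (λ v → cong (λ t → ⟦ P t ⟧) (sym (cancel v))) ⟩
    count (λ v → P ((v +ᵛ (-ᵛ w)) +ᵛ w)) V ℕR.≤⟨ count-injective (λ v → P (v +ᵛ w)) (_+ᵛ (-ᵛ w)) (+ᵛ-cancelʳ (-ᵛ w)) V-distinct ⟩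
    count (λ v → P (v +ᵛ w)) V            ℕR.∎)
    where
    cancel : ∀ v → (v +ᵛ (-ᵛ w)) +ᵛ w ≡ v
    cancel v = trans (+ᵛ-assoc v _ w) (trans (cong (v +ᵛ_) (-ᵛ-inverseˡ w)) (+ᵛ-identityʳ v))

  Nonzero : ∀ {k} → (Fin k → Carrier) → Set
  Nonzero c = ∃ λ i → ¬ (c i ≈ 0#)

  -- A nonzero combination of random vectors is uniformly distributed.
  lc-equidistributed : ∀ {k} (e : Fin k → Carrier) → Nonzero e → ∀ (P : Fin N → Bool) {ws} → Distinct _≡_ ws →
    length ws * count (λ x → P (lc e x)) (allFuns k ws) ≤ count P V * length ws ^ k
  lc-equidistributed {suc k} e (i , eᵢ≉0) P {ws} ws! with e zero ≟ᶠ 0#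
  -- With the other vectors fixed, the combination is injective in the first one. Since `ws` may be
  -- a proper part of the space, such as the members of a subspace, this yields an inequality.
  ... | no e₀≉0 = ℕR.begin
    w * count (λ x → P (lc e x)) (allFuns (suc k) ws)
      ℕR.≡⟨ cong (w *_) (trans (∑-allFuns-suc k ws _) (∑-swap ws (allFuns k ws) _)) ⟩
    w * ∑ (allFuns k ws) (λ x → count (λ v → P (e zero ∙ v +ᵛ lc (e ∘ suc) x)) ws)
      ℕR.≤⟨ ℕₚ.*-monoʳ-≤ w (∑-≤-const (All.universal (λ x → count-injective P (λ v → e zero ∙ v +ᵛ lc (e ∘ suc) x)
              (∙-cancel e₀≉0 ∘ +ᵛ-cancelʳ _) ws!) (allFuns k ws))) ⟩
    w * (length (allFuns k ws) * count P V) ℕR.≡⟨ cong (λ t → w * (t * count P V)) (length-allFuns k ws) ⟩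
    w * (w ^ k * count P V)                 ℕR.≡⟨ rearrange w (w ^ k) (count P V) ⟩
    count P V * w ^ suc k                   ℕR.∎
    where
    w : ℕ
    w = length ws
    rearrange : ∀ w a b → w * (a * b) ≡ b * (w * a)
    rearrange = solve-∀
  ... | yes e₀≈0 = ℕR.begin
    w * count (λ x → P (lc e x)) (allFuns (suc k) ws)
      ℕR.≡⟨ cong (w *_) (∑-allFuns-suc k ws _) ⟩
    w * ∑ ws (λ v → ∑ (allFuns k ws) (λ x → ⟦ P (e zero ∙ v +ᵛ lc (e ∘ suc) x) ⟧))
      ℕR.≡⟨ cong (w *_) (∑-cong ws λ v → ∑-cong (allFuns k ws) λ x → cong (λ t → ⟦ P t ⟧)
              (trans (cong (_+ᵛ lc (e ∘ suc) x) (trans (∙-cong v e₀≈0) (0∙ v))) (+ᵛ-identityˡ _))) ⟩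
    w * ∑ ws (λ v → count (λ x → P (lc (e ∘ suc) x)) (allFuns k ws))
      ℕR.≡⟨ cong (w *_) (∑-const ws _) ⟩
    w * (w * count (λ x → P (lc (e ∘ suc) x)) (allFuns k ws))
      ℕR.≤⟨ ℕₚ.*-monoʳ-≤ w (lc-equidistributed (e ∘ suc) (tail-nonzero i eᵢ≉0) P ws!) ⟩
    w * (count P V * w ^ k)   ℕR.≡⟨ rearrange w (count P V) (w ^ k) ⟩
    count P V * w ^ suc k     ℕR.∎
    where
    w : ℕ
    w = length ws
    rearrange : ∀ w a b → w * (a * b) ≡ a * (w * b)
    rearrange = solve-∀
    tail-nonzero : ∀ i → ¬ (e i ≈ 0#) → Nonzero (e ∘ suc)
    tail-nonzero zero    n = contradiction e₀≈0 n
    tail-nonzero (suc i) n = i , n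

  -- One representative of each point of the projective space: the first nonzero coordinate is 1.
  normalised : ∀ k → List (Fin k → Carrier)
  normalised zero    = []
  normalised (suc k) = map (1# VF.∷_) (allFuns k elems) ++ map (0# VF.∷_) (normalised k)

  normalised-nonzero : ∀ k → All Nonzero (normalised k)
  normalised-nonzero zero    = []
  normalised-nonzero (suc k) = Allₚ.++⁺
    (Allₚ.map⁺ (All.universal (λ _ → zero , λ e → 0≉1 (≈-sym e)) (allFuns k elems)))
    (Allₚ.map⁺ (All.map (λ (i , n) → suc i , n) (normalised-nonzero k)))

  normalise : ∀ {k} (c : Fin k → Carrier) → Nonzero c →
              Any (λ c′ → ∃ λ s → ¬ (s ≈ 0#) × (∀ i → c′ i ≈ s · c i)) (normalised k)
  normalise {suc k} c (i , cᵢ≉0) with c zero ≟ᶠ 0#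
  ... | no c₀≉0 with s , c₀s≈1 ← inverse (c zero) c₀≉0 = Anyₚ.++⁺ˡ (Anyₚ.map⁺ (Any.map
        (λ h → s , (λ s≈0 → 0≉1 (≈-trans (≈-sym (≈-trans (*-congˡ s≈0) (zeroʳ _))) c₀s≈1))
             , λ { zero → ≈-sym (≈-trans (*-comm s _) c₀s≈1) ; (suc j) → ≈-sym (h j) })
        (allFuns-complete _≈_ k complete (λ j → s · c (suc j)))))
  ... | yes c₀≈0 = Anyₚ.++⁺ʳ (map (1# VF.∷_) (allFuns k elems)) (Anyₚ.map⁺ (Any.map
        (λ (s , s≉0 , h) → s , s≉0 , λ { zero → ≈-sym (≈-trans (*-congˡ c₀≈0) (zeroʳ s)) ; (suc j) → h j })
        (normalise (c ∘ suc) (tail-nonzero i cᵢ≉0))))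
    where
    tail-nonzero : ∀ i → ¬ (c i ≈ 0#) → Nonzero (c ∘ suc)
    tail-nonzero zero    n = contradiction c₀≈0 n
    tail-nonzero (suc i) n = i , n

  private
    length-normalised-suc : ∀ k → length (normalised (suc k)) ≡ q ^ k + length (normalised k)
    length-normalised-suc k = trans (length-++ (map (1# VF.∷_) (allFuns k elems)))
      (cong₂ _+_ (trans (length-map _ (allFuns k elems)) (trans (length-allFuns k elems) (cong (_^ k) size)))
                 (length-map _ (normalised k)))

  -- There are (q^k - 1)/(q - 1) projective points, at most q^k / 2 of them once q ≥ 3. For q = 2
  -- this fails from k = 2 on, which is the reason for the assumption.
  2*normalised≤ : 3 ≤ q → ∀ k → 2 * length (normalised k) ≤ q ^ k
  2*normalised≤ 3≤q zero    = z≤n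
  2*normalised≤ 3≤q (suc k) = ℕR.begin
    2 * length (normalised (suc k))           ℕR.≡⟨ cong (2 *_) (length-normalised-suc k) ⟩
    2 * (q ^ k + length (normalised k))       ℕR.≡⟨ ℕₚ.*-distribˡ-+ 2 (q ^ k) _ ⟩
    2 * q ^ k + 2 * length (normalised k)     ℕR.≤⟨ ℕₚ.+-monoʳ-≤ (2 * q ^ k) (2*normalised≤ 3≤q k) ⟩
    2 * q ^ k + q ^ k                         ℕR.≡⟨ three (q ^ k) ⟩
    3 * q ^ k                                 ℕR.≤⟨ ℕₚ.*-monoˡ-≤ (q ^ k) 3≤q ⟩
    q ^ suc k                                 ℕR.∎
    where
    three : ∀ x → 2 * x + x ≡ 3 * x
    three = solve-∀

  normalised≤2q^ : 3 ≤ q → ∀ k → length (normalised (suc k)) ≤ 2 * q ^ k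
  normalised≤2q^ 3≤q k = ℕR.begin
    length (normalised (suc k))       ℕR.≡⟨ length-normalised-suc k ⟩
    q ^ k + length (normalised k)     ℕR.≤⟨ ℕₚ.+-monoʳ-≤ (q ^ k) (ℕₚ.≤-trans (ℕₚ.m≤n*m _ 2) (2*normalised≤ 3≤q k)) ⟩
    q ^ k + q ^ k                     ℕR.≡⟨ cong (q ^ k +_) (ℕₚ.+-identityʳ _) ⟨
    2 * q ^ k                         ℕR.∎

  hits : ∀ {k} → (Fin N → Bool) → (Fin k → Fin N) → Bool
  hits {k} P x = any (λ c → P (lc c x)) (normalised k)

  -- Union bound over projective points. It is applied twice: to the zero vector, where it counts
  -- dependent tuples, and to the set of low-rank matrices.
  hits-count : ∀ (P : Fin N → Bool) k {ws} → Distinct _≡_ ws →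
    length ws * count (hits P) (allFuns k ws) ≤ length (normalised k) * (count P V * length ws ^ k)
  hits-count P k {ws} ws! = ℕR.begin
    length ws * count (hits P) (allFuns k ws)
      ℕR.≤⟨ ℕₚ.*-monoʳ-≤ (length ws) (∑-mono (allFuns k ws) (λ x → ⟦any⟧≤count (λ c → P (lc c x)) (normalised k))) ⟩
    length ws * ∑ (allFuns k ws) (λ x → count (λ c → P (lc c x)) (normalised k))
      ℕR.≡⟨ cong (length ws *_) (∑-swap (allFuns k ws) (normalised k) _) ⟩
    length ws * ∑ (normalised k) (λ c → count (λ x → P (lc c x)) (allFuns k ws))
      ℕR.≡⟨ *-distribˡ-∑ (normalised k) (length ws) _ ⟩
    ∑ (normalised k) (λ c → length ws * count (λ x → P (lc c x)) (allFuns k ws))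
      ℕR.≤⟨ ∑-≤-const (All.map (λ {c} c≉0 → lc-equidistributed c c≉0 P ws!) (normalised-nonzero k)) ⟩
    length (normalised k) * (count P V * length ws ^ k) ℕR.∎

  isZero : Fin N → Bool
  isZero v = does (v Fin.≟ 0ᵛ)

  -- Phrased through `hits`, so that the union bound for arbitrary predicates also bounds the
  -- dependent tuples.
  independent : ∀ {k} → (Fin k → Fin N) → Bool
  independent x = not (hits isZero x)

  independent⇒trivial : ∀ {k} (x : Fin k → Fin N) → independent x ≡ true → ∀ c → lc c x ≡ 0ᵛ → ∀ i → c i ≈ 0#
  independent⇒trivial x ind c lc≡0 i with c i ≟ᶠ 0#
  ... | yes e = e
  ... | no  n = contradiction (trans (sym ind) (cong not (any-intro _
    (Any.map (λ {c′} (s , _ , h) → dec-true (lc c′ x Fin.≟ 0ᵛ)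
      (trans (lc-cong x h) (trans (lc-scale s c x) (trans (cong (s ∙_) lc≡0) (∙0ᵛ s))))) (normalise c (i , n)))))) λ ()

  lc-injective : ∀ {k} (x : Fin k → Fin N) → independent x ≡ true → ∀ c c′ → lc c x ≡ lc c′ x → ∀ i → c i ≈ c′ i
  lc-injective x ind c c′ e i = x-y≈0⇒x≈y _ _ (independent⇒trivial x ind (c ⊖ c′)
    (+ᵛ-cancelˡ (lc c′ x) (trans (lc-⊖ c c′ x) (trans e (sym (+ᵛ-identityʳ _))))) i)

  -- Each projective point sends at most a fraction 1/w of the tuples to zero, where w is the length
  -- of `ws`, and there are at most q^k / 2 ≤ w / 2 points. Taking `ws` to be the whole space or a
  -- subspace gives the two halves needed later.
  independent-count : 3 ≤ q → ∀ k {ws} → Distinct _≡_ ws → q ^ k ≤ length ws →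
                      length ws ^ k ≤ 2 * count independent (allFuns k ws)
  independent-count 3≤q k {ws} ws! q^k≤w = ℕₚ.+-cancelˡ-≤ (w ^ k) _ _ (ℕR.begin
    w ^ k + w ^ k        ℕR.≡⟨ cong (w ^ k +_) (ℕₚ.+-identityʳ _) ⟨
    2 * w ^ k            ℕR.≡⟨ cong (2 *_) (trans (count-not (hits isZero) (allFuns k ws)) (length-allFuns k ws)) ⟨
    2 * (D + I)          ℕR.≡⟨ ℕₚ.*-distribˡ-+ 2 D I ⟩
    2 * D + 2 * I        ℕR.≤⟨ ℕₚ.+-monoˡ-≤ (2 * I) (ℕₚ.*-cancelˡ-≤ w {{w≢0}} dependent) ⟩
    w ^ k + 2 * I        ℕR.∎)
    where
    w D I : ℕ
    w = length ws
    D = count (hits isZero) (allFuns k ws)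
    I = count independent (allFuns k ws)
    w≢0 : NonZero w
    w≢0 = ℕ.>-nonZero (ℕₚ.≤-trans (ℕₚ.m^n>0 q {{ℕ.>-nonZero (ℕₚ.≤-trans (s≤s z≤n) 3≤q)}} k) q^k≤w)
    one-zero : count isZero V ≤ 1
    one-zero = count-≤1 isZero V-distinct λ u v eu ev →
      trans (does-elim (u Fin.≟ 0ᵛ) eu) (sym (does-elim (v Fin.≟ 0ᵛ) ev))
    swap : ∀ a b c → a * (b * c) ≡ b * (a * c)
    swap = solve-∀
    dependent : w * (2 * D) ≤ w * w ^ k
    dependent = ℕR.begin
      w * (2 * D)                                       ℕR.≡⟨ swap w 2 D ⟩
      2 * (w * D)                                       ℕR.≤⟨ ℕₚ.*-monoʳ-≤ 2 (hits-count isZero k ws!) ⟩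
      2 * (length (normalised k) * (count isZero V * w ^ k))
        ℕR.≤⟨ ℕₚ.*-monoʳ-≤ 2 (ℕₚ.*-monoʳ-≤ (length (normalised k)) (ℕₚ.*-monoˡ-≤ (w ^ k) one-zero)) ⟩
      2 * (length (normalised k) * (1 * w ^ k))         ℕR.≡⟨ cong (λ t → 2 * (length (normalised k) * t)) (ℕₚ.*-identityˡ _) ⟩
      2 * (length (normalised k) * w ^ k)               ℕR.≡⟨ ℕₚ.*-assoc 2 (length (normalised k)) _ ⟨
      2 * length (normalised k) * w ^ k                 ℕR.≤⟨ ℕₚ.*-monoˡ-≤ (w ^ k) (ℕₚ.≤-trans (2*normalised≤ 3≤q k) q^k≤w) ⟩
      w * w ^ k                                         ℕR.∎

-- The second moment method

module SecondMoment {q : ℕ} (K : FiniteField q) {N : ℕ} (𝕍 : VectorSpace K N) (B : Fin N → Bool) (k : ℕ) where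
  open FiniteField K hiding (zero) renaming
    (_+_ to _+ᶠ_; -_ to -ᶠ_; _-_ to _-ᶠ_; refl to ≈-refl; sym to ≈-sym; trans to ≈-trans; _≟_ to _≟ᶠ_)
  open VectorSpace 𝕍
  open Subspaces K 𝕍
  open GroupProperties +-group using () renaming (x∙y⁻¹≈ε⇒x≈y to x-y≈0⇒x≈y)
  private
    module ℕR = ℕₚ.≤-Reasoning

    As : List (Fin k → Carrier)
    As = allFuns k elems

    length-As : length As ≡ q ^ k
    length-As = trans (length-allFuns k elems) (cong (_^ k) size)

    Xs : List (Fin k → Fin N)
    Xs = allFuns k V

    length-Xs : length Xs ≡ N ^ k
    length-Xs = trans (length-allFuns k V) (cong (_^ k) length-V)

    -- `A` is the number of affine points. `M` is N times the expected number of hits, the scaling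
    -- that keeps all moments integral.
    b A M : ℕ
    b = count B V
    A = q ^ k
    M = A * b

  affine : (Fin k → Carrier) → (Fin (suc k) → Fin N) → Fin N
  affine a x = x zero +ᵛ lc a (x ∘ suc)

  affineHit : (Fin (suc k) → Fin N) → (Fin k → Carrier) → Bool
  affineHit x a = B (affine a x)

  affineHits : (Fin (suc k) → Fin N) → ℕ
  affineHits x = count (affineHit x) As

  avoids : (Fin (suc k) → Fin N) → Bool
  avoids x = not (any (affineHit x) As)

  private
    first-moment : ∀ a → count (λ x → B (affine a x)) (allFuns (suc k) V) ≡ N ^ k * b
    first-moment a = begin
      count (λ x → B (affine a x)) (allFuns (suc k) V)      ≡⟨ trans (∑-allFuns-suc k V _) (∑-swap V Xs _) ⟩
      ∑ Xs (λ x → count (λ v → B (v +ᵛ lc a x)) V)          ≡⟨ ∑-cong Xs (λ x → count-translate B (lc a x)) ⟩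
      ∑ Xs (λ _ → b)                                        ≡⟨ ∑-const Xs b ⟩
      length Xs * b                                         ≡⟨ cong (_* b) length-Xs ⟩
      N ^ k * b                                             ∎
      where open ≡-Reasoning

    total : ∑ (allFuns (suc k) V) affineHits ≡ M * N ^ k
    total = begin
      ∑ (allFuns (suc k) V) affineHits                                ≡⟨ ∑-swap (allFuns (suc k) V) As _ ⟩
      ∑ As (λ a → count (λ x → B (affine a x)) (allFuns (suc k) V))   ≡⟨ ∑-cong As first-moment ⟩
      ∑ As (λ _ → N ^ k * b)                                          ≡⟨ ∑-const As _ ⟩
      length As * (N ^ k * b)                                         ≡⟨ cong (_* (N ^ k * b)) length-As ⟩
      A * (N ^ k * b)                                                 ≡⟨ rearrange A (N ^ k) b ⟩
      M * N ^ k                                                       ∎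
      where
      open ≡-Reasoning
      rearrange : ∀ a n b → a * (n * b) ≡ a * b * n
      rearrange = solve-∀

    same : (Fin k → Carrier) → (Fin k → Carrier) → Bool
    same a a′ = does (Finₚ.all? (λ i → a i ≟ᶠ a′ i))

    pairHits : (a a′ : Fin k → Carrier) → ℕ
    pairHits a a′ = ∑ (allFuns (suc k) V) (λ x → ⟦ affineHit x a ⟧ * ⟦ affineHit x a′ ⟧)

    ⟦⟧≤1 : ∀ b → ⟦ b ⟧ ≤ 1
    ⟦⟧≤1 true  = ℕₚ.≤-refl
    ⟦⟧≤1 false = z≤n

    ⟦∧⟧ : ∀ a b → ⟦ a ⟧ * ⟦ b ⟧ ≡ ⟦ a ∧ b ⟧
    ⟦∧⟧ true  b = ℕₚ.+-identityʳ _
    ⟦∧⟧ false b = refl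

    -- For a ≠ a′ the points x₀ + a x and x₀ + a′ x are pairwise independent.
    pairHits-distinct : ∀ a a′ → Nonzero (a′ ⊖ a) → N * pairHits a a′ ≤ b * b * N ^ k
    pairHits-distinct a a′ e≉0 = ℕR.begin
      N * pairHits a a′
        ℕR.≡⟨ cong (N *_) (trans (∑-allFuns-suc k V _) (∑-swap V Xs _)) ⟩
      N * ∑ Xs (λ x → ∑ V (λ v → ⟦ B (v +ᵛ lc a x) ⟧ * ⟦ B (v +ᵛ lc a′ x) ⟧))
        ℕR.≡⟨ cong (N *_) (∑-cong Xs λ x → trans (∑-cong V λ v →
                trans (⟦∧⟧ (B (v +ᵛ lc a x)) _) (cong (λ t → ⟦ B (v +ᵛ lc a x) ∧ B t ⟧) (shift v x)))
                (count-translate (λ y → B y ∧ B (y +ᵛ lc e x)) (lc a x))) ⟩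
      N * ∑ Xs (λ x → count (λ y → B y ∧ B (y +ᵛ lc e x)) V)
        ℕR.≡⟨ cong (N *_) (∑-cong Xs λ x → ∑-cong V λ y → sym (⟦∧⟧ (B y) _)) ⟩
      N * ∑ Xs (λ x → ∑ V (λ y → ⟦ B y ⟧ * ⟦ B (y +ᵛ lc e x) ⟧))
        ℕR.≡⟨ cong (N *_) (trans (∑-swap Xs V _) (∑-cong V λ y → sym (*-distribˡ-∑ Xs ⟦ B y ⟧ _))) ⟩
      N * ∑ V (λ y → ⟦ B y ⟧ * count (λ x → B (y +ᵛ lc e x)) Xs)
        ℕR.≡⟨ trans (*-distribˡ-∑ V N _) (∑-cong V λ y → swap N ⟦ B y ⟧ _) ⟩
      ∑ V (λ y → ⟦ B y ⟧ * (N * count (λ x → B (y +ᵛ lc e x)) Xs))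
        ℕR.≤⟨ ∑-mono V (λ y → ℕₚ.*-monoʳ-≤ ⟦ B y ⟧ (equidistributed y)) ⟩
      ∑ V (λ y → ⟦ B y ⟧ * (b * N ^ k))
        ℕR.≡⟨ *-distribʳ-∑ V (b * N ^ k) _ ⟨
      b * (b * N ^ k)
        ℕR.≡⟨ ℕₚ.*-assoc b b _ ⟨
      b * b * N ^ k ℕR.∎
      where
      e : Fin k → Carrier
      e = a′ ⊖ a
      swap : ∀ a b c → a * (b * c) ≡ b * (a * c)
      swap = solve-∀
      shift : ∀ v x → v +ᵛ lc a′ x ≡ (v +ᵛ lc a x) +ᵛ lc e x
      shift v x = trans (cong (v +ᵛ_) (sym (lc-⊖ a′ a x))) (sym (+ᵛ-assoc v _ _))
      equidistributed : ∀ y → N * count (λ x → B (y +ᵛ lc e x)) Xs ≤ b * N ^ k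
      equidistributed y = ℕR.begin
        N * count (λ x → B (y +ᵛ lc e x)) Xs         ℕR.≡⟨ cong (_* count (λ x → B (y +ᵛ lc e x)) Xs) length-V ⟨
        length V * count (λ x → B (y +ᵛ lc e x)) Xs  ℕR.≤⟨ lc-equidistributed e e≉0 (λ v → B (y +ᵛ v)) V-distinct ⟩
        count (λ v → B (y +ᵛ v)) V * length V ^ k    ℕR.≤⟨ ℕₚ.*-mono-≤ (count-injective B (y +ᵛ_) (+ᵛ-cancelˡ y) V-distinct)
                                                             (ℕₚ.≤-reflexive (cong (_^ k) length-V)) ⟩
        b * N ^ k                                    ℕR.∎

    -- Off the diagonal pairwise independence applies. On the diagonal the two events coincide, and
    -- the first moment bounds their number.
    pairHits-bound : ∀ a a′ → N * pairHits a a′ ≤ ⟦ same a a′ ⟧ * (b * (N * N ^ k)) + b * b * N ^ k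
    pairHits-bound a a′ = bound (Finₚ.all? (λ i → a i ≟ᶠ a′ i))
      where
      rearrange : ∀ n m b → n * (m * b) ≡ 1 * (b * (n * m))
      rearrange = solve-∀
      differ : (∃ λ i → ¬ (a i ≈ a′ i)) → Nonzero (a′ ⊖ a)
      differ (i , n) = i , λ e → n (≈-sym (x-y≈0⇒x≈y _ _ e))
      bound : (d : Dec (∀ i → a i ≈ a′ i)) → N * pairHits a a′ ≤ ⟦ does d ⟧ * (b * (N * N ^ k)) + b * b * N ^ k
      bound (no ¬same) = pairHits-distinct a a′ (differ (Finₚ.¬∀⟶∃¬ k _ (λ i → a i ≟ᶠ a′ i) ¬same))
      bound (yes _)    = ℕR.begin
        N * pairHits a a′                     ℕR.≤⟨ ℕₚ.*-monoʳ-≤ N (∑-mono (allFuns (suc k) V) λ x →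
                                                      ℕₚ.≤-trans (ℕₚ.*-monoʳ-≤ ⟦ affineHit x a ⟧ (⟦⟧≤1 _)) (ℕₚ.≤-reflexive (ℕₚ.*-identityʳ _))) ⟩
        N * count (λ x → B (affine a x)) (allFuns (suc k) V) ℕR.≡⟨ cong (N *_) (first-moment a) ⟩
        N * (N ^ k * b)                       ℕR.≡⟨ rearrange N (N ^ k) b ⟩
        1 * (b * (N * N ^ k))                 ℕR.≤⟨ ℕₚ.m≤m+n _ _ ⟩
        1 * (b * (N * N ^ k)) + b * b * N ^ k ℕR.∎

    -- With mean μ = M / N this is E[X²] ≤ μ + μ², cleared of denominators: the diagonal pairs give
    -- μ, the other pairs at most μ².
    second-moment : N * ∑ (allFuns (suc k) V) (λ x → affineHits x * affineHits x) ≤ M * (N * N ^ k) + M * M * N ^ k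
    second-moment = ℕR.begin
      N * ∑ (allFuns (suc k) V) (λ x → affineHits x * affineHits x)
        ℕR.≡⟨ cong (N *_) (∑-cong (allFuns (suc k) V) λ x → trans (*-distribʳ-∑ As (affineHits x) _)
                (∑-cong As λ a → *-distribˡ-∑ As ⟦ affineHit x a ⟧ _)) ⟩
      N * ∑ (allFuns (suc k) V) (λ x → ∑ As (λ a → ∑ As (λ a′ → ⟦ affineHit x a ⟧ * ⟦ affineHit x a′ ⟧)))
        ℕR.≡⟨ cong (N *_) (trans (∑-swap (allFuns (suc k) V) As _) (∑-cong As λ a → ∑-swap (allFuns (suc k) V) As _)) ⟩
      N * ∑ As (λ a → ∑ As (λ a′ → pairHits a a′))
        ℕR.≡⟨ trans (*-distribˡ-∑ As N _) (∑-cong As λ a → *-distribˡ-∑ As N _) ⟩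
      ∑ As (λ a → ∑ As (λ a′ → N * pairHits a a′))
        ℕR.≤⟨ ∑-mono As (λ a → ∑-mono As (λ a′ → pairHits-bound a a′)) ⟩
      ∑ As (λ a → ∑ As (λ a′ → ⟦ same a a′ ⟧ * (b * (N * N ^ k)) + b * b * N ^ k))
        ℕR.≤⟨ ∑-≤-const (All.universal row As) ⟩
      length As * (b * (N * N ^ k) + A * (b * b * N ^ k))
        ℕR.≡⟨ cong (_* (b * (N * N ^ k) + A * (b * b * N ^ k))) length-As ⟩
      A * (b * (N * N ^ k) + A * (b * b * N ^ k))
        ℕR.≡⟨ rearrange A b (N * N ^ k) (N ^ k) ⟩
      M * (N * N ^ k) + M * M * N ^ k ℕR.∎
      where
      rearrange : ∀ a b n m → a * (b * n + a * (b * b * m)) ≡ a * b * n + a * b * (a * b) * m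
      rearrange = solve-∀
      same-elim : ∀ a a′ → same a a′ ≡ true → ∀ i → a i ≈ a′ i
      same-elim a a′ e = does-elim (Finₚ.all? (λ i → a i ≟ᶠ a′ i)) e
      row : ∀ a → ∑ As (λ a′ → ⟦ same a a′ ⟧ * (b * (N * N ^ k)) + b * b * N ^ k) ≤ b * (N * N ^ k) + A * (b * b * N ^ k)
      row a = ℕR.begin
        ∑ As (λ a′ → ⟦ same a a′ ⟧ * (b * (N * N ^ k)) + b * b * N ^ k)
          ℕR.≡⟨ ∑-+ As _ _ ⟩
        ∑ As (λ a′ → ⟦ same a a′ ⟧ * (b * (N * N ^ k))) + ∑ As (λ _ → b * b * N ^ k)
          ℕR.≡⟨ cong₂ _+_ (sym (*-distribʳ-∑ As (b * (N * N ^ k)) _)) (trans (∑-const As _) (cong (_* (b * b * N ^ k)) length-As)) ⟩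
        count (same a) As * (b * (N * N ^ k)) + A * (b * b * N ^ k)
          ℕR.≤⟨ ℕₚ.+-monoˡ-≤ _ (ℕₚ.*-monoˡ-≤ (b * (N * N ^ k)) (count-≤1 (same a) (allFuns-distinct _≈_ k distinct)
                  λ c c′ e e′ i → ≈-trans (≈-sym (same-elim a c e i)) (same-elim a c′ e′ i))) ⟩
        1 * (b * (N * N ^ k)) + A * (b * b * N ^ k)
          ℕR.≡⟨ cong (_+ A * (b * b * N ^ k)) (ℕₚ.*-identityˡ (b * (N * N ^ k))) ⟩
        b * (N * N ^ k) + A * (b * b * N ^ k) ℕR.∎

    2xy≤x²+y² : ∀ x y → 2 * (x * y) ≤ x * x + y * y
    2xy≤x²+y² x y with ℕₚ.≤-total x y
    ... | inj₁ x≤y with d , refl ← ℕₚ.m≤n⇒∃[o]m+o≡n x≤y = subst (2 * (x * (x + d)) ≤_) (sym (square x d)) (ℕₚ.m≤m+n _ _)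
      where
      square : ∀ x d → x * x + (x + d) * (x + d) ≡ 2 * (x * (x + d)) + d * d
      square = solve-∀
    ... | inj₂ y≤x with d , refl ← ℕₚ.m≤n⇒∃[o]m+o≡n y≤x = subst (2 * ((y + d) * y) ≤_) (sym (square y d)) (ℕₚ.m≤m+n _ _)
      where
      square : ∀ y d → (y + d) * (y + d) + y * y ≡ 2 * ((y + d) * y) + d * d
      square = solve-∀

    -- Chebyshev's inequality pointwise, (M − N X)² ≥ M² [X = 0], without subtraction.
    chebyshev : ∀ x → ⟦ avoids x ⟧ * (M * M) + 2 * M * N * affineHits x ≤ N * (N * (affineHits x * affineHits x)) + M * M
    chebyshev x with any (affineHit x) As in hit
    ... | false = ℕR.begin
      1 * (M * M) + 2 * M * N * affineHits x ℕR.≡⟨ cong (λ t → 1 * (M * M) + 2 * M * N * t) none ⟩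
      1 * (M * M) + 2 * M * N * 0            ℕR.≡⟨ simplify M N ⟩
      M * M                                  ℕR.≤⟨ ℕₚ.m≤n+m _ _ ⟩
      N * (N * (affineHits x * affineHits x)) + M * M ℕR.∎
      where
      simplify : ∀ m n → 1 * (m * m) + 2 * m * n * 0 ≡ m * m
      simplify = solve-∀
      none : affineHits x ≡ 0
      none with affineHits x in eq
      ... | zero  = refl
      ... | suc _ = contradiction (trans (sym hit) (any-intro (affineHit x) (some As (subst (1 ≤_) (sym eq) (s≤s z≤n))))) λ ()
        where
        some : ∀ as → 1 ≤ count (affineHit x) as → Any (λ a → affineHit x a ≡ true) as
        some (a ∷ as) h with affineHit x a in e
        ... | true  = here e
        ... | false = there (some as h)
    ... | true = ℕR.begin
      2 * M * N * X              ℕR.≡⟨ rearrange M N X ⟩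
      2 * (N * X * M)            ℕR.≤⟨ 2xy≤x²+y² (N * X) M ⟩
      N * X * (N * X) + M * M    ℕR.≡⟨ cong (_+ M * M) (regroup N X) ⟩
      N * (N * (X * X)) + M * M  ℕR.∎
      where
      X : ℕ
      X = affineHits x
      rearrange : ∀ m n x → 2 * m * n * x ≡ 2 * (n * x * m)
      rearrange = solve-∀
      regroup : ∀ n x → n * x * (n * x) ≡ n * (n * (x * x))
      regroup = solve-∀

  -- The variance is at most the mean, so summing the pointwise inequality leaves Z M² ≤ M N² N^k.
  -- One factor M is divided out; for M = 0 the claim is trivial.
  avoids-count : count avoids (allFuns (suc k) V) * (q ^ k * count B V) ≤ N * N ^ suc k
  avoids-count = cancel M refl
    where
    T : List (Fin (suc k) → Fin N)
    T = allFuns (suc k) V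
    Z : ℕ
    Z = count avoids T
    length-T : length T ≡ N * N ^ k
    length-T = trans (length-allFuns (suc k) V) (cong (_^ suc k) length-V)
    summed : Z * (M * M) ≤ M * (N * (N * N ^ k))
    summed = ℕₚ.+-cancelʳ-≤ (2 * (M * M * (N * N ^ k))) _ _ (ℕR.begin
      Z * (M * M) + 2 * (M * M * (N * N ^ k))
        ℕR.≡⟨ cong₂ _+_ (*-distribʳ-∑ T (M * M) _) (trans (rearrange M N (N ^ k)) (trans (cong (2 * M * N *_) (sym total)) (*-distribˡ-∑ T (2 * M * N) _))) ⟩
      ∑ T (λ x → ⟦ avoids x ⟧ * (M * M)) + ∑ T (λ x → 2 * M * N * affineHits x)
        ℕR.≡⟨ ∑-+ T _ _ ⟨
      ∑ T (λ x → ⟦ avoids x ⟧ * (M * M) + 2 * M * N * affineHits x)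
        ℕR.≤⟨ ∑-mono T chebyshev ⟩
      ∑ T (λ x → N * (N * (affineHits x * affineHits x)) + M * M)
        ℕR.≡⟨ ∑-+ T _ _ ⟩
      ∑ T (λ x → N * (N * (affineHits x * affineHits x))) + ∑ T (λ _ → M * M)
        ℕR.≡⟨ cong₂ _+_ (sym (trans (cong (N *_) (*-distribˡ-∑ T N _)) (*-distribˡ-∑ T N _))) (trans (∑-const T _) (cong (_* (M * M)) length-T)) ⟩
      N * (N * ∑ T (λ x → affineHits x * affineHits x)) + N * N ^ k * (M * M)
        ℕR.≤⟨ ℕₚ.+-monoˡ-≤ _ (ℕₚ.*-monoʳ-≤ N second-moment) ⟩
      N * (M * (N * N ^ k) + M * M * N ^ k) + N * N ^ k * (M * M)
        ℕR.≡⟨ collect M N (N ^ k) ⟩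
      M * (N * (N * N ^ k)) + 2 * (M * M * (N * N ^ k)) ℕR.∎)
      where
      rearrange : ∀ m n p → 2 * (m * m * (n * p)) ≡ 2 * m * n * (m * p)
      rearrange = solve-∀
      collect : ∀ m n p → n * (m * (n * p) + m * m * p) + n * p * (m * m) ≡ m * (n * (n * p)) + 2 * (m * m * (n * p))
      collect = solve-∀
    cancel : ∀ m → m ≡ M → Z * M ≤ N * N ^ suc k
    cancel zero    e = subst (λ t → Z * t ≤ N * N ^ suc k) e (subst (_≤ N * N ^ suc k) (sym (ℕₚ.*-zeroʳ Z)) z≤n)
    cancel (suc m) e = ℕₚ.*-cancelˡ-≤ M {{ℕ.>-nonZero (subst (0 <_) e (s≤s z≤n))}}
      (subst (_≤ M * (N * N ^ suc k)) (swap Z M) summed)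
      where
      swap : ∀ z m → z * (m * m) ≡ m * (z * m)
      swap = solve-∀

-- Counting subspaces by their bases

module SubspaceCounting {q : ℕ} (K : FiniteField q) {N : ℕ} (𝕍 : VectorSpace K N) (3≤q : 3 ≤ q) where
  open FiniteField K hiding (zero) renaming
    (_+_ to _+ᶠ_; -_ to -ᶠ_; _-_ to _-ᶠ_; refl to ≈-refl; sym to ≈-sym; trans to ≈-trans; _≟_ to _≟ᶠ_)
  open VectorSpace 𝕍
  open Subspaces K 𝕍
  private
    module ℕR = ℕₚ.≤-Reasoning

  record IsSubspace (S : Fin N → Bool) : Set where
    field
      0∈ : S 0ᵛ ≡ true
      +∈ : ∀ {u v} → S u ≡ true → S v ≡ true → S (u +ᵛ v) ≡ true
      ∙∈ : ∀ a {v} → S v ≡ true → S (a ∙ v) ≡ true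
  open IsSubspace

  lc∈ : ∀ {S} → IsSubspace S → ∀ {k} (c : Fin k → Carrier) x → (∀ i → S (x i) ≡ true) → S (lc c x) ≡ true
  lc∈ sub {zero}  c x h = 0∈ sub
  lc∈ sub {suc k} c x h = +∈ sub (∙∈ sub (c zero) (h zero)) (lc∈ sub (c ∘ suc) (x ∘ suc) (h ∘ suc))

  inside : ∀ {k} → (Fin N → Bool) → (Fin k → Fin N) → Bool
  inside {zero}  S x = true
  inside {suc k} S x = S (x zero) ∧ inside S (x ∘ suc)

  inside-elim : ∀ {k} S (x : Fin k → Fin N) → inside S x ≡ true → ∀ i → S (x i) ≡ true
  inside-elim {suc k} S x e zero    = proj₁ (∧-elim e)
  inside-elim {suc k} S x e (suc i) = inside-elim S (x ∘ suc) (proj₂ (∧-elim {S (x zero)} e)) i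

  inside-intro : ∀ {k} S (x : Fin k → Fin N) → (∀ i → S (x i) ≡ true) → inside S x ≡ true
  inside-intro {zero}  S x h = refl
  inside-intro {suc k} S x h = ∧-intro (h zero) (inside-intro S (x ∘ suc) (h ∘ suc))

  private
    members : (Fin N → Bool) → List (Fin N)
    members S = filter (λ v → S v Bool.≟ true) V

    -- The dependence on `S` moves from the range of summation into an indicator, so that sums over
    -- subspaces and sums over tuples can be exchanged.
    ∑-members : ∀ k S (g : (Fin k → Fin N) → ℕ) →
                ∑ (allFuns k (members S)) g ≡ ∑ (allFuns k V) (λ x → ⟦ inside S x ⟧ * g x)
    ∑-members zero    S g = cong (_+ 0) (sym (ℕₚ.+-identityʳ _))
    ∑-members (suc k) S g = begin
      ∑ (allFuns (suc k) (members S)) g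
        ≡⟨ ∑-allFuns-suc k (members S) g ⟩
      ∑ (members S) (λ v → ∑ (allFuns k (members S)) (λ x → g (v VF.∷ x)))
        ≡⟨ ∑-filter S V _ ⟩
      ∑ V (λ v → ⟦ S v ⟧ * ∑ (allFuns k (members S)) (λ x → g (v VF.∷ x)))
        ≡⟨ ∑-cong V (λ v → trans (cong (⟦ S v ⟧ *_) (∑-members k S _)) (*-distribˡ-∑ (allFuns k V) ⟦ S v ⟧ _)) ⟩
      ∑ V (λ v → ∑ (allFuns k V) (λ x → ⟦ S v ⟧ * (⟦ inside S x ⟧ * g (v VF.∷ x))))
        ≡⟨ ∑-cong V (λ v → ∑-cong (allFuns k V) (λ x → absorb (S v) (inside S x) _)) ⟩
      ∑ V (λ v → ∑ (allFuns k V) (λ x → ⟦ S v ∧ inside S x ⟧ * g (v VF.∷ x)))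
        ≡⟨ ∑-allFuns-suc k V _ ⟨
      ∑ (allFuns (suc k) V) (λ x → ⟦ inside S x ⟧ * g x) ∎
      where
      open ≡-Reasoning
      absorb : ∀ a b m → ⟦ a ⟧ * (⟦ b ⟧ * m) ≡ ⟦ a ∧ b ⟧ * m
      absorb true  b m = ℕₚ.*-identityˡ _
      absorb false b m = refl

    length-members : ∀ S → length (members S) ≡ count S V
    length-members S = length-filter≡count S V

    members-distinct : ∀ S → Distinct _≡_ (members S)
    members-distinct S = Distinct-filter S V-distinct

  span : ∀ {k} → (Fin k → Fin N) → Fin N → Bool
  span {k} x v = any (λ c → does (lc c x Fin.≟ v)) (allFuns k elems)

  span-elim : ∀ {k} (x : Fin k → Fin N) v → span x v ≡ true → ∃ λ c → lc c x ≡ v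
  span-elim x v e with c , h ← Any.satisfied (any-elim _ {allFuns _ elems} e) = c , does-elim (lc c x Fin.≟ v) h

  span-intro : ∀ {k} (x : Fin k → Fin N) c → span x (lc c x) ≡ true
  span-intro {k} x c = any-intro _ (Any.map (λ {c′} e → dec-true (lc c′ x Fin.≟ lc c x) (sym (lc-cong x e)))
    (allFuns-complete _≈_ k complete c))

  span-subspace : ∀ {k} (x : Fin k → Fin N) → IsSubspace (span x)
  span-subspace x .0∈ = subst (λ v → span x v ≡ true) (lc-0 x) (span-intro x (λ _ → 0#))
  span-subspace x .+∈ {u} {v} eu ev with c , refl ← span-elim x u eu | d , refl ← span-elim x v ev =
    subst (λ v → span x v ≡ true) (lc-+ c d x) (span-intro x (λ i → c i +ᶠ d i))
  span-subspace x .∙∈ a {v} ev with c , refl ← span-elim x v ev =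
    subst (λ v → span x v ≡ true) (lc-scale a c x) (span-intro x (λ i → a · c i))

  span-card : ∀ {k} (x : Fin k → Fin N) → independent x ≡ true → count (span x) V ≡ q ^ k
  span-card {k} x ind = trans (sym (length-members (span x))) (trans (ℕₚ.≤-antisym upper lower) length-coefficients)
    where
    length-coefficients : length (allFuns k elems) ≡ q ^ k
    length-coefficients = trans (length-allFuns k elems) (cong (_^ k) size)
    upper : length (members (span x)) ≤ length (allFuns k elems)
    upper = length-≤ (λ v c → lc c x ≡ v) sym (members-distinct (span x))
      (All.map (λ {v} h → Any.map (λ {c} e → does-elim (lc c x Fin.≟ v) e) (any-elim _ {allFuns k elems} h)) (filter-All (span x) V))
      (λ e e′ → trans (sym e) e′)
    lower : length (allFuns k elems) ≤ length (members (span x))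
    lower = length-≤ (λ c v → lc c x ≡ v) (λ e i → ≈-sym (e i)) (allFuns-distinct _≈_ k distinct)
      (All.universal (λ c → filter-Any (span x) (λ { refl → span-intro x c }) (Any-allFin {P = lc c x ≡_} (lc c x) refl)) _)
      (λ {c} {c′} e e′ → lc-injective x ind c c′ (trans e (sym e′)))

  module _ (k : ℕ) where

    HasDim : (Fin N → Bool) → Set
    HasDim S = count S V ≡ q ^ k

    -- The span lies in `S`, and both have `q ^ k` elements. Dimension is encoded by cardinality, so
    -- counting alone forces equality.
    subspace≡span : ∀ {S} → IsSubspace S → HasDim S → ∀ (x : Fin k → Fin N) → independent x ≡ true →
                    inside S x ≡ true → ∀ v → S v ≡ true → span x v ≡ true
    subspace≡span {S} sub dim x ind x⊆S = allFin-lookup (count-exhaust V span⊆S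
      (ℕₚ.≤-reflexive (trans dim (sym (span-card x ind)))))
      where
      span⊆S : ∀ v → span x v ≡ true → S v ≡ true
      span⊆S v e with c , refl ← span-elim x v e = lc∈ sub c x (inside-elim S x x⊆S)

    -- Each k-dimensional subspace has at least q^(k²)/2 ordered bases, and a basis determines its subspace.
    count-by-bases : ∀ {𝒮} (T : (Fin k → Fin N) → Bool) → Distinct (Pointwise _≡_) 𝒮 →
      All (λ S → IsSubspace S × HasDim S × (∀ x → independent x ≡ true → inside S x ≡ true → T x ≡ true)) 𝒮 →
      length 𝒮 * (q ^ k) ^ k ≤ 2 * count T (allFuns k V)
    count-by-bases {𝒮} T 𝒮! good = ℕR.begin
      length 𝒮 * (q ^ k) ^ k                                 ℕR.≡⟨ ∑-const 𝒮 _ ⟨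
      ∑ 𝒮 (λ _ → (q ^ k) ^ k)                                ℕR.≤⟨ ∑-mono-All (All.map (λ {S} (_ , dim , _) → bases S dim) good) ⟩
      ∑ 𝒮 (λ S → 2 * ∑ (allFuns k V) (λ x → ⟦ inside S x ⟧ * ⟦ independent x ⟧))
        ℕR.≡⟨ *-distribˡ-∑ 𝒮 2 _ ⟨
      2 * ∑ 𝒮 (λ S → ∑ (allFuns k V) (λ x → ⟦ inside S x ⟧ * ⟦ independent x ⟧))
        ℕR.≡⟨ cong (2 *_) (∑-swap 𝒮 (allFuns k V) _) ⟩
      2 * ∑ (allFuns k V) (λ x → ∑ 𝒮 (λ S → ⟦ inside S x ⟧ * ⟦ independent x ⟧))
        ℕR.≡⟨ cong (2 *_) (∑-cong (allFuns k V) λ x → sym (*-distribʳ-∑ 𝒮 ⟦ independent x ⟧ _)) ⟩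
      2 * ∑ (allFuns k V) (λ x → count (λ S → inside S x) 𝒮 * ⟦ independent x ⟧)
        ℕR.≤⟨ ℕₚ.*-monoʳ-≤ 2 (∑-mono (allFuns k V) unique) ⟩
      2 * count T (allFuns k V) ℕR.∎
      where
      bases : ∀ S → HasDim S → (q ^ k) ^ k ≤ 2 * ∑ (allFuns k V) (λ x → ⟦ inside S x ⟧ * ⟦ independent x ⟧)
      bases S dim = ℕR.begin
        (q ^ k) ^ k                                   ℕR.≡⟨ cong (_^ k) (sym (trans (length-members S) dim)) ⟩
        length (members S) ^ k                        ℕR.≤⟨ independent-count 3≤q k (members-distinct S) (ℕₚ.≤-reflexive (sym (trans (length-members S) dim))) ⟩
        2 * count independent (allFuns k (members S)) ℕR.≡⟨ cong (2 *_) (∑-members k S _) ⟩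
        2 * ∑ (allFuns k V) (λ x → ⟦ inside S x ⟧ * ⟦ independent x ⟧) ℕR.∎
      unique : ∀ x → count (λ S → inside S x) 𝒮 * ⟦ independent x ⟧ ≤ ⟦ T x ⟧
      unique x with independent x in ind | T x in t
      ... | false | t′    = subst (_≤ ⟦ t′ ⟧) (sym (ℕₚ.*-zeroʳ (count (λ S → inside S x) 𝒮))) z≤n
      ... | true  | true  = subst (_≤ 1) (sym (ℕₚ.*-identityʳ _)) (count-≤1-All _ (λ S → inside S x) 𝒮! good
        λ S S′ (sub , dim , _) (sub′ , dim′ , _) x⊆S x⊆S′ v → same (S v) (S′ v)
          (λ v∈S → transfer sub dim sub′ x⊆S x⊆S′ v v∈S) (λ v∈S′ → transfer sub′ dim′ sub x⊆S′ x⊆S v v∈S′))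
        where
        same : ∀ a b → (a ≡ true → b ≡ true) → (b ≡ true → a ≡ true) → a ≡ b
        same true  true  f g = refl
        same true  false f g = sym (f refl)
        same false true  f g = g refl
        same false false f g = refl
        transfer : ∀ {S S′} → IsSubspace S → HasDim S → IsSubspace S′ → inside S x ≡ true → inside S′ x ≡ true →
                   ∀ v → S v ≡ true → S′ v ≡ true
        transfer {S} {S′} sub dim sub′ x⊆S x⊆S′ v v∈S with c , refl ← span-elim x v (subspace≡span sub dim x ind x⊆S v v∈S) =
          lc∈ sub′ c x (inside-elim S′ x x⊆S′)
      ... | true  | false = subst (_≤ 0) (sym (ℕₚ.*-identityʳ _)) (none good)
        where
        none : ∀ {𝒮} → All (λ S → IsSubspace S × HasDim S × (∀ x → independent x ≡ true → inside S x ≡ true → T x ≡ true)) 𝒮 →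
               count (λ S → inside S x) 𝒮 ≤ 0
        none []                 = z≤n
        none {S ∷ 𝒮} ((_ , _ , h) ∷ hs) with inside S x in x⊆S
        ... | false = none hs
        ... | true  = contradiction (trans (sym t) (h x ind x⊆S)) λ ()

    -- Every independent tuple lies in some member of the list, namely its span, and each member
    -- contains exactly `(q ^ k) ^ k` tuples. The assumption on N makes at least half of all tuples
    -- independent.
    subspaces-≥ : ∀ {𝒮} → q ^ k ≤ N → All HasDim 𝒮 →
      (∀ S → IsSubspace S → HasDim S → Any (Pointwise _≡_ S) 𝒮) →
      N ^ k ≤ 2 * (length 𝒮 * (q ^ k) ^ k)
    subspaces-≥ {𝒮} q^k≤N dims covers = ℕR.begin
      N ^ k                                            ℕR.≡⟨ cong (_^ k) length-V ⟨
      length V ^ k                                     ℕR.≤⟨ independent-count 3≤q k V-distinct (subst (q ^ k ≤_) (sym length-V) q^k≤N) ⟩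
      2 * count independent (allFuns k V)              ℕR.≤⟨ ℕₚ.*-monoʳ-≤ 2 (∑-mono (allFuns k V) spanned) ⟩
      2 * ∑ (allFuns k V) (λ x → count (λ S → inside S x) 𝒮) ℕR.≡⟨ cong (2 *_) (∑-swap (allFuns k V) 𝒮 _) ⟩
      2 * ∑ 𝒮 (λ S → count (inside S) (allFuns k V))   ℕR.≤⟨ ℕₚ.*-monoʳ-≤ 2 (∑-≤-const (All.map (λ {S} dim → ℕₚ.≤-reflexive (tuples S dim)) dims)) ⟩
      2 * (length 𝒮 * (q ^ k) ^ k)                     ℕR.∎
      where
      spanned : ∀ x → ⟦ independent x ⟧ ≤ count (λ S → inside S x) 𝒮
      spanned x with independent x in ind
      ... | false = z≤n
      ... | true  = count-≥1 (λ S → inside S x) (Any.map (λ {S} e → inside-intro S x λ i →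
        trans (sym (e (x i))) (subst (λ v → span x v ≡ true) (lc-unit i x) (span-intro x (unit i))))
        (covers (span x) (span-subspace x) (span-card x ind)))
      tuples : ∀ S → HasDim S → count (inside S) (allFuns k V) ≡ (q ^ k) ^ k
      tuples S dim = begin
        count (inside S) (allFuns k V)                    ≡⟨ ∑-cong (allFuns k V) (λ x → sym (ℕₚ.*-identityʳ _)) ⟩
        ∑ (allFuns k V) (λ x → ⟦ inside S x ⟧ * 1)        ≡⟨ ∑-members k S (λ _ → 1) ⟨
        ∑ (allFuns k (members S)) (λ _ → 1)               ≡⟨ length≡∑ (allFuns k (members S)) ⟨
        length (allFuns k (members S))                    ≡⟨ length-allFuns k (members S) ⟩
        length (members S) ^ k                            ≡⟨ cong (_^ k) (trans (length-members S) dim) ⟩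
        (q ^ k) ^ k                                       ∎
        where open ≡-Reasoning

  module _ (B : Fin N → Bool) (k : ℕ) where
    open SecondMoment K 𝕍 B k

    -- All affine points of a tuple in S belong to S, so every basis of a subspace that avoids B is
    -- a tuple counted by `avoids`.
    avoiding-≤ : ∀ {𝒮} → Distinct (Pointwise _≡_) 𝒮 →
      All (λ S → IsSubspace S × HasDim (suc k) S × (∀ v → S v ≡ true → B v ≡ false)) 𝒮 →
      length 𝒮 * (q ^ suc k) ^ suc k * (q ^ k * count B V) ≤ 2 * (N * N ^ suc k)
    avoiding-≤ {𝒮} 𝒮! good = ℕR.begin
      length 𝒮 * (q ^ suc k) ^ suc k * (q ^ k * count B V)
        ℕR.≤⟨ ℕₚ.*-monoˡ-≤ (q ^ k * count B V) (count-by-bases (suc k) avoids 𝒮!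
                (All.map (λ {S} (sub , dim , h) → sub , dim , λ x _ x⊆S → avoided S sub h x (inside-elim S x x⊆S)) good)) ⟩
      2 * count avoids (allFuns (suc k) V) * (q ^ k * count B V)
        ℕR.≡⟨ ℕₚ.*-assoc 2 (count avoids (allFuns (suc k) V)) _ ⟩
      2 * (count avoids (allFuns (suc k) V) * (q ^ k * count B V))
        ℕR.≤⟨ ℕₚ.*-monoʳ-≤ 2 avoids-count ⟩
      2 * (N * N ^ suc k) ℕR.∎
      where
      avoided : ∀ S → IsSubspace S → (∀ v → S v ≡ true → B v ≡ false) → ∀ x → (∀ i → S (x i) ≡ true) → avoids x ≡ true
      avoided S sub h x x⊆S with any (affineHit x) (allFuns k elems) in hit
      ... | false = refl
      ... | true with a , Ba ← Any.satisfied (any-elim (affineHit x) {allFuns k elems} hit) =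
        contradiction (trans (sym Ba) (h _ (+∈ sub (x⊆S zero) (lc∈ sub a (x ∘ suc) (x⊆S ∘ suc))))) λ ()

    -- A point of S in B is a nonzero combination of any basis of S. As B is stable under nonzero
    -- scaling, the normalised multiple of that combination also lies in B, so the basis is counted
    -- by `hits B`.
    meeting-≤ : B 0ᵛ ≡ false → (∀ s v → ¬ (s ≈ 0#) → B v ≡ true → B (s ∙ v) ≡ true) →
      ∀ {𝒮} → Distinct (Pointwise _≡_) 𝒮 →
      All (λ S → IsSubspace S × HasDim (suc k) S × (∃ λ v → S v ≡ true × B v ≡ true)) 𝒮 →
      N * (length 𝒮 * (q ^ suc k) ^ suc k) ≤ 2 * (2 * q ^ k * (count B V * N ^ suc k))
    meeting-≤ B0 scale {𝒮} 𝒮! bad = ℕR.begin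
      N * (length 𝒮 * (q ^ suc k) ^ suc k)
        ℕR.≤⟨ ℕₚ.*-monoʳ-≤ N (count-by-bases (suc k) (hits B) 𝒮!
                (All.map (λ {S} (sub , dim , v , v∈S , Bv) → sub , dim , λ x ind x⊆S →
                  hit x v Bv (subspace≡span (suc k) sub dim x ind x⊆S v v∈S)) bad)) ⟩
      N * (2 * count (hits B) T)                 ℕR.≡⟨ swap N 2 _ ⟩
      2 * (N * count (hits B) T)                 ℕR.≡⟨ cong (λ t → 2 * (t * count (hits B) T)) length-V ⟨
      2 * (length V * count (hits B) T)          ℕR.≤⟨ ℕₚ.*-monoʳ-≤ 2 (hits-count B (suc k) V-distinct) ⟩
      2 * (length (normalised (suc k)) * (count B V * length V ^ suc k))
        ℕR.≤⟨ ℕₚ.*-monoʳ-≤ 2 (ℕₚ.*-mono-≤ (normalised≤2q^ 3≤q k) (ℕₚ.≤-reflexive (cong (λ t → count B V * t ^ suc k) length-V))) ⟩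
      2 * (2 * q ^ k * (count B V * N ^ suc k))  ℕR.∎
      where
      T : List (Fin (suc k) → Fin N)
      T = allFuns (suc k) V
      swap : ∀ a b c → a * (b * c) ≡ b * (a * c)
      swap = solve-∀
      hit : ∀ x v → B v ≡ true → span x v ≡ true → hits B x ≡ true
      hit x v Bv v∈span with c , refl ← span-elim x v v∈span with Finₚ.all? (λ i → c i ≟ᶠ 0#)
      ... | yes c≈0 = contradiction (trans (sym Bv) (trans (cong B (trans (lc-cong x c≈0) (lc-0 x))) B0)) λ ()
      ... | no ¬c≈0 = any-intro _ (Any.map
        (λ {c′} (s , s≉0 , h) → trans (cong B (trans (lc-cong x h) (lc-scale s c x))) (scale s _ s≉0 Bv))
        (normalise c (Finₚ.¬∀⟶∃¬ _ _ (λ i → c i ≟ᶠ 0#) ¬c≈0)))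

-- Hermitian matrices as a vector space over the fixed field

module HermitianSubspaces (q : ℕ) (q-pp : IsPrimePower q) (3≤q : 3 ≤ q) (F : FiniteField (q * q)) (n : ℕ) where
  open FiniteField F hiding (zero) renaming
    (_+_ to _+ᶠ_; -_ to -ᶠ_; _-_ to _-ᶠ_; refl to ≈-refl; sym to ≈-sym; trans to ≈-trans; _≟_ to _≟ᶠ_)
  open FieldTheory F
  open Conjugation q q-pp F
  open Hermitian q q-pp F using (_≐_; ≐-sym; ≐-trans; Herm; conj≡σ; herList-All; herList-complete; herList-distinct)
  open LowRank q q-pp F using (RankAtLeast; rankAtLeast-elim; rankAtLeast-intro)
  open HermitianCounting q F n
  private
    module ℕR = ℕₚ.≤-Reasoning

  H-Herm : ∀ i → Herm (H i)
  H-Herm i = All.lookup (herList-All n) (∈-lookup i)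

  H-injective : ∀ {i j} → H i ≐ H j → i ≡ j
  H-injective {i} {j} = lookup-injective (λ {M} {M′} → ≐-sym {n} {M} {M′}) (herList-distinct n) i j

  toIndex : ∀ (M : Mat) → Herm M → Fin N
  toIndex M h = Any.index (herList-complete M h)

  H-toIndex : ∀ (M : Mat) (h : Herm M) → M ≐ H (toIndex M h)
  H-toIndex M h = Anyₚ.lookup-index (herList-complete M h)

  private
    K : FiniteField q
    K = fixedField
    module K = FiniteField K

    ⊕-Herm : ∀ i j → Herm (H i ⊕ H j)
    ⊕-Herm i j a b = ≈-trans (+-cong (H-Herm i a b) (H-Herm j a b)) (≈-sym (σ-+ _ _))

    ⊙-Herm : ∀ (c : K.Carrier) i → Herm (proj₁ c ⊙ H i)
    ⊙-Herm (c , c-fixed) i a b = ≈-trans (*-cong c-fixed (H-Herm i a b)) (≈-sym (σ-* _ _))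

    neg-Herm : ∀ i → Herm (λ a b → -ᶠ H i a b)
    neg-Herm i a b = ≈-trans (-‿cong (H-Herm i a b)) (≈-sym (σ-neg _))

    zero-Herm : Herm zeroM
    zero-Herm a b = ≈-sym σ-0

    plus : Fin N → Fin N → Fin N
    plus i j = toIndex (H i ⊕ H j) (⊕-Herm i j)

    times : K.Carrier → Fin N → Fin N
    times c i = toIndex (proj₁ c ⊙ H i) (⊙-Herm c i)

    H-plus : ∀ i j a b → H (plus i j) a b ≈ H i a b +ᶠ H j a b
    H-plus i j a b = ≈-sym (H-toIndex _ (⊕-Herm i j) a b)

    H-times : ∀ c i a b → H (times c i) a b ≈ proj₁ c · H i a b
    H-times c i a b = ≈-sym (H-toIndex _ (⊙-Herm c i) a b)

  hermitianSpace : VectorSpace fixedField N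
  hermitianSpace = record
    { _+ᵛ_ = plus
    ; 0ᵛ = toIndex zeroM zero-Herm
    ; -ᵛ_ = λ i → toIndex _ (neg-Herm i)
    ; _∙_ = times
    ; +ᵛ-assoc = λ i j k → H-injective λ a b →
        ≈-trans (H-plus _ k a b) (≈-trans (+-congʳ (H-plus i j a b)) (≈-trans (+-assoc _ _ _)
          (≈-sym (≈-trans (H-plus i _ a b) (+-congˡ (H-plus j k a b))))))
    ; +ᵛ-comm = λ i j → H-injective λ a b → ≈-trans (H-plus i j a b) (≈-trans (+-comm _ _) (≈-sym (H-plus j i a b)))
    ; +ᵛ-identityˡ = λ i → H-injective λ a b →
        ≈-trans (H-plus _ i a b) (≈-trans (+-congʳ (≈-sym (H-toIndex zeroM zero-Herm a b))) (+-identityˡ _))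
    ; -ᵛ-inverseˡ = λ i → H-injective λ a b →
        ≈-trans (H-plus _ i a b) (≈-trans (+-congʳ (≈-sym (H-toIndex _ (neg-Herm i) a b)))
          (≈-trans (-‿inverseˡ _) (H-toIndex zeroM zero-Herm a b)))
    ; ∙-cong = λ {c} {c′} i e → H-injective λ a b →
        ≈-trans (H-times c i a b) (≈-trans (*-congʳ e) (≈-sym (H-times c′ i a b)))
    ; 1∙ = λ i → H-injective λ a b → ≈-trans (H-times K.1# i a b) (*-identityˡ _)
    ; ∙-assoc = λ c d i → H-injective λ a b →
        ≈-trans (H-times _ i a b) (≈-trans (*-assoc _ _ _)
          (≈-sym (≈-trans (H-times c _ a b) (*-congˡ (H-times d i a b)))))
    ; ∙-distribʳ = λ c d i → H-injective λ a b →
        ≈-trans (H-times _ i a b) (≈-trans (distribʳ _ _ _)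
          (≈-sym (≈-trans (H-plus _ _ a b) (+-cong (H-times c i a b) (H-times d i a b)))))
    ; ∙-distribˡ = λ c i j → H-injective λ a b →
        ≈-trans (H-times c _ a b) (≈-trans (*-congˡ (H-plus i j a b)) (≈-trans (distribˡ _ _ _)
          (≈-sym (≈-trans (H-plus _ _ a b) (+-cong (H-times c i a b) (H-times c j a b))))))
    }

  open VectorSpace hermitianSpace
  open Subspaces fixedField hermitianSpace using (V)
  open SubspaceCounting fixedField hermitianSpace 3≤q
  open IsSubspace

  matEq-elim : ∀ (M M′ : Mat) → matEq M M′ ≡ true → M ≐ M′
  matEq-elim M M′ e i j = does-elim (M i j ≟ᶠ M′ i j) (allFin-lookup (all-elim _ (allFin-lookup (all-elim _ e) i)) j)

  matEq-intro : ∀ (M M′ : Mat) → M ≐ M′ → matEq M M′ ≡ true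
  matEq-intro M M′ h = all-intro _ (All-allFin λ i → all-intro _ (All-allFin λ j → dec-true (M i j ≟ᶠ M′ i j) (h i j)))

  private
    memᵇ-elim : ∀ S (M : Mat) {j} → M ≐ H j → memᵇ S M ≡ true → S j ≡ true
    memᵇ-elim S M {j} M≐Hj e with i , h ← Any.satisfied (any-elim _ {allFin N} e) with Si , Hi≐M ← ∧-elim {S i} h =
      subst (λ t → S t ≡ true) (H-injective (≐-trans {n} {H i} {M} {H j} (matEq-elim (H i) M Hi≐M) M≐Hj)) Si

    memᵇ-intro : ∀ S (M : Mat) {j} → M ≐ H j → S j ≡ true → memᵇ S M ≡ true
    memᵇ-intro S M {j} M≐Hj Sj = any-intro _ (Any-allFin j (∧-intro Sj (matEq-intro (H j) M (≐-sym {n} {M} {H j} M≐Hj))))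

    Fq-complete : ∀ c → c ≈ σ c → Any (c ≈_) Fq
    Fq-complete c c-fixed = Membershipₚ.∈-filter⁺ setoid (λ x → x ≟ᶠ conj x)
      (λ {x} {y} x≈y h → ≈-trans (≈-sym x≈y) (≈-trans h (subst₂ _≈_ (sym (conj≡σ n x)) (sym (conj≡σ n y)) (σ-cong x≈y))))
      (complete c) (subst (c ≈_) (sym (conj≡σ n c)) c-fixed)

    Fq-All : All (λ c → c ≈ σ c) Fq
    Fq-All = All.map (λ {c} → subst (c ≈_) (conj≡σ n c)) (Allₚ.all-filter (λ x → x ≟ᶠ conj x) elems)

  isFqSubspace-elim : ∀ S → isFqSubspace S ≡ true → IsSubspace S
  isFqSubspace-elim S e with z , e′ ← ∧-elim {memᵇ S zeroM} e with p , s ← ∧-elim e′ = record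
    { 0∈ = memᵇ-elim S zeroM (H-toIndex zeroM zero-Herm) z
    ; +∈ = λ {u} {v} u∈ v∈ → memᵇ-elim S (H u ⊕ H v) (H-toIndex _ (⊕-Herm u v))
        (⇒-elim {S u ∧ S v} (allFin-lookup (all-elim _ (allFin-lookup (all-elim _ p) u)) v) (∧-intro u∈ v∈))
    ; ∙∈ = λ c {v} v∈ → let (closed , c≈c′) = All.lookupAny (all-elim _ {Fq} s) (Fq-complete (proj₁ c) (proj₂ c)) in
        memᵇ-elim S _ (λ a b → ≈-trans (*-congʳ (≈-sym c≈c′)) (H-toIndex _ (⊙-Herm c v) a b))
          (⇒-elim {S v} (allFin-lookup (all-elim _ closed) v) v∈)
    }

  isFqSubspace-intro : ∀ S → IsSubspace S → isFqSubspace S ≡ true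
  isFqSubspace-intro S sub = ∧-intro
    (memᵇ-intro S zeroM (H-toIndex zeroM zero-Herm) (0∈ sub))
    (∧-intro
      (all-intro _ (All-allFin λ u → all-intro _ (All-allFin λ v → ⇒-intro {S u ∧ S v} λ e →
        memᵇ-intro S _ (H-toIndex _ (⊕-Herm u v)) (+∈ sub (proj₁ (∧-elim {S u} e)) (proj₂ (∧-elim {S u} e))))))
      (all-intro _ (All.map (λ {c} c-fixed → all-intro _ (All-allFin λ v → ⇒-intro {S v} λ v∈ →
        memᵇ-intro S _ (H-toIndex _ (⊙-Herm (c , c-fixed) v)) (∙∈ sub (c , c-fixed) v∈))) Fq-All)))

  IsSubspace-resp : ∀ {S S′} → (∀ i → S i ≡ S′ i) → IsSubspace S → IsSubspace S′
  IsSubspace-resp e sub .0∈ = trans (sym (e _)) (0∈ sub)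
  IsSubspace-resp e sub .+∈ u v = trans (sym (e _)) (+∈ sub (trans (e _) u) (trans (e _) v))
  IsSubspace-resp e sub .∙∈ c v = trans (sym (e _)) (∙∈ sub c (trans (e _) v))

  hasDim-elim : ∀ k S → hasDim k S ≡ true → HasDim k S
  hasDim-elim k S e = trans (sym (length-filter≡count S V)) (does-elim (card S ℕ.≟ q ^ k) e)

  hasDim-intro : ∀ k S → HasDim k S → hasDim k S ≡ true
  hasDim-intro k S h = dec-true (card S ℕ.≟ q ^ k) (trans (length-filter≡count S V) h)

  module _ (d : ℕ) where

    -- The set B of the method, for rank below `d`. It is the literal negation of the test inside
    -- `minRankAtLeast`, so avoiding B and passing that test agree on the nose.
    lowRankᵇ : Fin N → Bool
    lowRankᵇ i = not (matEq (H i) zeroM ∨ rankAtLeast d (H i))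

    lowRankᵇ-elim : ∀ i → lowRankᵇ i ≡ true → ¬ (H i ≐ zeroM) × ¬ RankAtLeast d (H i)
    lowRankᵇ-elim i e with matEq (H i) zeroM in z | rankAtLeast d (H i) in r
    ... | false | false = (λ h → contradiction (trans (sym z) (matEq-intro (H i) zeroM h)) λ ())
                        , (λ h → contradiction (trans (sym r) (rankAtLeast-intro d (H i) h)) λ ())

    lowRankᵇ-intro : ∀ i → ¬ (H i ≐ zeroM) → ¬ RankAtLeast d (H i) → lowRankᵇ i ≡ true
    lowRankᵇ-intro i nz nr with matEq (H i) zeroM in z | rankAtLeast d (H i) in r
    ... | true  | _     = contradiction (matEq-elim (H i) zeroM z) nz
    ... | false | true  = contradiction (rankAtLeast-elim d (H i) r) nr
    ... | false | false = refl

    lowRankᵇ-0 : lowRankᵇ 0ᵛ ≡ false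
    lowRankᵇ-0 rewrite matEq-intro (H 0ᵛ) zeroM (≐-sym {n} {zeroM} {H 0ᵛ} (H-toIndex zeroM zero-Herm)) = refl

    lowRankᵇ-scale : ∀ s v → ¬ (proj₁ s ≈ 0#) → lowRankᵇ v ≡ true → lowRankᵇ (s ∙ v) ≡ true
    lowRankᵇ-scale s v s≉0 e with nz , nr ← lowRankᵇ-elim v e = lowRankᵇ-intro (s ∙ v)
      (λ h → nz λ a b → no-zero-divisors s≉0 (≈-trans (≈-sym (H-times s v a b)) (h a b)))
      (λ (ρ , inj , indep) → nr (ρ , inj , λ c h → indep c λ j → begin
        ∑ᶠ (λ i → c i · H (s ∙ v) (ρ i) j)       ≈⟨ ∑ᶠ-cong (λ i → ≈-trans (*-congˡ (H-times s v (ρ i) j)) (x·[y·z]≈y·[x·z] _ _ _)) ⟩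
        ∑ᶠ (λ i → proj₁ s · (c i · H v (ρ i) j)) ≈⟨ ·-∑ᶠ (proj₁ s) _ ⟨
        proj₁ s · ∑ᶠ (λ i → c i · H v (ρ i) j)   ≈⟨ ≈-trans (*-congˡ (h j)) (zeroʳ _) ⟩
        0#                                       ∎))
      where open SetoidReasoning setoid

    minRank-elim : ∀ S → minRankAtLeast d S ≡ true → ∀ v → S v ≡ true → lowRankᵇ v ≡ false
    minRank-elim S e v v∈ = cong not (⇒-elim {S v} (allFin-lookup (all-elim _ e) v) v∈)

    minRank-false : ∀ S → minRankAtLeast d S ≡ false → ∃ λ v → S v ≡ true × lowRankᵇ v ≡ true
    minRank-false S e with v , h ← Any.satisfied (all-false _ {allFin N} e) = v , split (S v) _ h
      where
      split : ∀ a b → not a ∨ b ≡ false → a ≡ true × not b ≡ true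
      split true false _ = refl , refl

    private
      isSubspace : ℕ → Subset → Bool
      isSubspace k S = isFqSubspace S ∧ hasDim k S

      isGood isBad : ℕ → Subset → Bool
      isGood k S = isFqSubspace S ∧ hasDim k S ∧ minRankAtLeast d S
      isBad  k S = isFqSubspace S ∧ hasDim k S ∧ not (minRankAtLeast d S)

      select : (Subset → Bool) → List Subset
      select p = filter (λ S → p S Bool.≟ true) allSubsets

      Bool-complete : ∀ b → Any (b ≡_) (true ∷ false ∷ [])
      Bool-complete true  = here refl
      Bool-complete false = there (here refl)

      select-distinct : ∀ p → Distinct (Pointwise _≡_) (select p)
      select-distinct p = Distinct-filter p (allFuns-distinct _≡_ N (((λ ()) ∷ []) ∷ [] ∷ []))

      good+bad : ∀ k → length (select (isSubspace k)) ≡ length (select (isGood k)) + length (select (isBad k))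
      good+bad k = trans (length-filter≡count (isSubspace k) allSubsets)
        (trans (trans (∑-cong allSubsets (λ S → split (isFqSubspace S) (hasDim k S) (minRankAtLeast d S))) (∑-+ allSubsets _ _))
          (sym (cong₂ _+_ (length-filter≡count (isGood k) allSubsets) (length-filter≡count (isBad k) allSubsets))))
        where
        split : ∀ a b c → ⟦ a ∧ b ⟧ ≡ ⟦ a ∧ b ∧ c ⟧ + ⟦ a ∧ b ∧ not c ⟧
        split false b     c     = refl
        split true  false c     = refl
        split true  true  true  = refl
        split true  true  false = refl

    numSubspaces-≥ : ∀ k → q ^ k ≤ N → N ^ k ≤ 2 * (numSubspaces k * (q ^ k) ^ k)
    numSubspaces-≥ k q^k≤N = subspaces-≥ k q^k≤N
      (All.map (λ {S} h → hasDim-elim k S (proj₂ (∧-elim {isFqSubspace S} h))) (filter-All (isSubspace k) allSubsets))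
      (λ S sub dim → filter-Any (isSubspace k)
        (λ {S′} e → ∧-intro (isFqSubspace-intro S′ (IsSubspace-resp e sub))
          (hasDim-intro k S′ (trans (∑-cong V λ v → cong ⟦_⟧ (sym (e v))) dim)))
        (allFuns-complete _≡_ N Bool-complete S))

    numRankSubspaces-≤ : ∀ k → numRankSubspaces (suc k) d * (q ^ suc k) ^ suc k * (q ^ k * count lowRankᵇ V) ≤ 2 * (N * N ^ suc k)
    numRankSubspaces-≤ k = avoiding-≤ lowRankᵇ k (select-distinct (isGood (suc k)))
      (All.map (λ {S} h → let (sub , h′) = ∧-elim {isFqSubspace S} h ; (dim , rank) = ∧-elim {hasDim (suc k) S} h′ in
        isFqSubspace-elim S sub , hasDim-elim (suc k) S dim , minRank-elim S rank) (filter-All (isGood (suc k)) allSubsets))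

    -- The truncated difference is a genuine one: subspaces with and without a low-rank member
    -- partition all subspaces of the given dimension.
    numBadSubspaces-≤ : ∀ k → N * ((numSubspaces (suc k) ∸ numRankSubspaces (suc k) d) * (q ^ suc k) ^ suc k)
                              ≤ 2 * (2 * q ^ k * (count lowRankᵇ V * N ^ suc k))
    numBadSubspaces-≤ k = subst (λ t → N * (t * (q ^ suc k) ^ suc k) ≤ 2 * (2 * q ^ k * (count lowRankᵇ V * N ^ suc k)))
      (sym (trans (cong (_∸ numRankSubspaces (suc k) d) (good+bad (suc k))) (ℕₚ.m+n∸m≡n (numRankSubspaces (suc k) d) _)))
      (meeting-≤ lowRankᵇ k lowRankᵇ-0 lowRankᵇ-scale (select-distinct (isBad (suc k)))
        (All.map (λ {S} h → let (sub , h′) = ∧-elim {isFqSubspace S} h ; (dim , rank) = ∧-elim {hasDim (suc k) S} h′ in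
          isFqSubspace-elim S sub , hasDim-elim (suc k) S dim , minRank-false S (not-true rank)) (filter-All (isBad (suc k)) allSubsets)))
      where
      not-true : ∀ {b} → not b ≡ true → b ≡ false
      not-true {false} _ = refl

-- Explicit bounds on the density

module Density (q : ℕ) (q-pp : IsPrimePower q) (3≤q : 3 ≤ q) (F : FiniteField (q * q)) (r s k : ℕ) where
  private
    n d : ℕ
    n = suc r + s
    d = suc (suc r)
  open HermitianCounting q F n
  open HermitianSubspaces q q-pp 3≤q F n
  open Hermitian q q-pp F using (_≐_; ≐-sym; ≐-trans; length-herList)
  open LowRank q q-pp F
  open RowSpace q q-pp F using (lowRank-upper)
  private
    module ℕR = ℕₚ.≤-Reasoning

    V : List (Fin N)
    V = allFin N

    -- Since suc r = d - 1 and n = suc r + s, `E` equals (d - 1)(2n - d + 1). `X` is the number of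
    -- tuples of length suc k in a subspace of dimension suc k, and `W` the number of Hermitian
    -- matrices; the density is Y / G.
    E b X W G Y : ℕ
    E = suc r * (suc r + 2 * s)
    b = count (lowRankᵇ d) V
    X = (q ^ suc k) ^ suc k
    W = q ^ (n * n)
    G = numSubspaces (suc k)
    Y = numRankSubspaces (suc k) d

    N≡W : N ≡ W
    N≡W = length-herList n

    q≢0 : NonZero q
    q≢0 = ℕ.>-nonZero (ℕₚ.≤-trans (s≤s z≤n) 3≤q)

    X≢0 : NonZero X
    X≢0 = ℕₚ.m^n≢0 (q ^ suc k) (suc k) {{ℕₚ.m^n≢0 q (suc k) {{q≢0}}}}

  lowRank-≥ : q ^ E ≤ 2 ^ suc r * b
  lowRank-≥ = ℕₚ.≤-trans (lowRank-size (suc r) s) (ℕₚ.*-monoʳ-≤ (2 ^ suc r) (ℕR.begin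
    length (lowRank (suc r) s)
      ℕR.≤⟨ length-≤ (λ M i → M ≐ H i) (λ {M} {M′} → ≐-sym {n} {M} {M′}) (lowRank-distinct (suc r) s)
        (All.zipWith (λ {M} ((herm , factors) , M≉0) → filter-Any (lowRankᵇ d)
            (λ {i} M≐Hi → lowRankᵇ-intro d i (λ h → M≉0 (≐-trans {n} {M} {H i} {zeroM} M≐Hi h))
              (λ rank → Factors⇒¬RankAtLeast {n} {suc r} {M} factors (RankAtLeast-resp {n} {d} {H i} {M} (≐-sym {n} {M} {H i} M≐Hi) rank)))
            (Any-allFin {P = λ i → M ≐ H i} (toIndex M herm) (H-toIndex M herm)))
          (lowRank-All (suc r) s , lowRank-nonzero r s))
        (λ {M} {M′} {i} e e′ → ≐-trans {n} {M} {H i} {M′} e (≐-sym {n} {M′} {H i} e′)) ⟩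
    length (filter (λ i → lowRankᵇ d i Bool.≟ true) V) ℕR.≡⟨ length-filter≡count (lowRankᵇ d) V ⟩
    b ℕR.∎))

  lowRank-≤ : b ≤ suc (suc r) * suc n ^ suc r * q ^ E
  lowRank-≤ = ℕR.begin
    b                                                            ℕR.≡⟨ length-filter≡count (lowRankᵇ d) V ⟨
    length (filter (λ i → lowRankᵇ d i Bool.≟ true) V)           ℕR.≡⟨ length-map H (filter (λ i → lowRankᵇ d i Bool.≟ true) V) ⟨
    length (map H (filter (λ i → lowRankᵇ d i Bool.≟ true) V))
      ℕR.≤⟨ lowRank-upper (suc r) s
              (AllPairsₚ.map⁺ (AllPairs.map (λ i≢j e → i≢j (H-injective e)) (Distinct-filter (lowRankᵇ d) (allFin-distinct N))))
              (Allₚ.map⁺ (All.map (λ {i} h → H-Herm i , proj₂ (lowRankᵇ-elim d i h)) (filter-All (lowRankᵇ d) V))) ⟩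
    suc (suc r) * suc n ^ suc r * q ^ E                          ℕR.∎

  module _ (k<n² : suc k ≤ n * n) where

    private
      total : W ^ suc k ≤ 2 * (G * X)
      total = subst (λ t → t ^ suc k ≤ 2 * (G * X)) N≡W
        (numSubspaces-≥ d (suc k) (subst (q ^ suc k ≤_) (sym N≡W) (ℕₚ.^-monoʳ-≤ q {{q≢0}} k<n²)))

    -- The 4 is one factor 2 for the bases within a subspace and one for the independent tuples of
    -- the whole space; the powers of `W` and the factor `X` cancel.
    good-≤ : Y * (q ^ k * b) ≤ 4 * (W * G)
    good-≤ = ℕₚ.*-cancelʳ-≤ _ _ X {{X≢0}} (ℕR.begin
      Y * (q ^ k * b) * X      ℕR.≡⟨ swap Y (q ^ k * b) X ⟩
      Y * X * (q ^ k * b)      ℕR.≤⟨ subst (λ t → Y * X * (q ^ k * b) ≤ 2 * (t * t ^ suc k)) N≡W (numRankSubspaces-≤ d k) ⟩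
      2 * (W * W ^ suc k)      ℕR.≤⟨ ℕₚ.*-monoʳ-≤ 2 (ℕₚ.*-monoʳ-≤ W total) ⟩
      2 * (W * (2 * (G * X)))  ℕR.≡⟨ regroup W G X ⟩
      4 * (W * G) * X          ℕR.∎)
      where
      swap : ∀ a b c → a * b * c ≡ a * c * b
      swap = solve-∀
      regroup : ∀ w g x → 2 * (w * (2 * (g * x))) ≡ 4 * (w * g) * x
      regroup = solve-∀

    -- Beyond the two factors 2 from counting bases and independent tuples, a third comes from
    -- bounding the number of projective points by `2 * q ^ k`.
    bad-≤ : W * (G ∸ Y) ≤ 8 * (q ^ k * b * G)
    bad-≤ = ℕₚ.*-cancelʳ-≤ _ _ X {{X≢0}} (ℕR.begin
      W * (G ∸ Y) * X                        ℕR.≡⟨ ℕₚ.*-assoc W (G ∸ Y) X ⟩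
      W * ((G ∸ Y) * X)                      ℕR.≤⟨ subst (λ t → t * ((G ∸ Y) * X) ≤ 2 * (2 * q ^ k * (b * t ^ suc k))) N≡W (numBadSubspaces-≤ d k) ⟩
      2 * (2 * q ^ k * (b * W ^ suc k))      ℕR.≤⟨ ℕₚ.*-monoʳ-≤ 2 (ℕₚ.*-monoʳ-≤ (2 * q ^ k) (ℕₚ.*-monoʳ-≤ b total)) ⟩
      2 * (2 * q ^ k * (b * (2 * (G * X))))  ℕR.≡⟨ regroup (q ^ k) b G X ⟩
      8 * (q ^ k * b * G) * X                ℕR.∎)
      where
      regroup : ∀ a b g x → 2 * (2 * a * (b * (2 * (g * x)))) ≡ 8 * (a * b * g) * x
      regroup = solve-∀

    density-≤ : Y * q ^ (suc k + E) ≤ 4 * 2 ^ suc r * G * q ^ (n * n + 1)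
    density-≤ = ℕR.begin
      Y * q ^ (suc k + E)                  ℕR.≡⟨ cong (Y *_) (ℕₚ.^-distribˡ-+-* q (suc k) E) ⟩
      Y * (q * q ^ k * q ^ E)              ℕR.≤⟨ ℕₚ.*-monoʳ-≤ Y (ℕₚ.*-monoʳ-≤ (q * q ^ k) lowRank-≥) ⟩
      Y * (q * q ^ k * (2 ^ suc r * b))    ℕR.≡⟨ regroup Y q (q ^ k) (2 ^ suc r) b ⟩
      q * (2 ^ suc r * (Y * (q ^ k * b)))  ℕR.≤⟨ ℕₚ.*-monoʳ-≤ q (ℕₚ.*-monoʳ-≤ (2 ^ suc r) good-≤) ⟩
      q * (2 ^ suc r * (4 * (W * G)))      ℕR.≡⟨ regroup′ q (2 ^ suc r) W G ⟩
      4 * 2 ^ suc r * G * (W * (q * 1))    ℕR.≡⟨ cong (4 * 2 ^ suc r * G *_) (ℕₚ.^-distribˡ-+-* q (n * n) 1) ⟨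
      4 * 2 ^ suc r * G * q ^ (n * n + 1)  ℕR.∎
      where
      regroup : ∀ y q a c b → y * (q * a * (c * b)) ≡ q * (c * (y * (a * b)))
      regroup = solve-∀
      regroup′ : ∀ q c w g → q * (c * (4 * (w * g))) ≡ 4 * c * g * (w * (q * 1))
      regroup′ = solve-∀

    -- The strict inequality of exponents leaves a spare factor q, so the density is O(1/q).
    density-small : n * n + 1 < suc k + E → Y * q ≤ 4 * 2 ^ suc r * G
    density-small lt = ℕₚ.*-cancelʳ-≤ _ _ (q ^ (n * n + 1)) {{ℕₚ.m^n≢0 q (n * n + 1) {{q≢0}}}} (ℕR.begin
      Y * q * q ^ (n * n + 1)              ℕR.≡⟨ ℕₚ.*-assoc Y q _ ⟩
      Y * q ^ suc (n * n + 1)              ℕR.≤⟨ ℕₚ.*-monoʳ-≤ Y (ℕₚ.^-monoʳ-≤ q {{q≢0}} lt) ⟩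
      Y * q ^ (suc k + E)                  ℕR.≤⟨ density-≤ ⟩
      4 * 2 ^ suc r * G * q ^ (n * n + 1)  ℕR.∎)

    -- By the union bound the complementary density is O(q^(k - n²) |B|) for the shifted index k.
    -- The upper bound on |B| then leaves the spare factor q, as the exponent suc k + E does not
    -- exceed n².
    density-large : suc k + E ≤ n * n → (G ∸ Y) * q ≤ 8 * (suc (suc r) * suc n ^ suc r) * G
    density-large le = ℕₚ.*-cancelˡ-≤ W {{ℕₚ.m^n≢0 q (n * n) {{q≢0}}}} (ℕR.begin
      W * ((G ∸ Y) * q)                    ℕR.≡⟨ swap W (G ∸ Y) q ⟩
      q * (W * (G ∸ Y))                    ℕR.≤⟨ ℕₚ.*-monoʳ-≤ q bad-≤ ⟩
      q * (8 * (q ^ k * b * G))            ℕR.≤⟨ ℕₚ.*-monoʳ-≤ q (ℕₚ.*-monoʳ-≤ 8 (ℕₚ.*-monoˡ-≤ G (ℕₚ.*-monoʳ-≤ (q ^ k) lowRank-≤))) ⟩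
      q * (8 * (q ^ k * (c * q ^ E) * G))  ℕR.≡⟨ regroup q (q ^ k) c (q ^ E) G ⟩
      8 * c * G * (q * q ^ k * q ^ E)      ℕR.≡⟨ cong (8 * c * G *_) (ℕₚ.^-distribˡ-+-* q (suc k) E) ⟨
      8 * c * G * q ^ (suc k + E)          ℕR.≤⟨ ℕₚ.*-monoʳ-≤ (8 * c * G) (ℕₚ.^-monoʳ-≤ q {{q≢0}} le) ⟩
      8 * c * G * W                        ℕR.≡⟨ ℕₚ.*-comm (8 * c * G) W ⟩
      W * (8 * c * G)                      ℕR.∎)
      where
      c : ℕ
      c = suc (suc r) * suc n ^ suc r
      swap : ∀ w g q → w * (g * q) ≡ q * (w * g)
      swap = solve-∀
      regroup : ∀ q a c e g → q * (8 * (a * (c * e) * g)) ≡ 8 * c * g * (q * a * e)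
      regroup = solve-∀

-- The asymptotic statements

private
  -- Turns x / g = O(1/q) into the ε-form of a limit, with ε = 1/(m + 1), once q ≥ C (m + 1).
  ratio-≤ : ∀ C x g q m → .{{_ : NonZero C}} → C * suc m ≤ q → x * q ≤ C * g → x * suc m ≤ g
  ratio-≤ C x g q m big h = ℕₚ.*-cancelˡ-≤ C (begin
    C * (x * suc m)  ≡⟨ swap C x (suc m) ⟩
    x * (C * suc m)  ≤⟨ ℕₚ.*-monoʳ-≤ x big ⟩
    x * q            ≤⟨ h ⟩
    C * g            ∎)
    where
    open ℕₚ.≤-Reasoning
    swap : ∀ a b c → a * (b * c) ≡ b * (a * c)
    swap = solve-∀

  2n∸d+1 : ∀ r t → 2 * (suc r + suc t) ∸ suc (suc r) + 1 ≡ suc r + 2 * suc t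
  2n∸d+1 r t = trans (cong (_+ 1) (trans (cong (_∸ suc (suc r)) (expand r t)) (ℕₚ.m+n∸m≡n (suc (suc r)) (suc r + (2 * t + 1))))) (collect r t)
    where
    expand : ∀ r t → 2 * (suc r + suc t) ≡ suc (suc r) + (suc r + (2 * t + 1))
    expand = solve-∀
    collect : ∀ r t → suc r + (2 * t + 1) + 1 ≡ suc r + 2 * suc t
    collect = solve-∀

  split : ∀ {r n} → suc (suc r) ≤ n → ∃ λ t → suc r + suc t ≡ n
  split {r} h with t , e ← ℕₚ.m≤n⇒∃[o]m+o≡n h = t , trans (ℕₚ.+-suc (suc r) t) e

  -- The truncated difference is positive here, which forces o < n, so no truncation takes place.
  m<n∸o⇒m+o<n : ∀ m n o → m < n ∸ o → m + o < n
  m<n∸o⇒m+o<n m n o lt = ℕₚ.m≤o∸n⇒m+n≤o (suc m) (ℕₚ.<⇒≤ (ℕₚ.m∸n≢0⇒n<m {n} {o} (ℕₚ.m<n⇒n≢0 lt))) lt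

  -- In this direction truncation is harmless, because m ≤ n + (m ∸ n) always holds.
  m∸n<o⇒m<n+o : ∀ m n o → m ∸ n < o → m < n + o
  m∸n<o⇒m<n+o m n o lt = ℕₚ.≤-<-trans (ℕₚ.m≤n+m∸n m n) (ℕₚ.+-monoʳ-< n lt)

  -- The exponent `D` is a separate argument, so that its subtraction-free form can be exchanged for
  -- the one in the theorem by a single `subst`.
  Conclusion : (n d k D : ℕ) → Set₁
  Conclusion n d k D =
    (∃ λ C → ∃ λ Q → ∀ q → IsPrimePower q → Q ≤ q → (F : FiniteField (q * q)) →
    HermitianCounting.numRankSubspaces q F n k d * q ^ (k + D)
    ≤ C * HermitianCounting.numSubspaces q F n k * q ^ (n * n + 1))
    × (k < n * n + 1 ∸ D →
    ∀ m → ∃ λ Q → ∀ q → IsPrimePower q → Q ≤ q → (F : FiniteField (q * q)) →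
    (HermitianCounting.numSubspaces q F n k ∸ HermitianCounting.numRankSubspaces q F n k d) * suc m
    ≤ HermitianCounting.numSubspaces q F n k)
    × (n * n + 1 ∸ D < k →
    ∀ m → ∃ λ Q → ∀ q → IsPrimePower q → Q ≤ q → (F : FiniteField (q * q)) →
    HermitianCounting.numRankSubspaces q F n k d * suc m
    ≤ HermitianCounting.numSubspaces q F n k)

  conclusion : ∀ r s k → suc k ≤ (suc r + s) * (suc r + s) →
               Conclusion (suc r + s) (suc (suc r)) (suc k) (suc r * (suc r + 2 * s))
  conclusion r s k k≤n² =
      (C₀ , 3 , λ q pp 3≤q F → Density.density-≤ q pp 3≤q F r s k k≤n²)
    -- In both limits the summand 3 of the threshold serves the halving estimates, and the other
    -- summand makes q large enough for the ratio to fall below 1/(m + 1).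
    , (λ lt m → 3 + C₁ * suc m , λ q pp big F →
        ratio-≤ C₁ (G q F ∸ Y q F) (G q F) q m {{C₁≢0}} (ℕₚ.≤-trans (ℕₚ.m≤n+m _ 3) big)
          (Density.density-large q pp (ℕₚ.≤-trans (ℕₚ.m≤m+n 3 _) big) F r s k k≤n²
            (ℕₚ.≤-pred (subst (suc k + E <_) (ℕₚ.+-comm (n * n) 1) (m<n∸o⇒m+o<n (suc k) (n * n + 1) E lt)))))
    , (λ lt m → 3 + C₀ * suc m , λ q pp big F →
        ratio-≤ C₀ (Y q F) (G q F) q m {{C₀≢0}} (ℕₚ.≤-trans (ℕₚ.m≤n+m _ 3) big)
          (Density.density-small q pp (ℕₚ.≤-trans (ℕₚ.m≤m+n 3 _) big) F r s k k≤n²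
            (subst (n * n + 1 <_) (ℕₚ.+-comm E (suc k)) (m∸n<o⇒m<n+o (n * n + 1) E (suc k) lt))))
    where
    n E C₀ C₁ : ℕ
    n  = suc r + s
    E  = suc r * (suc r + 2 * s)
    C₀ = 4 * 2 ^ suc r
    C₁ = 8 * (suc (suc r) * suc n ^ suc r)
    G Y : ∀ q → FiniteField (q * q) → ℕ
    G q F = HermitianCounting.numSubspaces q F n (suc k)
    Y q F = HermitianCounting.numRankSubspaces q F n (suc k) (suc (suc r))
    C₀≢0 : NonZero C₀
    C₀≢0 = ℕₚ.m*n≢0 4 (2 ^ suc r) {{_}} {{ℕₚ.m^n≢0 2 (suc r)}}
    C₁≢0 : NonZero C₁
    C₁≢0 = ℕₚ.m*n≢0 8 (suc (suc r) * suc n ^ suc r) {{_}} {{ℕₚ.m*n≢0 (suc (suc r)) (suc n ^ suc r) {{_}} {{ℕₚ.m^n≢0 (suc n) (suc r)}}}}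

theorem6p20 : ∀ (n d k : ℕ) → 2 ≤ n → 2 ≤ d → d ≤ n → 1 ≤ k → k ≤ n * (n ∸ d + 1) →
    (∃ λ C → ∃ λ Q → ∀ q → IsPrimePower q → Q ≤ q → (F : FiniteField (q * q)) →
    HermitianCounting.numRankSubspaces q F n k d * q ^ (k + (d ∸ 1) * (2 * n ∸ d + 1))
    ≤ C * HermitianCounting.numSubspaces q F n k * q ^ (n * n + 1))
    × (k < n * n + 1 ∸ (d ∸ 1) * (2 * n ∸ d + 1) →
    ∀ m → ∃ λ Q → ∀ q → IsPrimePower q → Q ≤ q → (F : FiniteField (q * q)) →
    (HermitianCounting.numSubspaces q F n k ∸ HermitianCounting.numRankSubspaces q F n k d) * suc m
    ≤ HermitianCounting.numSubspaces q F n k)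
    × (n * n + 1 ∸ (d ∸ 1) * (2 * n ∸ d + 1) < k →
    ∀ m → ∃ λ Q → ∀ q → IsPrimePower q → Q ≤ q → (F : FiniteField (q * q)) →
    HermitianCounting.numRankSubspaces q F n k d * suc m
    ≤ HermitianCounting.numSubspaces q F n k)
theorem6p20 n d zero _ _ _ () _
theorem6p20 n (suc zero) (suc k) _ (s≤s ()) _ _ _
theorem6p20 n (suc (suc r)) (suc k) _ _ d≤n _ k≤ = transfer (split d≤n)
  where
  -- From 2 ≤ d ≤ n follows n - d + 1 ≤ n, so the dimension fits into that of the whole space. This
  -- is what makes independent tuples at least half of all tuples there.
  k≤n² : suc k ≤ n * n
  k≤n² = ℕₚ.≤-trans k≤ (ℕₚ.*-monoʳ-≤ n (subst (_≤ n) (ℕₚ.+-comm 1 (n ∸ suc (suc r)))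
    (ℕₚ.∸-monoʳ-< {n} {suc (suc r)} {0} (s≤s z≤n) d≤n)))
  transfer : (∃ λ t → suc r + suc t ≡ n) → Conclusion n (suc (suc r)) (suc k) (suc r * (2 * n ∸ suc (suc r) + 1))
  transfer (t , refl) = subst (Conclusion (suc r + suc t) (suc (suc r)) (suc k))
    (cong (suc r *_) (sym (2n∸d+1 r t))) (conclusion r (suc t) k k≤n²)
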